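{- For any prime power $q$, there exist unit weighing matrices $W_1,\ldots,W_q$ of order $q^2$ and weight $q$ that are mutually quasi-unbiased for the parameters $(q^2,q,q^2,1)$ and such that, for any distinct $i,j\in\{1,\ldots,q\}$, $W_iW_j^*$ is a Bush-type $(q^2,q)$-Butson Hadamard matrix.
   Context: Let $\mathbb{T}=\{c\in\mathbb{C}:|c|=1\}$ and $W^*$ the conjugate transpose. A unit weighing matrix of order $n$ and weight $k$ is an $n\times n$ matrix $W$ with entries in $\{0\}\cup\mathbb{T}$ with $WW^*=kI_n$. Unit weighing matrices $W_1,W_2$ of order $n$ and weight $k$ are quasi-unbiased for parameters $(n,k,l,a)$ if $\frac1{\sqrt a}W_1W_2^*$ is a unit weighing matrix of order $n$ and weight $l$; mutually quasi-unbiased means pairwise. A complex Hadamard matrix of order $n$ is a unit weighing matrix of order $n$ and weight $n$; an $(n,m)$-Butson Hadamard matrix is a complex Hadamard matrix of order $n$ all of whose entries are $m$-th roots of unity. A complex Hadamard matrix $H$ of order $n^2$ is of Bush-type if, partitioned into $n\times n$ blocks $H=(H_{ij})_{i,j=1}^n$, it satisfies $H_{ii}=J_n$ for all $i$ and $H_{ij}J_n=J_nH_{ij}=O_n$ for all $i\neq j$, where $J_n$ is the all-ones matrix and $O_n$ the zero matrix. -}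

module Defs where

open import Algebra.Bundles using (AbelianGroup; CommutativeRing)
open import Algebra.Structures using (IsCommutativeRing)
open import Data.Fin.Base using (Fin; combine)
open import Data.Fin.Properties using (_≟_)
import Data.Integer.Base as ℤ
open import Data.Nat.Base as ℕ using (ℕ)
import Data.Nat.Properties as ℕ
open import Data.Nat.Primality using (Prime)
open import Data.Product.Base using (∃-syntax; _×_; _,_)
open import Data.Sum.Base using (_⊎_)
open import Level using (Level; 0ℓ)
open import Relation.Binary.Bundles using (Setoid)
open import Relation.Binary.Structures using (IsEquivalence)
open import Relation.Binary.PropositionalEquality
  using (_≡_; _≢_; refl; sym; trans; cong; cong₂; subst)
open import Relation.Nullary.Decidable using (yes; no)

------------------------------------------------------------------------
-- The ring R[i] over a commutative ring R

module Gaussian {a ℓ : Level} (R : CommutativeRing a ℓ) where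

  private
    module R = CommutativeRing R
    open R using () renaming
      (Carrier to A; _≈_ to _≈₀_; _+_ to _⊕_; _*_ to _⊛_; -_ to ⊖_)

    open import Algebra.Properties.Ring R.ring using (-0#≈0#; -1*x≈-x)
    open import Algebra.Solver.Ring.NaturalCoefficients.Default R.commutativeSemiring
      using (solve; _:+_; _:*_; _:=_)

    -- The solver is for semirings, so negation is presented to it as
    -- multiplication by a variable.
    e : A
    e = ⊖ R.1#

    neg : ∀ x → ⊖ x ≈₀ e ⊛ x
    neg x = R.sym (-1*x≈-x x)

    assoc-re : ∀ x y u v s t →
      (x ⊛ u ⊕ (⊖ (y ⊛ v))) ⊛ s ⊕ (⊖ ((x ⊛ v ⊕ y ⊛ u) ⊛ t)) ≈₀
      x ⊛ (u ⊛ s ⊕ (⊖ (v ⊛ t))) ⊕ (⊖ (y ⊛ (u ⊛ t ⊕ v ⊛ s)))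
    assoc-re x y u v s t =
      R.trans (R.+-cong (R.*-congʳ (R.+-congˡ (neg _))) (neg _))
      (R.trans (solve 7 (λ e x y u v s t →
          (x :* u :+ e :* (y :* v)) :* s :+ e :* ((x :* v :+ y :* u) :* t) :=
          x :* (u :* s :+ e :* (v :* t)) :+ e :* (y :* (u :* t :+ v :* s)))
        R.refl e x y u v s t)
      (R.sym (R.+-cong (R.*-congˡ (R.+-congˡ (neg _))) (neg _))))

    assoc-im : ∀ x y u v s t →
      (x ⊛ u ⊕ (⊖ (y ⊛ v))) ⊛ t ⊕ (x ⊛ v ⊕ y ⊛ u) ⊛ s ≈₀
      x ⊛ (u ⊛ t ⊕ v ⊛ s) ⊕ y ⊛ (u ⊛ s ⊕ (⊖ (v ⊛ t)))
    assoc-im x y u v s t =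
      R.trans (R.+-congʳ (R.*-congʳ (R.+-congˡ (neg _))))
      (R.trans (solve 7 (λ e x y u v s t →
          (x :* u :+ e :* (y :* v)) :* t :+ (x :* v :+ y :* u) :* s :=
          x :* (u :* t :+ v :* s) :+ y :* (u :* s :+ e :* (v :* t)))
        R.refl e x y u v s t)
      (R.sym (R.+-congˡ (R.*-congˡ (R.+-congˡ (neg _))))))

    distribˡ-re : ∀ x y u v s t →
      x ⊛ (u ⊕ s) ⊕ (⊖ (y ⊛ (v ⊕ t))) ≈₀
      (x ⊛ u ⊕ (⊖ (y ⊛ v))) ⊕ (x ⊛ s ⊕ (⊖ (y ⊛ t)))
    distribˡ-re x y u v s t =
      R.trans (R.+-congˡ (neg _))
      (R.trans (solve 7 (λ e x y u v s t →
          x :* (u :+ s) :+ e :* (y :* (v :+ t)) :=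
          (x :* u :+ e :* (y :* v)) :+ (x :* s :+ e :* (y :* t)))
        R.refl e x y u v s t)
      (R.sym (R.+-cong (R.+-congˡ (neg _)) (R.+-congˡ (neg _)))))

    distribˡ-im : ∀ x y u v s t →
      x ⊛ (v ⊕ t) ⊕ y ⊛ (u ⊕ s) ≈₀ (x ⊛ v ⊕ y ⊛ u) ⊕ (x ⊛ t ⊕ y ⊛ s)
    distribˡ-im = solve 6 (λ x y u v s t →
      x :* (v :+ t) :+ y :* (u :+ s) :=
      (x :* v :+ y :* u) :+ (x :* t :+ y :* s)) R.refl

  infix 5 _+i_

  record Complex : Set a where
    constructor _+i_
    field
      re im : A

  open Complex public

  infix  4 _≈ᶜ_
  infixl 6 _+ᶜ_
  infixl 7 _*ᶜ_
  infix  8 -ᶜ_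

  record _≈ᶜ_ (z w : Complex) : Set ℓ where
    constructor _,_
    field
      re-≈ : re z ≈₀ re w
      im-≈ : im z ≈₀ im w

  open _≈ᶜ_ public

  _+ᶜ_ _*ᶜ_ : Complex → Complex → Complex
  z +ᶜ w = (re z ⊕ re w) +i (im z ⊕ im w)
  z *ᶜ w = (re z ⊛ re w ⊕ (⊖ (im z ⊛ im w))) +i (re z ⊛ im w ⊕ im z ⊛ re w)

  -ᶜ_ : Complex → Complex
  -ᶜ z = (⊖ re z) +i (⊖ im z)

  fromReal : A → Complex
  fromReal x = x +i R.0#

  conj : Complex → Complex
  conj z = re z +i (⊖ im z)

  ∣_∣² : Complex → A
  ∣ z ∣² = re z ⊛ re z ⊕ im z ⊛ im z

  private
    ≈ᶜ-isEquivalence : IsEquivalence _≈ᶜ_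
    ≈ᶜ-isEquivalence = record
      { refl  = R.refl , R.refl
      ; sym   = λ p → R.sym (re-≈ p) , R.sym (im-≈ p)
      ; trans = λ p q → R.trans (re-≈ p) (re-≈ q) , R.trans (im-≈ p) (im-≈ q)
      }

    ≈ᶜ-setoid : Setoid a ℓ
    ≈ᶜ-setoid = record { isEquivalence = ≈ᶜ-isEquivalence }

    open import Algebra.Consequences.Setoid ≈ᶜ-setoid
      using (comm∧idˡ⇒id; comm∧distrˡ⇒distr)

    +ᶜ-cong : ∀ {x y u v} → x ≈ᶜ y → u ≈ᶜ v → x +ᶜ u ≈ᶜ y +ᶜ v
    +ᶜ-cong p q = R.+-cong (re-≈ p) (re-≈ q) , R.+-cong (im-≈ p) (im-≈ q)

    *ᶜ-comm : ∀ z w → z *ᶜ w ≈ᶜ w *ᶜ z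
    *ᶜ-comm z w =
        R.+-cong (R.*-comm _ _) (R.-‿cong (R.*-comm _ _))
      , R.trans (R.+-comm _ _) (R.+-cong (R.*-comm _ _) (R.*-comm _ _))

    *ᶜ-identityˡ : ∀ z → fromReal R.1# *ᶜ z ≈ᶜ z
    *ᶜ-identityˡ z =
        R.trans (R.+-cong (R.*-identityˡ _) (R.trans (R.-‿cong (R.zeroˡ _)) -0#≈0#))
                (R.+-identityʳ _)
      , R.trans (R.+-cong (R.*-identityˡ _) (R.zeroˡ _)) (R.+-identityʳ _)

  isCommutativeRing : IsCommutativeRing _≈ᶜ_ _+ᶜ_ _*ᶜ_ -ᶜ_
    (fromReal R.0#) (fromReal R.1#)
  isCommutativeRing = record
    { isRing = record
      { +-isAbelianGroup = record
        { isGroup = record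
          { isMonoid = record
            { isSemigroup = record
              { isMagma = record
                { isEquivalence = ≈ᶜ-isEquivalence
                ; ∙-cong = +ᶜ-cong
                }
              ; assoc = λ x y z → R.+-assoc _ _ _ , R.+-assoc _ _ _
              }
            ; identity = (λ z → R.+-identityˡ _ , R.+-identityˡ _)
                       , (λ z → R.+-identityʳ _ , R.+-identityʳ _)
            }
          ; inverse = (λ z → R.-‿inverseˡ _ , R.-‿inverseˡ _)
                    , (λ z → R.-‿inverseʳ _ , R.-‿inverseʳ _)
          ; ⁻¹-cong = λ p → R.-‿cong (re-≈ p) , R.-‿cong (im-≈ p)
          }
        ; comm = λ z w → R.+-comm _ _ , R.+-comm _ _
        }
      ; *-cong = λ p q →
            R.+-cong (R.*-cong (re-≈ p) (re-≈ q))
                     (R.-‿cong (R.*-cong (im-≈ p) (im-≈ q)))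
          , R.+-cong (R.*-cong (re-≈ p) (im-≈ q)) (R.*-cong (im-≈ p) (re-≈ q))
      ; *-assoc = λ x y z →
            assoc-re (re x) (im x) (re y) (im y) (re z) (im z)
          , assoc-im (re x) (im x) (re y) (im y) (re z) (im z)
      ; *-identity = comm∧idˡ⇒id *ᶜ-comm *ᶜ-identityˡ
      ; distrib = comm∧distrˡ⇒distr +ᶜ-cong *ᶜ-comm (λ x y z →
            distribˡ-re (re x) (im x) (re y) (im y) (re z) (im z)
          , distribˡ-im (re x) (im x) (re y) (im y) (re z) (im z))
      }
    ; *-comm = *ᶜ-comm
    }

  commutativeRing : CommutativeRing a ℓ
  commutativeRing = record { isCommutativeRing = isCommutativeRing }

------------------------------------------------------------------------
-- Real numbers

open import Data.Rational.Base
open import Data.Rational.Properties hiding (_≟_)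

-- Cauchy sequences of rationals, identified when their difference tends
-- to zero.  No modulus or rate of convergence is fixed, so the algebraic
-- operations are pointwise.

Close : ℚ → ℚ → ℚ → Set
Close ε p q = ∣ p - q ∣ < ε

IsCauchy : (ℕ → ℚ) → Set
IsCauchy x = ∀ ε → 0ℚ < ε →
  ∃[ N ] (∀ m n → N ℕ.≤ m → N ℕ.≤ n → Close ε (x m) (x n))

record ℝ : Set where
  constructor mkℝ
  field
    seq    : ℕ → ℚ
    cauchy : IsCauchy seq

open ℝ public

infix 4 _≈ᵣ_

record _≈ᵣ_ (x y : ℝ) : Set where
  constructor mk≈
  field
    close : ∀ ε → 0ℚ < ε →
      ∃[ N ] (∀ n → N ℕ.≤ n → Close ε (seq x n) (seq y n))

open _≈ᵣ_ public

-- Strict positivity: eventually bounded below by a positive rational.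
Positiveᵣ : ℝ → Set
Positiveᵣ x = ∃[ ε ] (0ℚ < ε × ∃[ N ] (∀ n → N ℕ.≤ n → ε ≤ seq x n))

private
  open import Algebra.Properties.CommutativeSemigroup
    (AbelianGroup.commutativeSemigroup +-0-abelianGroup) using (interchange)
  open import Algebra.Properties.AbelianGroup +-0-abelianGroup
    using (⁻¹-anti-homo‿-)

  telescope : ∀ p q r → (p - q) + (q - r) ≡ p - r
  telescope p q r = trans (+-assoc p (- q) (q - r)) (cong (p +_)
    (trans (sym (+-assoc (- q) q (- r)))
      (trans (cong (_- r) (+-inverseˡ q)) (+-identityˡ (- r)))))

  +-difference : ∀ p q r s → (p - q) + (r - s) ≡ (p + r) - (q + s)
  +-difference p q r s = trans (interchange p (- q) r (- s))
    (cong ((p + r) +_) (sym (neg-distrib-+ q s)))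

  *-difference : ∀ p q r → p * (q - r) ≡ p * q - p * r
  *-difference p q r = trans (*-distribˡ-+ p q (- r))
    (cong (p * q +_) (sym (neg-distribʳ-* p r)))

  half : ∀ {ε} → 0ℚ < ε → 0ℚ < ½ * ε
  half {ε} 0<ε = subst (_< ½ * ε) (*-zeroʳ ½) (*-monoʳ-<-pos ½ 0<ε)

  half+half : ∀ ε → ½ * ε + ½ * ε ≡ ε
  half+half ε = trans (sym (*-distribʳ-+ ε ½ ½)) (*-identityˡ ε)

  close-refl : ∀ {ε} p → 0ℚ < ε → Close ε p p
  close-refl {ε} p 0<ε = subst (_< ε) (sym (cong ∣_∣ (+-inverseʳ p))) 0<ε

  close-sym : ∀ {ε} p q → Close ε p q → Close ε q p
  close-sym {ε} p q = subst (_< ε)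
    (trans (sym (∣-p∣≡∣p∣ (p - q))) (cong ∣_∣ (⁻¹-anti-homo‿- p q)))

  sum-close : ∀ {ε} p q → ∣ p ∣ < ½ * ε → ∣ q ∣ < ½ * ε → ∣ p + q ∣ < ε
  sum-close {ε} p q p<ε/2 q<ε/2 = subst (∣ p + q ∣ <_) (half+half ε)
    (≤-<-trans (∣p+q∣≤∣p∣+∣q∣ p q) (+-mono-< p<ε/2 q<ε/2))

  +-close : ∀ {ε} p q r s → Close (½ * ε) p q → Close (½ * ε) r s →
            Close ε (p + r) (q + s)
  +-close {ε} p q r s p~q r~s =
    subst (λ d → ∣ d ∣ < ε) (+-difference p q r s)
      (sum-close (p - q) (r - s) p~q r~s)

  neg-close : ∀ {ε} p q → Close ε p q → Close ε (- p) (- q)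
  neg-close {ε} p q = subst (_< ε)
    (trans (sym (∣-p∣≡∣p∣ (p - q))) (cong ∣_∣ (neg-distrib-+ p (- q))))

  close-trans : ∀ {ε} p q r → Close (½ * ε) p q → Close (½ * ε) q r → Close ε p r
  close-trans {ε} p q r p~q q~r =
    subst (λ d → ∣ d ∣ < ε) (telescope p q r) (sum-close (p - q) (q - r) p~q q~r)

  *-small : ∀ B δ p q → 0ℚ < B → ∣ p ∣ < B → ∣ q ∣ < δ → ∣ p * q ∣ < B * δ
  *-small B δ p q 0<B p<B q<δ = subst (_< B * δ) (sym (∣p*q∣≡∣p∣*∣q∣ p q))
    (≤-<-trans (*-monoʳ-≤-nonNeg ∣ q ∣ (<⇒≤ p<B)) (*-monoʳ-<-pos B q<δ))
    where instance
    _ = ∣-∣-nonNeg q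
    _ = positive 0<B

  *-close : ∀ {ε} B δ p q r s → 0ℚ < B → B * δ ≡ ½ * ε →
            ∣ p ∣ < B → ∣ s ∣ < B → Close δ p q → Close δ r s →
            Close ε (p * r) (q * s)
  *-close {ε} B δ p q r s 0<B Bδ p<B s<B p~q r~s =
    subst (λ d → ∣ d ∣ < ε) eq
      (sum-close (p * (r - s)) (s * (p - q))
        (subst (∣ p * (r - s) ∣ <_) Bδ (*-small B δ p (r - s) 0<B p<B r~s))
        (subst (∣ s * (p - q) ∣ <_) Bδ (*-small B δ s (p - q) 0<B s<B p~q)))
    where
    eq : p * (r - s) + s * (p - q) ≡ p * r - q * s
    eq = trans
      (cong₂ _+_ (*-difference p r s)
        (trans (*-difference s p q) (cong₂ _-_ (*-comm s p) (*-comm s q))))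
      (telescope (p * r) (p * s) (q * s))

  Bound : (ℕ → ℚ) → ℚ → ℕ → Set
  Bound x B N = ∀ n → N ℕ.≤ n → ∣ x n ∣ < B

  bounded : ∀ x → ∃[ B ] ∃[ N ] (0ℚ < B × Bound (seq x) B N)
  bounded x =
    let N , f = cauchy x 1ℚ (positive⁻¹ 1ℚ) in
      1ℚ + ∣ seq x N ∣ , N
    , +-mono-<-≤ (positive⁻¹ 1ℚ) (0≤∣p∣ (seq x N))
    , λ n N≤n → ≤-<-trans
        (subst (λ d → ∣ d ∣ ≤ ∣ seq x n - seq x N ∣ + ∣ seq x N ∣)
          (cancel (seq x n) (seq x N))
          (∣p+q∣≤∣p∣+∣q∣ (seq x n - seq x N) (seq x N)))
        (+-monoˡ-< ∣ seq x N ∣ (f n N N≤n ℕ.≤-refl))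
    where
    cancel : ∀ p q → (p - q) + q ≡ p
    cancel p q = trans (+-assoc p (- q) q)
      (trans (cong (p +_) (+-inverseˡ q)) (+-identityʳ p))

  commonBound : ∀ x y → ∃[ B ] ∃[ N ]
    (0ℚ < B × Bound (seq x) B N × Bound (seq y) B N)
  commonBound x y =
    let B , M , 0<B , x<B = bounded x
        C , N , 0<C , y<C = bounded y
    in B + C , M ℕ.⊔ N , +-mono-< 0<B 0<C
    , (λ n le → <-trans (x<B n (ℕ.m⊔n≤o⇒m≤o M N le))
        (subst (_< B + C) (+-identityʳ B) (+-monoʳ-< B 0<C)))
    , (λ n le → <-trans (y<C n (ℕ.m⊔n≤o⇒n≤o M N le))
        (subst (_< B + C) (+-identityˡ C) (+-monoˡ-< C 0<B)))

  scale : ∀ {ε} B → 0ℚ < ε → 0ℚ < B → ∃[ δ ] (0ℚ < δ × B * δ ≡ ½ * ε)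
  scale {ε} B 0<ε 0<B =
    1/ B * (½ * ε) ,
    positive⁻¹ _ ⦃ pos*pos⇒pos (1/ B) (½ * ε) ⦄ ,
    trans (sym (*-assoc B (1/ B) (½ * ε)))
      (trans (cong (_* (½ * ε)) (*-inverseʳ B)) (*-identityˡ _))
    where instance
    _ = positive 0<B
    _ = pos⇒nonZero B
    _ = 1/pos⇒pos B
    _ = positive (half 0<ε)

  abstract
    const-cauchy : ∀ p → IsCauchy (λ _ → p)
    const-cauchy p ε 0<ε = 0 , λ _ _ _ _ → close-refl p 0<ε

    +-cauchy : ∀ x y → IsCauchy (λ n → seq x n + seq y n)
    +-cauchy x y ε 0<ε =
      let M , f = cauchy x (½ * ε) (half 0<ε)
          N , g = cauchy y (½ * ε) (half 0<ε)
      in M ℕ.⊔ N , λ m n le le′ →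
        +-close (seq x m) (seq x n) (seq y m) (seq y n)
          (f m n (ℕ.m⊔n≤o⇒m≤o M N le) (ℕ.m⊔n≤o⇒m≤o M N le′))
          (g m n (ℕ.m⊔n≤o⇒n≤o M N le) (ℕ.m⊔n≤o⇒n≤o M N le′))

    neg-cauchy : ∀ x → IsCauchy (λ n → - seq x n)
    neg-cauchy x ε 0<ε =
      let N , f = cauchy x ε 0<ε
      in N , λ m n le le′ → neg-close (seq x m) (seq x n) (f m n le le′)

    *-cauchy : ∀ x y → IsCauchy (λ n → seq x n * seq y n)
    *-cauchy x y ε 0<ε =
      let B , L , 0<B , x<B , y<B = commonBound x y
          δ , 0<δ , Bδ = scale B 0<ε 0<B
          M , f = cauchy x δ 0<δ
          N , g = cauchy y δ 0<δ
      in L ℕ.⊔ (M ℕ.⊔ N) , λ m n le le′ →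
        let le₂  = ℕ.m⊔n≤o⇒n≤o L (M ℕ.⊔ N) le
            le₂′ = ℕ.m⊔n≤o⇒n≤o L (M ℕ.⊔ N) le′
        in *-close B δ (seq x m) (seq x n) (seq y m) (seq y n) 0<B Bδ
             (x<B m (ℕ.m⊔n≤o⇒m≤o L (M ℕ.⊔ N) le))
             (y<B n (ℕ.m⊔n≤o⇒m≤o L (M ℕ.⊔ N) le′))
             (f m n (ℕ.m⊔n≤o⇒m≤o M N le₂) (ℕ.m⊔n≤o⇒m≤o M N le₂′))
             (g m n (ℕ.m⊔n≤o⇒n≤o M N le₂) (ℕ.m⊔n≤o⇒n≤o M N le₂′))

ι : ℚ → ℝ
ι p = mkℝ (λ _ → p) (const-cauchy p)

infixl 6 _+ᵣ_
infixl 7 _*ᵣ_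
infix  8 -ᵣ_

_+ᵣ_ : ℝ → ℝ → ℝ
x +ᵣ y = mkℝ (λ n → seq x n + seq y n) (+-cauchy x y)

-ᵣ_ : ℝ → ℝ
-ᵣ x = mkℝ (λ n → - seq x n) (neg-cauchy x)

_*ᵣ_ : ℝ → ℝ → ℝ
x *ᵣ y = mkℝ (λ n → seq x n * seq y n) (*-cauchy x y)

private
  pointwise : ∀ {x y} → (∀ n → seq x n ≡ seq y n) → x ≈ᵣ y
  pointwise {x} eq = mk≈ λ ε 0<ε → 0 , λ n _ →
    subst (Close ε (seq x n)) (eq n) (close-refl (seq x n) 0<ε)

  abstract
    ≈ᵣ-sym : ∀ {x y} → x ≈ᵣ y → y ≈ᵣ x
    ≈ᵣ-sym {x} {y} x≈y = mk≈ λ ε 0<ε →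
      let N , f = close x≈y ε 0<ε
      in N , λ n le → close-sym (seq x n) (seq y n) (f n le)

    ≈ᵣ-trans : ∀ {x y z} → x ≈ᵣ y → y ≈ᵣ z → x ≈ᵣ z
    ≈ᵣ-trans {x} {y} {z} x≈y y≈z = mk≈ λ ε 0<ε →
      let M , f = close x≈y (½ * ε) (half 0<ε)
          N , g = close y≈z (½ * ε) (half 0<ε)
      in M ℕ.⊔ N , λ n le →
        close-trans (seq x n) (seq y n) (seq z n)
          (f n (ℕ.m⊔n≤o⇒m≤o M N le)) (g n (ℕ.m⊔n≤o⇒n≤o M N le))

    +ᵣ-cong : ∀ {x y u v} → x ≈ᵣ y → u ≈ᵣ v → x +ᵣ u ≈ᵣ y +ᵣ v
    +ᵣ-cong {x} {y} {u} {v} x≈y u≈v = mk≈ λ ε 0<ε →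
      let M , f = close x≈y (½ * ε) (half 0<ε)
          N , g = close u≈v (½ * ε) (half 0<ε)
      in M ℕ.⊔ N , λ n le →
        +-close (seq x n) (seq y n) (seq u n) (seq v n)
          (f n (ℕ.m⊔n≤o⇒m≤o M N le)) (g n (ℕ.m⊔n≤o⇒n≤o M N le))

    -ᵣ-cong : ∀ {x y} → x ≈ᵣ y → -ᵣ x ≈ᵣ -ᵣ y
    -ᵣ-cong {x} {y} x≈y = mk≈ λ ε 0<ε →
      let N , f = close x≈y ε 0<ε
      in N , λ n le → neg-close (seq x n) (seq y n) (f n le)

    *ᵣ-cong : ∀ {x y u v} → x ≈ᵣ y → u ≈ᵣ v → x *ᵣ u ≈ᵣ y *ᵣ v
    *ᵣ-cong {x} {y} {u} {v} x≈y u≈v = mk≈ λ ε 0<ε →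
      let B , L , 0<B , x<B , v<B = commonBound x v
          δ , 0<δ , Bδ = scale B 0<ε 0<B
          M , f = close x≈y δ 0<δ
          N , g = close u≈v δ 0<δ
      in L ℕ.⊔ (M ℕ.⊔ N) , λ n le →
        let le₁ = ℕ.m⊔n≤o⇒m≤o L (M ℕ.⊔ N) le
            le₂ = ℕ.m⊔n≤o⇒n≤o L (M ℕ.⊔ N) le
        in *-close B δ (seq x n) (seq y n) (seq u n) (seq v n) 0<B Bδ
             (x<B n le₁) (v<B n le₁)
             (f n (ℕ.m⊔n≤o⇒m≤o M N le₂)) (g n (ℕ.m⊔n≤o⇒n≤o M N le₂))

ℝ-isCommutativeRing : IsCommutativeRing _≈ᵣ_ _+ᵣ_ _*ᵣ_ -ᵣ_ (ι 0ℚ) (ι 1ℚ)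
ℝ-isCommutativeRing = record
  { isRing = record
    { +-isAbelianGroup = record
      { isGroup = record
        { isMonoid = record
          { isSemigroup = record
            { isMagma = record
              { isEquivalence = record
                { refl = pointwise (λ _ → refl) ; sym = ≈ᵣ-sym ; trans = ≈ᵣ-trans }
              ; ∙-cong = +ᵣ-cong
              }
            ; assoc = λ x y z →
                pointwise (λ n → +-assoc (seq x n) (seq y n) (seq z n))
            }
          ; identity = (λ x → pointwise (λ n → +-identityˡ (seq x n)))
                     , (λ x → pointwise (λ n → +-identityʳ (seq x n)))
          }
        ; inverse = (λ x → pointwise (λ n → +-inverseˡ (seq x n)))
                  , (λ x → pointwise (λ n → +-inverseʳ (seq x n)))
        ; ⁻¹-cong = -ᵣ-cong
        }
      ; comm = λ x y → pointwise (λ n → +-comm (seq x n) (seq y n))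
      }
    ; *-cong = *ᵣ-cong
    ; *-assoc = λ x y z →
        pointwise (λ n → *-assoc (seq x n) (seq y n) (seq z n))
    ; *-identity = (λ x → pointwise (λ n → *-identityˡ (seq x n)))
                 , (λ x → pointwise (λ n → *-identityʳ (seq x n)))
    ; distrib =
        (λ x y z → pointwise (λ n → *-distribˡ-+ (seq x n) (seq y n) (seq z n)))
      , (λ x y z → pointwise (λ n → *-distribʳ-+ (seq x n) (seq y n) (seq z n)))
    }
  ; *-comm = λ x y → pointwise (λ n → *-comm (seq x n) (seq y n))
  }

ℝ-commutativeRing : CommutativeRing 0ℓ 0ℓ
ℝ-commutativeRing = record { isCommutativeRing = ℝ-isCommutativeRing }

------------------------------------------------------------------------
-- Complex numbers

open Gaussian ℝ-commutativeRing public
  using (_+i_; re; im; fromReal; conj; ∣_∣²)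
  renaming (commutativeRing to ℂ-commutativeRing)

open CommutativeRing ℂ-commutativeRing public
  using () renaming
  ( Carrier to ℂ; _≈_ to _≈ᶜ_; _+_ to _+ᶜ_; _*_ to _*ᶜ_; -_ to -ᶜ_
  ; 0# to 0ᶜ; 1# to 1ᶜ
  )

open import Algebra.Properties.Semiring.Sum
  (CommutativeRing.semiring ℂ-commutativeRing) public using () renaming (sum to Σᶜ)
open import Algebra.Properties.Semiring.Exp
  (CommutativeRing.semiring ℂ-commutativeRing) public using () renaming (_^_ to _^ᶜ_)

fromℕ : ℕ → ℂ
fromℕ n = fromReal (ι (ℤ.+ n / 1))

-- |c| = 1, squared to avoid the square root in |c| = √((re c)² + (im c)²).
𝕋 : ℂ → Set
𝕋 c = ∣ c ∣² ≈ᵣ ι 1ℚ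

------------------------------------------------------------------------
-- Matrices

Matrix : ℕ → Set
Matrix n = Fin n → Fin n → ℂ

infix  4 _≋_
infixl 7 _·_
infixr 7 _•_
infix  9 _⁎

_≋_ : ∀ {n} → Matrix n → Matrix n → Set
A ≋ B = ∀ i j → A i j ≈ᶜ B i j

_·_ : ∀ {n} → Matrix n → Matrix n → Matrix n
(A · B) i j = Σᶜ (λ k → A i k *ᶜ B k j)

_•_ : ∀ {n} → ℂ → Matrix n → Matrix n
(c • A) i j = c *ᶜ A i j

_⁎ : ∀ {n} → Matrix n → Matrix n
(A ⁎) i j = conj (A j i)

I J O : ∀ n → Matrix n
I n i j with i ≟ j
... | yes _ = 1ᶜ
... | no  _ = 0ᶜ
J n _ _ = 1ᶜ
O n _ _ = 0ᶜ

------------------------------------------------------------------------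
-- Weighing and Hadamard matrices

record IsUnitWeighing (n k : ℕ) (W : Matrix n) : Set where
  field
    entries : ∀ i j → (W i j ≈ᶜ 0ᶜ) ⊎ 𝕋 (W i j)
    weight  : W · W ⁎ ≋ fromℕ k • I n

-- r is 1/√a.
record IsQuasiUnbiased (n k l : ℕ) (a : ℝ) (W₁ W₂ : Matrix n) : Set where
  field
    unitWeighing₁ : IsUnitWeighing n k W₁
    unitWeighing₂ : IsUnitWeighing n k W₂
    r             : ℝ
    r-positive    : Positiveᵣ r
    r²a≈1         : r *ᵣ r *ᵣ a ≈ᵣ ι 1ℚ
    product       : IsUnitWeighing n l (fromReal r • (W₁ · W₂ ⁎))

IsComplexHadamard : ∀ n → Matrix n → Set
IsComplexHadamard n = IsUnitWeighing n n

record IsButson (n m : ℕ) (H : Matrix n) : Set where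
  field
    complexHadamard : IsComplexHadamard n H
    entries         : ∀ i j → H i j ^ᶜ m ≈ᶜ 1ᶜ

-- combine i a = i n + a, so i is the block and a the position inside it.
block : ∀ {n} → Matrix (n ℕ.* n) → Fin n → Fin n → Matrix n
block H i j a b = H (combine i a) (combine j b)

record IsBushType (n : ℕ) (H : Matrix (n ℕ.* n)) : Set where
  field
    complexHadamard : IsComplexHadamard (n ℕ.* n) H
    diagonal        : ∀ i → block H i i ≋ J n
    offDiagonalʳ    : ∀ i j → i ≢ j → block H i j · J n ≋ O n
    offDiagonalˡ    : ∀ i j → i ≢ j → J n · block H i j ≋ O n

IsPrimePower : ℕ → Set
IsPrimePower q = ∃[ p ] ∃[ e ] (Prime p × 1 ℕ.≤ e × q ≡ p ℕ.^ e)

{-# OPTIONS --safe #-}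
-- Let F be the Fourier matrix of (ℤ/p)ᵉ.  Row (x , a) of the i-th weighing
-- matrix is row x of F written along the line v = i u + a of the affine plane
-- over the field with q = pᵉ elements.  Lines of distinct slopes i and j meet
-- in one point, so an entry of W_i W_j* is a single product F x u · conj (F y u),
-- where u is the abscissa of the meeting point; it is 1 for x = y, and along a
-- row or a column of a block u runs once through the field, so that the
-- orthogonality of the rows of F gives everything else.
--
-- The field is a quotient of R = 𝔽ₚ[x]/(x^(q-1) - 1).  All y in R satisfy
-- y^q = y, hence powers y^(q-1) are idempotent, and refining an idempotent by
-- all of them yields one whose summand is a field.  The refinement starts from
-- u = ∏ (x^(pᵈ) - x), 1 ≤ d < e, which is nonzero because it is monic of degree
-- less than q - 1.  So x keeps e distinct conjugates and the field has q elements.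
--
-- A primitive p-th root of unity is (u + i)² / (1 + u²) where u is a real zero of
-- Im (u + i)ᵖ, found by bisection.  A change of sign occurs because the powers of
-- N + i advance by a small angle and eventually cross the real axis.
module Submission where

-- No irreducible polynomial of degree e has to be exhibited. As x^q = x and Frobenius is additive,
-- R is a finite product of subfields of the field with q elements. Some factors are proper
-- subfields (x = 1 gives 𝔽ₚ), so an arbitrary minimal idempotent would not do; u vanishes on
-- exactly those factors where x has fewer than e conjugates. Equality in R is decidable, which
-- turns the refinement into an algorithm. Equality and sign of real numbers cannot be decided, and
-- this shapes the analytic half. Bisection tests signs at rational points only, where Im (u + i)ᵖ
-- is rational, and the change of sign that starts it comes from integer arithmetic with the powers
-- of N + i. Division is harmless because 1 + u² is at least 1. Primitivity costs nothing: for g = u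
-- + i with conjugate ḡ, ω - 1 = (g - ḡ) / ḡ = 2i / ḡ is invertible whichever zero u is found, and
-- for prime p the invertibility of ω - 1 is enough to make the character sums vanish.

-- Ring solver with integer coefficients for an arbitrary commutative ring.

module IntegerCoefficients where

  open import Algebra.Bundles using (CommutativeRing)
  open import Level using (Level)
  import Algebra.Properties.AbelianGroup
  import Algebra.Properties.Ring
  import Algebra.Properties.Semiring.Mult
  import Algebra.Solver.Ring
  open import Algebra.Solver.Ring.AlmostCommutativeRing
    using (fromCommutativeRing; _-Raw-AlmostCommutative⟶_)
  open import Data.Integer.Base as ℤ using (ℤ; +_; -[1+_]; _⊖_)
  import Data.Integer.Properties as ℤ
  open import Data.Maybe.Base using (Maybe; just; nothing)
  open import Data.Nat.Base as ℕ using (ℕ; zero; suc)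
  import Data.Nat.Properties as ℕ
  open import Relation.Binary.PropositionalEquality as ≡ using (_≡_)
  open import Relation.Nullary.Decidable using (yes; no)

  module IntegerSolver {a ℓ : Level} (R : CommutativeRing a ℓ) where

    open CommutativeRing R
    open Algebra.Properties.Ring ring using (-‿distribˡ-*; -‿distribʳ-*)
    open Algebra.Properties.AbelianGroup +-abelianGroup
      using (⁻¹-∙-comm; ⁻¹-involutive; ε⁻¹≈ε)
    open Algebra.Properties.Semiring.Mult semiring using (_×_; ×-homo-+; ×1-homo-*)
    open import Relation.Binary.Reasoning.Setoid setoid

    fromℤ : ℤ → Carrier
    fromℤ (+ n)      = n × 1#
    fromℤ -[1+ n ]   = - (suc n × 1#)

    fromℤ-⊖ : ∀ m n → fromℤ (m ⊖ n) ≈ m × 1# + - (n × 1#)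
    fromℤ-⊖ m zero = sym (trans (+-congˡ ε⁻¹≈ε) (+-identityʳ _))
    fromℤ-⊖ zero (suc n) = sym (+-identityˡ _)
    fromℤ-⊖ (suc m) (suc n) = begin
      fromℤ (suc m ⊖ suc n)                       ≡⟨ ≡.cong fromℤ (ℤ.[1+m]⊖[1+n]≡m⊖n m n) ⟩
      fromℤ (m ⊖ n)                               ≈⟨ fromℤ-⊖ m n ⟩
      m × 1# + - (n × 1#)                         ≈⟨ +-identityˡ _ ⟨
      0# + (m × 1# + - (n × 1#))                  ≈⟨ +-congʳ (-‿inverseʳ 1#) ⟨
      (1# + - 1#) + (m × 1# + - (n × 1#))         ≈⟨ +-assoc _ _ _ ⟩
      1# + (- 1# + (m × 1# + - (n × 1#)))         ≈⟨ +-congˡ (+-assoc _ _ _) ⟨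
      1# + ((- 1# + m × 1#) + - (n × 1#))         ≈⟨ +-congˡ (+-congʳ (+-comm _ _)) ⟩
      1# + ((m × 1# + - 1#) + - (n × 1#))         ≈⟨ +-congˡ (+-assoc _ _ _) ⟩
      1# + (m × 1# + (- 1# + - (n × 1#)))         ≈⟨ +-assoc _ _ _ ⟨
      suc m × 1# + (- 1# + - (n × 1#))            ≈⟨ +-congˡ (⁻¹-∙-comm _ _) ⟩
      suc m × 1# + - (suc n × 1#)                 ∎

    fromℤ-neg : ∀ i → fromℤ (ℤ.- i) ≈ - fromℤ i
    fromℤ-neg (+ zero)    = sym ε⁻¹≈ε
    fromℤ-neg (+ (suc n)) = refl
    fromℤ-neg -[1+ n ]    = sym (⁻¹-involutive _)

    fromℤ-+ : ∀ i j → fromℤ (i ℤ.+ j) ≈ fromℤ i + fromℤ j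
    fromℤ-+ (+ m)    (+ n)    = ×-homo-+ 1# m n
    fromℤ-+ (+ m)    -[1+ n ] = fromℤ-⊖ m (suc n)
    fromℤ-+ -[1+ m ] (+ n)    = trans (fromℤ-⊖ n (suc m)) (+-comm _ _)
    fromℤ-+ -[1+ m ] -[1+ n ] = begin
      - (suc (suc (m ℕ.+ n)) × 1#)        ≡⟨ ≡.cong (λ k → - (k × 1#)) (≡.cong suc (≡.sym (ℕ.+-suc m n))) ⟩
      - ((suc m ℕ.+ suc n) × 1#)          ≈⟨ -‿cong (×-homo-+ 1# (suc m) (suc n)) ⟩
      - (suc m × 1# + suc n × 1#)         ≈⟨ ⁻¹-∙-comm _ _ ⟨
      - (suc m × 1#) + - (suc n × 1#)     ∎

    fromℤ-*⁺ : ∀ m j → fromℤ (+ m ℤ.* j) ≈ (m × 1#) * fromℤ j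
    fromℤ-*⁺ m (+ n) = trans (reflexive (≡.cong fromℤ (≡.sym (ℤ.pos-* m n)))) (×1-homo-* m n)
    fromℤ-*⁺ m -[1+ n ] = begin
      fromℤ (+ m ℤ.* -[1+ n ])              ≡⟨ ≡.cong fromℤ (ℤ.neg-distribʳ-* (+ m) (+ suc n)) ⟨
      fromℤ (ℤ.- (+ m ℤ.* + suc n))         ≈⟨ fromℤ-neg (+ m ℤ.* + suc n) ⟩
      - fromℤ (+ m ℤ.* + suc n)             ≈⟨ -‿cong (fromℤ-*⁺ m (+ suc n)) ⟩
      - ((m × 1#) * (suc n × 1#))           ≈⟨ -‿distribʳ-* _ _ ⟩
      (m × 1#) * - (suc n × 1#)             ∎

    fromℤ-* : ∀ i j → fromℤ (i ℤ.* j) ≈ fromℤ i * fromℤ j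
    fromℤ-* (+ m) j = fromℤ-*⁺ m j
    fromℤ-* -[1+ m ] j = begin
      fromℤ (-[1+ m ] ℤ.* j)            ≡⟨ ≡.cong fromℤ (ℤ.neg-distribˡ-* (+ suc m) j) ⟨
      fromℤ (ℤ.- (+ suc m ℤ.* j))       ≈⟨ fromℤ-neg (+ suc m ℤ.* j) ⟩
      - fromℤ (+ suc m ℤ.* j)           ≈⟨ -‿cong (fromℤ-*⁺ (suc m) j) ⟩
      - ((suc m × 1#) * fromℤ j)        ≈⟨ -‿distribˡ-* _ _ ⟩
      - (suc m × 1#) * fromℤ j          ∎

    private
      homomorphism : CommutativeRing.rawRing ℤ.+-*-commutativeRing
                     -Raw-AlmostCommutative⟶ fromCommutativeRing R
      homomorphism = record
        { ⟦_⟧    = fromℤ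
        ; +-homo = fromℤ-+
        ; *-homo = fromℤ-*
        ; -‿homo = fromℤ-neg
        ; 0-homo = refl
        ; 1-homo = +-identityʳ 1#
        }

      -- One-sided on purpose: distinct integers may have equal images, for instance in
      -- characteristic p, so `nothing` asserts no inequality.
      coeff≟ : ∀ i j → Maybe (fromℤ i ≈ fromℤ j)
      coeff≟ i j with i ℤ.≟ j
      ... | yes ≡.refl = just refl
      ... | no  _      = nothing

    open Algebra.Solver.Ring _ _ homomorphism coeff≟ public
      using (solve; _:=_; _:+_; _:*_; _:-_; :-_; con)

-- Additivity of the Frobenius map in characteristic p.

module FreshmansDream where

  open import Algebra.Bundles using (CommutativeRing)
  open import Level using (Level)
  import Algebra.Properties.CommutativeSemiring.Binomial
  import Algebra.Properties.Semiring.Exp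
  import Algebra.Properties.Semiring.Mult
  import Algebra.Properties.Semiring.Sum
  open import Data.Empty using (⊥-elim)
  open import Data.Fin.Base as Fin using (Fin; fromℕ; inject₁)
  import Data.Fin.Properties as Fin
  open import Data.Nat.Base as ℕ using (ℕ; zero; suc; _!)
  import Data.Nat.Properties as ℕ
  import Data.Nat.DivMod as ℕ
  open import Data.Nat.Combinatorics using (_C_; nCk≡n!/k![n-k]!; k![n∸k]!∣n!; nCn≡1)
  open import Data.Nat.Divisibility as ℕ using (_∣_; divides; ∣⇒≤; m∣m*n)
  open import Data.Nat.Primality using (Prime; euclidsLemma; prime⇒nonZero; ¬prime[0]; ¬prime[1])
  open import Data.Sum.Base using (inj₁; inj₂)
  open import Relation.Binary.PropositionalEquality as ≡ using (_≡_)

  ∣n!⇒≤ : ∀ {p} → Prime p → ∀ n → p ∣ n ! → p ℕ.≤ n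
  ∣n!⇒≤ {p} p-prime zero p∣1 = ⊥-elim (¬prime[1] (≡.subst Prime (ℕ.∣1⇒≡1 p∣1) p-prime))
  ∣n!⇒≤ p-prime (suc n) p∣ with euclidsLemma (suc n) (n !) p-prime p∣
  ... | inj₁ p∣n = ∣⇒≤ p∣n
  ... | inj₂ p∣n! = ℕ.m≤n⇒m≤1+n (∣n!⇒≤ p-prime n p∣n!)

  -- The prime divides p! = (p C k) · k! · (p - k)!, but neither factorial on the right, since k and
  -- p - k are both below p.
  ∣pCk : ∀ {p k} → Prime p → 0 ℕ.< k → k ℕ.< p → p ∣ p C k
  ∣pCk {p@(suc p-1)} {k} p-prime 0<k k<p
    with euclidsLemma (p C k) (k ! ℕ.* (p ℕ.∸ k) !) p-prime p∣C*k!
    where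
    instance _ = k ℕ.!* (p ℕ.∸ k) !≢0
    C*k! : (p C k) ℕ.* (k ! ℕ.* (p ℕ.∸ k) !) ≡ p !
    C*k! = ≡.trans
      (≡.cong (ℕ._* (k ! ℕ.* (p ℕ.∸ k) !)) (nCk≡n!/k![n-k]! (ℕ.<⇒≤ k<p)))
      (ℕ.m/n*n≡m (k![n∸k]!∣n! (ℕ.<⇒≤ k<p)))
    p∣C*k! : p ∣ (p C k) ℕ.* (k ! ℕ.* (p ℕ.∸ k) !)
    p∣C*k! = ≡.subst (p ∣_) (≡.sym C*k!) (m∣m*n (p-1 !))
  ... | inj₁ p∣C = p∣C
  ... | inj₂ p∣k!*l! with euclidsLemma (k !) ((p ℕ.∸ k) !) p-prime p∣k!*l!
  ...   | inj₁ p∣k! = ⊥-elim (ℕ.<⇒≱ k<p (∣n!⇒≤ p-prime k p∣k!))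
  ...   | inj₂ p∣l! = ⊥-elim (ℕ.<⇒≱ (ℕ.∸-monoʳ-< 0<k (ℕ.<⇒≤ k<p)) (∣n!⇒≤ p-prime (p ℕ.∸ k) p∣l!))
  ∣pCk {zero} p-prime _ _ = ⊥-elim (¬prime[0] p-prime)

  module Frobenius {a ℓ : Level} (R : CommutativeRing a ℓ) where

    open CommutativeRing R
    open Algebra.Properties.Semiring.Exp semiring
    open Algebra.Properties.Semiring.Mult semiring
    open Algebra.Properties.Semiring.Sum semiring
    open Algebra.Properties.CommutativeSemiring.Binomial commutativeSemiring
      using (theorem; binomialTerm)
    open import Relation.Binary.Reasoning.Setoid setoid

    module _ {p : ℕ} (p-prime : Prime p) (p×1≈0 : p × 1# ≈ 0#) where

      private
        multiple≈0 : ∀ {m} x → p ∣ m → m × x ≈ 0#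
        multiple≈0 x (divides d ≡.refl) = begin
          (d ℕ.* p) × x             ≈⟨ ×-congʳ (d ℕ.* p) (*-identityˡ x) ⟨
          (d ℕ.* p) × (1# * x)      ≈⟨ ×-assoc-* (d ℕ.* p) 1# x ⟨
          ((d ℕ.* p) × 1#) * x      ≈⟨ *-congʳ (×-assocˡ 1# d p) ⟨
          (d × (p × 1#)) * x        ≈⟨ *-congʳ (×-congʳ d p×1≈0) ⟩
          -- Zero is rewritten as `0# * 0#` so that `×-comm-*` can move a zero factor outside the
          -- multiple.
          (d × 0#) * x              ≈⟨ *-congʳ (×-congʳ d (zeroˡ 0#)) ⟨
          (d × (0# * 0#)) * x       ≈⟨ *-congʳ (×-comm-* d 0# 0#) ⟨
          (0# * (d × 0#)) * x       ≈⟨ *-congʳ (zeroˡ _) ⟩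
          0# * x                    ≈⟨ zeroˡ x ⟩
          0#                        ∎

      ^p-distrib-+ : ∀ x y → (x + y) ^ p ≈ x ^ p + y ^ p
      ^p-distrib-+ x y = go p p-prime p×1≈0 multiple≈0
        where
        -- The prime is a module parameter and cannot be split there; `go` takes it as an argument,
        -- with the facts about it, so that it becomes `suc r` and the two outer binomial terms can
        -- be separated from the rest.
        go : ∀ p → Prime p → p × 1# ≈ 0# → (∀ {m} x → p ∣ m → m × x ≈ 0#) →
             (x + y) ^ p ≈ x ^ p + y ^ p
        go zero p-prime _ _ = ⊥-elim (¬prime[0] p-prime)
        go (suc r) p-prime _ multiple≈0 = begin
          (x + y) ^ suc r                             ≈⟨ theorem (suc r) x y ⟩
          t Fin.zero + sum (λ k → t (Fin.suc k))      ≈⟨ +-congˡ (sum-init-last (λ k → t (Fin.suc k))) ⟩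
          t Fin.zero + (sum (λ k → t (Fin.suc (inject₁ k))) + t (Fin.suc (fromℕ r)))
                                                      ≈⟨ +-cong first (+-cong middle last) ⟩
          y ^ suc r + (0# + x ^ suc r)                ≈⟨ +-congˡ (+-identityˡ _) ⟩
          y ^ suc r + x ^ suc r                       ≈⟨ +-comm _ _ ⟩
          x ^ suc r + y ^ suc r                       ∎
          where
          t : Fin (suc (suc r)) → Carrier
          t = binomialTerm x y (suc r)
          first : t Fin.zero ≈ y ^ suc r
          first = trans (+-identityʳ _) (*-identityˡ _)
          last : t (Fin.suc (fromℕ r)) ≈ x ^ suc r
          last rewrite Fin.toℕ-fromℕ r | nCn≡1 (suc r) | ℕ.n∸n≡0 r =
            trans (+-identityʳ _) (*-identityʳ _)
          middle : sum (λ k → t (Fin.suc (inject₁ k))) ≈ 0#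
          middle = trans
            (sum-cong-≋ (λ k → multiple≈0 _ (∣pCk p-prime (ℕ.s≤s ℕ.z≤n)
              (ℕ.s≤s (≡.subst (ℕ._< r) (≡.sym (Fin.toℕ-inject₁ k)) (Fin.toℕ<n k))))))
            (sum-replicate-zero r)

      ^p^-suc : ∀ x e → x ^ (p ℕ.^ suc e) ≈ (x ^ p) ^ (p ℕ.^ e)
      ^p^-suc x e = sym (^-assocʳ x p (p ℕ.^ e))

      ^p^-distrib-+ : ∀ e x y → (x + y) ^ (p ℕ.^ e) ≈ x ^ (p ℕ.^ e) + y ^ (p ℕ.^ e)
      ^p^-distrib-+ zero x y = trans (*-identityʳ _) (+-cong (sym (*-identityʳ x)) (sym (*-identityʳ y)))
      ^p^-distrib-+ (suc e) x y = begin
        (x + y) ^ (p ℕ.^ suc e)                     ≈⟨ ^p^-suc (x + y) e ⟩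
        ((x + y) ^ p) ^ (p ℕ.^ e)                   ≈⟨ ^-congˡ (p ℕ.^ e) (^p-distrib-+ x y) ⟩
        (x ^ p + y ^ p) ^ (p ℕ.^ e)                 ≈⟨ ^p^-distrib-+ e (x ^ p) (y ^ p) ⟩
        (x ^ p) ^ (p ℕ.^ e) + (y ^ p) ^ (p ℕ.^ e)   ≈⟨ +-cong (^p^-suc x e) (^p^-suc y e) ⟨
        x ^ (p ℕ.^ suc e) + y ^ (p ℕ.^ suc e)       ∎

      -- The constants d × 1 are fixed because they are sums of ones.
      ×1-fixed : ∀ e d → (d × 1#) ^ (p ℕ.^ e) ≈ d × 1#
      ×1-fixed e zero with p ℕ.^ e | ℕ.m^n≢0 p e {{prime⇒nonZero p-prime}}
      ... | suc _ | _ = zeroˡ _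
      ×1-fixed e (suc d) = trans (^p^-distrib-+ e 1# (d × 1#)) (+-cong (1^ (p ℕ.^ e)) (×1-fixed e d))
        where
        1^ : ∀ n → 1# ^ n ≈ 1#
        1^ zero = refl
        1^ (suc n) = trans (*-identityˡ _) (1^ n)

-- Evaluation of polynomials, division by a linear factor, number of roots.

module PolynomialRoots where

  open import Algebra.Bundles using (CommutativeRing)
  open import Level using (Level)
  open import Data.Fin.Base as Fin using (Fin; fromℕ; inject₁)
  open import Data.Nat.Base using (ℕ; zero; suc)
  open import Data.Sum.Base using (_⊎_; inj₁; inj₂)
  open import Function.Base using (_∘_)
  import Algebra.Properties.Group
  import Algebra.Properties.Semiring.Exp
  open import Relation.Binary.PropositionalEquality as ≡ using (_≡_)
  open IntegerCoefficients

  -- c : Fin m → A stands for the polynomial Σ c i yⁱ of degree less than m.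
  module Polynomial {a ℓ : Level} (R : CommutativeRing a ℓ) where

    open CommutativeRing R renaming (Carrier to A)
    open Algebra.Properties.Group +-group using (x∙y⁻¹≈ε⇒x≈y; ε⁻¹≈ε)
    open Algebra.Properties.Semiring.Exp semiring using (_^_)
    open IntegerSolver R
    open import Relation.Binary.Reasoning.Setoid setoid

    eval : ∀ {m} → (Fin m → A) → A → A
    eval {zero}  c y = 0#
    eval {suc m} c y = c Fin.zero + y * eval (c ∘ Fin.suc) y

    eval-cong : ∀ {m} {c d : Fin m → A} → (∀ i → c i ≈ d i) → ∀ y → eval c y ≈ eval d y
    eval-cong {zero}  c≈d y = refl
    eval-cong {suc m} c≈d y = +-cong (c≈d Fin.zero) (*-congˡ (eval-cong (c≈d ∘ Fin.suc) y))

    eval-+ : ∀ {m} (c d : Fin m → A) y → eval (λ i → c i + d i) y ≈ eval c y + eval d y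
    eval-+ {zero}  c d y = sym (+-identityʳ 0#)
    eval-+ {suc m} c d y = trans (+-congˡ (*-congˡ (eval-+ (c ∘ Fin.suc) (d ∘ Fin.suc) y)))
      (solve 5 (λ a b y s t → (a :+ b) :+ y :* (s :+ t) := (a :+ y :* s) :+ (b :+ y :* t)) refl
        (c Fin.zero) (d Fin.zero) y (eval (c ∘ Fin.suc) y) (eval (d ∘ Fin.suc) y))

    eval-neg : ∀ {m} (c : Fin m → A) y → eval (λ i → - c i) y ≈ - eval c y
    eval-neg {zero}  c y = sym ε⁻¹≈ε
    eval-neg {suc m} c y = trans (+-congˡ (*-congˡ (eval-neg (c ∘ Fin.suc) y)))
      (solve 3 (λ a y s → :- a :+ y :* (:- s) := :- (a :+ y :* s)) refl
        (c Fin.zero) y (eval (c ∘ Fin.suc) y))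

    eval-zero : ∀ m {c : Fin m → A} → (∀ i → c i ≈ 0#) → ∀ y → eval c y ≈ 0#
    eval-zero zero c≈0 y = refl
    eval-zero (suc m) c≈0 y = trans
      (+-cong (c≈0 Fin.zero) (trans (*-congˡ (eval-zero m (c≈0 ∘ Fin.suc) y)) (zeroʳ y)))
      (+-identityʳ 0#)

    eval-init-last : ∀ {m} (c : Fin (suc m) → A) y →
                     eval c y ≈ eval (c ∘ inject₁) y + y ^ m * c (fromℕ m)
    eval-init-last {zero} c y = trans (+-cong (sym (*-identityˡ _)) (zeroʳ y)) (+-comm _ _)
    eval-init-last {suc m} c y = trans (+-congˡ (*-congˡ (eval-init-last (c ∘ Fin.suc) y)))
      (solve 5 (λ a y s t l → a :+ y :* (s :+ t :* l) := (a :+ y :* s) :+ (y :* t) :* l) refl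
        (c Fin.zero) y (eval (c ∘ Fin.suc ∘ inject₁) y) (y ^ m) (c (Fin.suc (fromℕ m))))

    monomial : ∀ m → Fin (suc m) → A
    monomial zero    _           = 1#
    monomial (suc m) Fin.zero    = 0#
    monomial (suc m) (Fin.suc i) = monomial m i

    eval-monomial : ∀ m y → eval (monomial m) y ≈ y ^ m
    eval-monomial zero y = trans (+-congˡ (zeroʳ y)) (+-identityʳ 1#)
    eval-monomial (suc m) y = trans (+-identityˡ _) (*-congˡ (eval-monomial m y))

    monomial-last : ∀ m → monomial m (fromℕ m) ≈ 1#
    monomial-last zero = refl
    monomial-last (suc m) = monomial-last m

    -- Horner's scheme: these are the coefficients of (c - c(r)) / (Y - r).
    quotient : ∀ {m} → (Fin (suc m) → A) → A → Fin m → A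
    quotient c r Fin.zero    = eval (c ∘ Fin.suc) r
    quotient c r (Fin.suc i) = quotient (c ∘ Fin.suc) r i

    eval-quotient : ∀ {m} (c : Fin (suc m) → A) r y →
                    eval c y ≈ eval c r + (y - r) * eval (quotient c r) y
    eval-quotient {zero} c r y = trans (+-congˡ (zeroʳ y))
      (sym (trans (+-cong (+-congˡ (zeroʳ r)) (zeroʳ _)) (+-identityʳ _)))
    eval-quotient {suc m} c r y = trans (+-congˡ (*-congˡ (eval-quotient (c ∘ Fin.suc) r y)))
      (solve 5 (λ a r y s t → a :+ y :* (s :+ (y :- r) :* t) :=
          (a :+ r :* s) :+ (y :- r) :* (s :+ y :* t)) refl
        (c Fin.zero) r y (eval (c ∘ Fin.suc) r) (eval (quotient (c ∘ Fin.suc) r) y))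

    -- Division with remainder by Y - r loses nothing. In the recursion, the lowest coefficient of
    -- the quotient is the value of the tail at r, so it supplies the root hypothesis for the tail.
    quotient≈0 : ∀ {m} (c : Fin (suc m) → A) r → (∀ i → quotient c r i ≈ 0#) →
                 eval c r ≈ 0# → ∀ i → c i ≈ 0#
    quotient≈0 {zero} c r _ root Fin.zero =
      trans (sym (trans (+-congˡ (zeroʳ r)) (+-identityʳ _))) root
    quotient≈0 {suc m} c r q≈0 root = λ where
        Fin.zero    → trans (sym (trans (+-congˡ (trans (*-congˡ (q≈0 Fin.zero)) (zeroʳ r)))
                                        (+-identityʳ _))) root
        (Fin.suc i) → quotient≈0 (c ∘ Fin.suc) r (q≈0 ∘ Fin.suc) (q≈0 Fin.zero) i

    -- Divide by the first root; without zero divisors the other roots stay roots of the quotient.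
    -- This serves twice, for the independence of powers of x and for counting the roots of Yᵠ - Y.
    rootBound : (∀ x y → x * y ≈ 0# → x ≈ 0# ⊎ y ≈ 0#) →
                ∀ {m} (c : Fin m → A) (r : Fin m → A) →
                (∀ {i j} → r i ≈ r j → i ≡ j) →
                (∀ i → eval c (r i) ≈ 0#) → ∀ i → c i ≈ 0#
    rootBound noZeroDivisors {suc m} c r r-injective root =
      quotient≈0 c (r Fin.zero)
        (rootBound noZeroDivisors (quotient c (r Fin.zero)) (r ∘ Fin.suc)
          (λ eq → suc-injective (r-injective eq)) root′)
        (root Fin.zero)
      where
      open import Data.Fin.Properties using (suc-injective)
      root′ : ∀ i → eval (quotient c (r Fin.zero)) (r (Fin.suc i)) ≈ 0#
      root′ i with noZeroDivisors (r (Fin.suc i) - r Fin.zero)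
        (eval (quotient c (r Fin.zero)) (r (Fin.suc i)))
        (trans (sym (trans (+-congʳ (root Fin.zero)) (+-identityˡ _)))
          (trans (sym (eval-quotient c (r Fin.zero) (r (Fin.suc i)))) (root (Fin.suc i))))
      ... | inj₂ q≈0 = q≈0
      ... | inj₁ r≈r with r-injective (x∙y⁻¹≈ε⇒x≈y _ _ r≈r)
      ...   | ()

-- The group ring of a cyclic group over 𝔽ₚ, with integer lists as elements.

module CyclicGroupRing where

  open import Algebra.Bundles using (CommutativeRing)
  open import Algebra.Structures using (IsCommutativeRing)
  open import Data.Fin.Base as Fin using (Fin; toℕ; fromℕ<)
  import Data.Fin.Properties as Fin
  open import Data.Integer.Base as ℤ using (ℤ; +_; 0ℤ; 1ℤ; _+_; _*_; -_; _-_)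
  import Data.Integer.Properties as ℤ
  import Data.Integer.DivMod as ℤ
  open import Data.Integer.Divisibility.Signed as ℤ using (divides; ∣m∣n⇒∣m+n; ∣m⇒∣-m; ∣n⇒∣m*n)
  open import Data.Integer.Solver using (module +-*-Solver)
  open import Data.List.Base using (List; []; _∷_; map)
  open import Data.Nat.Base as ℕ using (ℕ; zero; suc)
  import Data.Nat.Properties as ℕ
  import Data.Nat.DivMod as ℕ
  import Data.Nat.Divisibility as ℕ
  open import Data.Product.Base using (_,_)
  open import Function.Base using (_∘_)
  open import Level using (0ℓ)
  open import Relation.Binary.PropositionalEquality
  open import Relation.Binary.Structures using (IsEquivalence)
  open import Relation.Binary.Bundles using (Setoid)
  open import Relation.Nullary.Decidable using (Dec; yes; no; map′)
  open import Relation.Nullary.Negation using (¬_; contradiction)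
  import Algebra.Consequences.Setoid
  import Algebra.Properties.Semiring.Exp
  import Algebra.Properties.Semiring.Mult
  open +-*-Solver using (solve; _:=_; _:+_; _:*_; _:-_; :-_; con)

  -- The linear functional with xⁱ ↦ s i. Identities that hold against every sequence `s` hold
  -- already in ℤ[x]; restricting to suitable periodic sequences is reduction modulo xⁿ - 1.
  pairing : List ℤ → (ℕ → ℤ) → ℤ
  pairing []      s = 0ℤ
  pairing (a ∷ f) s = a * s 0 + pairing f (s ∘ suc)

  infixl 6 _⊞_
  _⊞_ : List ℤ → List ℤ → List ℤ
  []      ⊞ g       = g
  (a ∷ f) ⊞ []      = a ∷ f
  (a ∷ f) ⊞ (b ∷ g) = a + b ∷ f ⊞ g

  infixl 7 _⊠_
  _⊠_ : List ℤ → List ℤ → List ℤ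
  []      ⊠ g = []
  (a ∷ f) ⊠ g = map (a *_) g ⊞ (0ℤ ∷ f ⊠ g)

  ⊟_ : List ℤ → List ℤ
  ⊟_ = map (-_)

  pairing-cong : ∀ f {s t} → s ≗ t → pairing f s ≡ pairing f t
  pairing-cong []      s≗t = refl
  pairing-cong (a ∷ f) s≗t = cong₂ _+_ (cong (a *_) (s≗t 0)) (pairing-cong f (s≗t ∘ suc))

  pairing-⊞ : ∀ f g s → pairing (f ⊞ g) s ≡ pairing f s + pairing g s
  pairing-⊞ []      g       s = sym (ℤ.+-identityˡ _)
  pairing-⊞ (a ∷ f) []      s = sym (ℤ.+-identityʳ _)
  pairing-⊞ (a ∷ f) (b ∷ g) s rewrite pairing-⊞ f g (s ∘ suc) =
    solve 5 (λ a b x u v → (a :+ b) :* x :+ (u :+ v) := (a :* x :+ u) :+ (b :* x :+ v)) refl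
      a b (s 0) (pairing f (s ∘ suc)) (pairing g (s ∘ suc))

  pairing-map-* : ∀ c f s → pairing (map (c *_) f) s ≡ c * pairing f s
  pairing-map-* c []      s = sym (ℤ.*-zeroʳ c)
  pairing-map-* c (a ∷ f) s rewrite pairing-map-* c f (s ∘ suc) =
    solve 4 (λ c a x u → (c :* a) :* x :+ c :* u := c :* (a :* x :+ u)) refl
      c a (s 0) (pairing f (s ∘ suc))

  pairing-⊟ : ∀ f s → pairing (⊟ f) s ≡ - pairing f s
  pairing-⊟ []      s = refl
  pairing-⊟ (a ∷ f) s rewrite pairing-⊟ f (s ∘ suc) =
    solve 3 (λ a x u → (:- a) :* x :+ (:- u) := :- (a :* x :+ u)) refl
      a (s 0) (pairing f (s ∘ suc))

  -- The product xⁱ xᵏ pairs to s (i + k), and prepending a zero shifts s by one. Products become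
  -- iterated sums, whose rearrangements are the ring laws.
  pairing-⊠ : ∀ f g s → pairing (f ⊠ g) s ≡ pairing f (λ i → pairing g (λ k → s (i ℕ.+ k)))
  pairing-⊠ []      g s = refl
  pairing-⊠ (a ∷ f) g s = begin
    pairing (map (a *_) g ⊞ (0ℤ ∷ f ⊠ g)) s
      ≡⟨ pairing-⊞ (map (a *_) g) (0ℤ ∷ f ⊠ g) s ⟩
    pairing (map (a *_) g) s + (0ℤ * s 0 + pairing (f ⊠ g) (s ∘ suc))
      ≡⟨ cong₂ _+_ (pairing-map-* a g s) (ℤ.+-identityˡ _) ⟩
    a * pairing g s + pairing (f ⊠ g) (s ∘ suc)
      ≡⟨ cong (λ z → a * pairing g s + z) (pairing-⊠ f g (s ∘ suc)) ⟩
    a * pairing g s + pairing f (λ i → pairing g (λ k → s (suc i ℕ.+ k))) ∎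
    where open ≡-Reasoning

  pairing-linear : ∀ g a s t → pairing g (λ k → a * s k + t k) ≡ a * pairing g s + pairing g t
  pairing-linear []      a s t = sym (trans (ℤ.+-identityʳ _) (ℤ.*-zeroʳ a))
  pairing-linear (b ∷ g) a s t rewrite pairing-linear g a (s ∘ suc) (t ∘ suc) =
    solve 6 (λ b a x y u v → b :* (a :* x :+ y) :+ (a :* u :+ v) :=
      a :* (b :* x :+ u) :+ (b :* y :+ v)) refl
      b a (s 0) (t 0) (pairing g (s ∘ suc)) (pairing g (t ∘ suc))

  pairing-zero : ∀ f → pairing f (λ _ → 0ℤ) ≡ 0ℤ
  pairing-zero []      = refl
  pairing-zero (a ∷ f) rewrite pairing-zero f = trans (ℤ.+-identityʳ _) (ℤ.*-zeroʳ a)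

  pairing-swap : ∀ f g (t : ℕ → ℕ → ℤ) →
    pairing f (λ i → pairing g (t i)) ≡ pairing g (λ k → pairing f (λ i → t i k))
  pairing-swap []      g t = sym (pairing-zero g)
  pairing-swap (a ∷ f) g t = trans (cong (λ z → a * pairing g (t 0) + z) (pairing-swap f g (t ∘ suc)))
    (sym (pairing-linear g a (t 0) (λ k → pairing f (λ i → t (suc i) k))))

  -- 𝔽ₚ[x]/(xⁿ - 1).  The list f stands for Σ fᵢ xⁱ, and coefficient f j is
  -- the coefficient of x⁻ʲ after reduction modulo xⁿ - 1.
  module CyclicRing (p n : ℕ) where

    infix 4 _≡ₚ_ _≈_

    -- A record, so that a and b can be inferred; the bare difference `a - b` does not determine
    -- them.
    record _≡ₚ_ (a b : ℤ) : Set where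
      constructor mod-p
      field p∣difference : + p ℤ.∣ a - b

    private
      ≡ₚ-reflexive : ∀ {a b} → a ≡ b → a ≡ₚ b
      ≡ₚ-reflexive {a} refl = mod-p (divides 0ℤ (ℤ.+-inverseʳ a))

      ≡ₚ-sym : ∀ {a b} → a ≡ₚ b → b ≡ₚ a
      ≡ₚ-sym {a} {b} (mod-p d) = mod-p (subst (+ p ℤ.∣_)
        (solve 2 (λ a b → :- (a :- b) := b :- a) refl a b) (∣m⇒∣-m d))

      ≡ₚ-trans : ∀ {a b c} → a ≡ₚ b → b ≡ₚ c → a ≡ₚ c
      ≡ₚ-trans {a} {b} {c} (mod-p d) (mod-p e) = mod-p (subst (+ p ℤ.∣_)
        (solve 3 (λ a b c → (a :- b) :+ (b :- c) := a :- c) refl a b c) (∣m∣n⇒∣m+n d e))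

      +-cong : ∀ {a b c d} → a ≡ₚ b → c ≡ₚ d → a + c ≡ₚ b + d
      +-cong {a} {b} {c} {d} (mod-p e) (mod-p f) = mod-p (subst (+ p ℤ.∣_)
        (solve 4 (λ a b c d → (a :- b) :+ (c :- d) := (a :+ c) :- (b :+ d)) refl a b c d)
        (∣m∣n⇒∣m+n e f))

      *-congˡ : ∀ a {b c} → b ≡ₚ c → a * b ≡ₚ a * c
      *-congˡ a {b} {c} (mod-p e) = mod-p (subst (+ p ℤ.∣_)
        (solve 3 (λ a b c → a :* (b :- c) := a :* b :- a :* c) refl a b c) (∣n⇒∣m*n a e))

      -‿cong : ∀ {a b} → a ≡ₚ b → - a ≡ₚ - b
      -‿cong {a} {b} (mod-p e) = mod-p (subst (+ p ℤ.∣_)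
        (solve 2 (λ a b → :- (a :- b) := (:- a) :- (:- b)) refl a b) (∣m⇒∣-m e))

      pairing-≡ₚ : ∀ f {s t} → (∀ i → s i ≡ₚ t i) → pairing f s ≡ₚ pairing f t
      pairing-≡ₚ []      s≡t = ≡ₚ-reflexive refl
      pairing-≡ₚ (a ∷ f) s≡t = +-cong (*-congˡ a (s≡t 0)) (pairing-≡ₚ f (s≡t ∘ suc))

    δ : ℕ → ℤ
    δ i with n ℕ.∣? i
    ... | yes _ = 1ℤ
    ... | no  _ = 0ℤ

    δ-yes : ∀ {i} → n ℕ.∣ i → δ i ≡ 1ℤ
    δ-yes {i} n∣i with n ℕ.∣? i
    ... | yes _   = refl
    ... | no  n∤i = contradiction n∣i n∤i

    δ-no : ∀ {i} → ¬ (n ℕ.∣ i) → δ i ≡ 0ℤ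
    δ-no {i} n∤i with n ℕ.∣? i
    ... | yes n∣i = contradiction n∣i n∤i
    ... | no  _   = refl

    δ-periodic : ∀ i → δ (n ℕ.+ i) ≡ δ i
    δ-periodic i with n ℕ.∣? i
    ... | yes n∣i = δ-yes (ℕ.∣m∣n⇒∣m+n ℕ.∣-refl n∣i)
    ... | no  n∤i = δ-no (λ n∣n+i → n∤i (ℕ.∣m+n∣m⇒∣n n∣n+i ℕ.∣-refl))

    coefficient : List ℤ → ℕ → ℤ
    coefficient f j = pairing f (λ i → δ (i ℕ.+ j))

    record _≈_ (f g : List ℤ) : Set where
      constructor coefficientwise
      field coefficients : ∀ j → coefficient f j ≡ₚ coefficient g j
    open _≈_

    1#≈ : List ℤ
    1#≈ = 1ℤ ∷ []

    private
      exact : ∀ {f g} → (∀ s → pairing f s ≡ pairing g s) → f ≈ g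
      exact eq = coefficientwise λ j → ≡ₚ-reflexive (eq (λ i → δ (i ℕ.+ j)))

    -- The right factor enters through its reduced coefficients alone, so multiplication respects
    -- `_≈_` on the right; commutativity carries this to the left.
    coefficient-⊠ : ∀ f g j → coefficient (f ⊠ g) j ≡ pairing f (λ i → coefficient g (i ℕ.+ j))
    coefficient-⊠ f g j = trans (pairing-⊠ f g _)
      (pairing-cong f (λ i → pairing-cong g (λ k → cong δ (trans
        (cong (ℕ._+ j) (ℕ.+-comm i k)) (ℕ.+-assoc k i j)))))

    private
      ≈-isEquivalence : IsEquivalence _≈_
      ≈-isEquivalence = record
        { refl  = coefficientwise λ j → ≡ₚ-reflexive refl
        ; sym   = λ e → coefficientwise λ j → ≡ₚ-sym (coefficients e j)
        ; trans = λ e f → coefficientwise λ j → ≡ₚ-trans (coefficients e j) (coefficients f j)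
        }

      open IsEquivalence ≈-isEquivalence using () renaming (trans to ≈-trans)

      ⊞-cong : ∀ {f g h k} → f ≈ g → h ≈ k → f ⊞ h ≈ g ⊞ k
      ⊞-cong {f} {g} {h} {k} e e′ = coefficientwise λ j → subst₂ _≡ₚ_
        (sym (pairing-⊞ f h _)) (sym (pairing-⊞ g k _))
        (+-cong (coefficients e j) (coefficients e′ j))

      ⊞-comm : ∀ f g → f ⊞ g ≈ g ⊞ f
      ⊞-comm f g = exact λ s → trans (pairing-⊞ f g s)
        (trans (ℤ.+-comm (pairing f s) (pairing g s)) (sym (pairing-⊞ g f s)))

      ⊞-identityˡ : ∀ f → [] ⊞ f ≈ f
      ⊞-identityˡ f = exact λ s → refl

      ⊞-assoc : ∀ f g h → (f ⊞ g) ⊞ h ≈ f ⊞ (g ⊞ h)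
      ⊞-assoc f g h = exact λ s → begin
        pairing ((f ⊞ g) ⊞ h) s                       ≡⟨ pairing-⊞ (f ⊞ g) h s ⟩
        pairing (f ⊞ g) s + pairing h s               ≡⟨ cong (_+ _) (pairing-⊞ f g s) ⟩
        (pairing f s + pairing g s) + pairing h s     ≡⟨ ℤ.+-assoc (pairing f s) _ _ ⟩
        pairing f s + (pairing g s + pairing h s)     ≡⟨ cong (λ z → pairing f s + z) (pairing-⊞ g h s) ⟨
        pairing f s + pairing (g ⊞ h) s               ≡⟨ pairing-⊞ f (g ⊞ h) s ⟨
        pairing (f ⊞ (g ⊞ h)) s                       ∎
        where open ≡-Reasoning

      ⊟-cong : ∀ {f g} → f ≈ g → ⊟ f ≈ ⊟ g
      ⊟-cong {f} {g} e = coefficientwise λ j → subst₂ _≡ₚ_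
        (sym (pairing-⊟ f _)) (sym (pairing-⊟ g _)) (-‿cong (coefficients e j))

      ⊟-inverseˡ : ∀ f → ⊟ f ⊞ f ≈ []
      ⊟-inverseˡ f = exact λ s → trans (pairing-⊞ (⊟ f) f s)
        (trans (cong (_+ pairing f s) (pairing-⊟ f s)) (ℤ.+-inverseˡ (pairing f s)))

      ⊠-comm : ∀ f g → f ⊠ g ≈ g ⊠ f
      ⊠-comm f g = exact λ s → begin
        pairing (f ⊠ g) s                                   ≡⟨ pairing-⊠ f g s ⟩
        pairing f (λ i → pairing g (λ k → s (i ℕ.+ k)))     ≡⟨ pairing-swap f g _ ⟩
        pairing g (λ k → pairing f (λ i → s (i ℕ.+ k)))
          ≡⟨ pairing-cong g (λ k → pairing-cong f (λ i → cong s (ℕ.+-comm i k))) ⟩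
        pairing g (λ k → pairing f (λ i → s (k ℕ.+ i)))     ≡⟨ pairing-⊠ g f s ⟨
        pairing (g ⊠ f) s                                   ∎
        where open ≡-Reasoning

      ⊠-congˡ : ∀ f {g h} → g ≈ h → f ⊠ g ≈ f ⊠ h
      ⊠-congˡ f {g} {h} e = coefficientwise λ j → subst₂ _≡ₚ_
        (sym (coefficient-⊠ f g j)) (sym (coefficient-⊠ f h j))
        (pairing-≡ₚ f (λ i → coefficients e (i ℕ.+ j)))

      ⊠-cong : ∀ {f g h k} → f ≈ g → h ≈ k → f ⊠ h ≈ g ⊠ k
      ⊠-cong {f} {g} {h} {k} e e′ =
        ≈-trans (⊠-comm f h) (≈-trans (⊠-congˡ h e) (≈-trans (⊠-comm h g) (⊠-congˡ g e′)))

      ⊠-assoc : ∀ f g h → (f ⊠ g) ⊠ h ≈ f ⊠ (g ⊠ h)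
      ⊠-assoc f g h = exact λ s → begin
        pairing ((f ⊠ g) ⊠ h) s
          ≡⟨ pairing-⊠ (f ⊠ g) h s ⟩
        pairing (f ⊠ g) (λ m → pairing h (λ l → s (m ℕ.+ l)))
          ≡⟨ pairing-⊠ f g _ ⟩
        pairing f (λ i → pairing g (λ k → pairing h (λ l → s ((i ℕ.+ k) ℕ.+ l))))
          ≡⟨ pairing-cong f (λ i → pairing-cong g (λ k → pairing-cong h (λ l →
               cong s (ℕ.+-assoc i k l)))) ⟩
        pairing f (λ i → pairing g (λ k → pairing h (λ l → s (i ℕ.+ (k ℕ.+ l)))))
          ≡⟨ pairing-cong f (λ i → pairing-⊠ g h _) ⟨
        pairing f (λ i → pairing (g ⊠ h) (λ m → s (i ℕ.+ m)))
          ≡⟨ pairing-⊠ f (g ⊠ h) s ⟨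
        pairing (f ⊠ (g ⊠ h)) s ∎
        where open ≡-Reasoning

      ⊠-identityˡ : ∀ f → 1#≈ ⊠ f ≈ f
      ⊠-identityˡ f = exact λ s → trans (pairing-⊠ 1#≈ f s)
        (trans (ℤ.+-identityʳ _) (ℤ.*-identityˡ (pairing f s)))

      ⊠-distribʳ : ∀ f g h → (g ⊞ h) ⊠ f ≈ g ⊠ f ⊞ h ⊠ f
      ⊠-distribʳ f g h = exact λ s → begin
        pairing ((g ⊞ h) ⊠ f) s                                     ≡⟨ pairing-⊠ (g ⊞ h) f s ⟩
        pairing (g ⊞ h) (λ i → pairing f (λ k → s (i ℕ.+ k)))       ≡⟨ pairing-⊞ g h _ ⟩
        pairing g (λ i → pairing f (λ k → s (i ℕ.+ k))) +
        pairing h (λ i → pairing f (λ k → s (i ℕ.+ k)))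
          ≡⟨ cong₂ _+_ (pairing-⊠ g f s) (pairing-⊠ h f s) ⟨
        pairing (g ⊠ f) s + pairing (h ⊠ f) s                       ≡⟨ pairing-⊞ (g ⊠ f) (h ⊠ f) s ⟨
        pairing (g ⊠ f ⊞ h ⊠ f) s                                   ∎
        where open ≡-Reasoning

      ≈-setoid : Setoid 0ℓ 0ℓ
      ≈-setoid = record { isEquivalence = ≈-isEquivalence }

      open Algebra.Consequences.Setoid ≈-setoid
        using (comm∧idˡ⇒id; comm∧invˡ⇒inv; comm∧distrʳ⇒distr)

    isCommutativeRing : IsCommutativeRing _≈_ _⊞_ _⊠_ ⊟_ [] 1#≈
    isCommutativeRing = record
      { isRing = record
        { +-isAbelianGroup = record
          { isGroup = record
            { isMonoid = record
              { isSemigroup = record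
                { isMagma = record { isEquivalence = ≈-isEquivalence ; ∙-cong = ⊞-cong }
                ; assoc = ⊞-assoc
                }
              ; identity = comm∧idˡ⇒id ⊞-comm ⊞-identityˡ
              }
            ; inverse = comm∧invˡ⇒inv ⊞-comm ⊟-inverseˡ
            ; ⁻¹-cong = ⊟-cong
            }
          ; comm = ⊞-comm
          }
        ; *-cong = ⊠-cong
        ; *-assoc = ⊠-assoc
        ; *-identity = comm∧idˡ⇒id ⊠-comm ⊠-identityˡ
        ; distrib = comm∧distrʳ⇒distr ⊞-cong ⊠-comm ⊠-distribʳ
        }
      ; *-comm = ⊠-comm
      }

    commutativeRing : CommutativeRing 0ℓ 0ℓ
    commutativeRing = record { isCommutativeRing = isCommutativeRing }

    open CommutativeRing commutativeRing using (semiring)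
      renaming (refl to ≈-refl; sym to ≈-sym)
    open Algebra.Properties.Semiring.Exp semiring using (_^_)
    open Algebra.Properties.Semiring.Mult semiring using (_×_)

    x : List ℤ
    x = 0ℤ ∷ 1ℤ ∷ []

    constant : ℤ → List ℤ
    constant a = a ∷ []

    x⊠ : ∀ f → x ⊠ f ≈ 0ℤ ∷ f
    x⊠ f = exact λ s → trans (pairing-⊠ x f s)
      (solve 3 (λ u v w → con 0ℤ :* u :+ (con 1ℤ :* v :+ con 0ℤ) := con 0ℤ :* w :+ v) refl
        (pairing f s) (pairing f (s ∘ suc)) (s 0))

    ∷-split : ∀ a f → a ∷ f ≈ constant a ⊞ x ⊠ f
    ∷-split a f = ≈-trans
      (exact λ s → trans
        (solve 3 (λ a u v → a :* u :+ v := (a :* u :+ con 0ℤ) :+ (con 0ℤ :* u :+ v)) refl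
          a (s 0) (pairing f (s ∘ suc)))
        (sym (pairing-⊞ (constant a) (0ℤ ∷ f) s)))
      (⊞-cong {constant a} ≈-refl (≈-sym (x⊠ f)))

    coefficient-x⊠ : ∀ f j → coefficient (x ⊠ f) j ≡ coefficient f (suc j)
    coefficient-x⊠ f j = trans (coefficient-⊠ x f j)
      (trans (ℤ.+-identityˡ _) (trans (ℤ.+-identityʳ _) (ℤ.*-identityˡ _)))

    coefficient-x^ : ∀ k j → coefficient (x ^ k) j ≡ δ (k ℕ.+ j)
    coefficient-x^ zero    j = trans (ℤ.+-identityʳ _) (ℤ.*-identityˡ _)
    coefficient-x^ (suc k) j = trans (coefficient-x⊠ (x ^ k) j)
      (trans (coefficient-x^ k (suc j)) (cong δ (ℕ.+-suc k j)))

    x^n≈1 : x ^ n ≈ 1#≈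
    x^n≈1 = coefficientwise λ j → ≡ₚ-reflexive (trans (coefficient-x^ n j)
      (trans (δ-periodic j) (sym (coefficient-x^ 0 j))))

    ×1-constant : ∀ d → d × 1#≈ ≈ constant (+ d)
    ×1-constant zero    = exact λ s → refl
    ×1-constant (suc d) = ⊞-cong {1#≈} ≈-refl (×1-constant d)

    constant-cong : ∀ {a b} → a ≡ₚ b → constant a ≈ constant b
    constant-cong {a} {b} a≡b = coefficientwise λ j →
      subst₂ _≡ₚ_ (comm a j) (comm b j) (+-cong (*-congˡ (δ j) a≡b) (≡ₚ-reflexive refl))
      where
      comm : ∀ a j → δ j * a + 0ℤ ≡ coefficient (constant a) j
      comm a j = cong (_+ 0ℤ) (ℤ.*-comm (δ j) a)

    p×1≈0 : p × 1#≈ ≈ []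
    p×1≈0 = ≈-trans (×1-constant p) (≈-trans
      (constant-cong {+ p} {0ℤ} (mod-p (divides 1ℤ (trans (ℤ.+-identityʳ (+ p)) (sym (ℤ.*-identityˡ (+ p)))))))
      (exact λ s → refl))

    -- Turns integer constants, possibly negative, into multiples of 1 by a natural number, the form
    -- in which Frobenius visibly fixes them.
    constant≈×1 : .{{_ : ℕ.NonZero p}} → ∀ a → constant a ≈ (a ℤ.%ℕ p) × 1#≈
    constant≈×1 a = ≈-trans (constant-cong {a} (mod-p (divides (a ℤ./ℕ p) (begin
        a - + (a ℤ.%ℕ p)
          ≡⟨ cong (_- + (a ℤ.%ℕ p)) (ℤ.a≡a%ℕn+[a/ℕn]*n a p) ⟩
        (+ (a ℤ.%ℕ p) + (a ℤ./ℕ p) * + p) - + (a ℤ.%ℕ p)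
          ≡⟨ solve 2 (λ u v → (u :+ v) :- u := v) refl (+ (a ℤ.%ℕ p)) ((a ℤ./ℕ p) * + p) ⟩
        (a ℤ./ℕ p) * + p ∎))))
      (≈-sym (×1-constant (a ℤ.%ℕ p)))
      where open ≡-Reasoning

    -- Coefficients have period n in their index, so n divisibility tests settle all of them.
    ≈0? : .{{_ : ℕ.NonZero n}} → ∀ f → Dec (f ≈ [])
    ≈0? f = map′ to from (Fin.all? {n = n} (λ j → + p ℤ.∣? coefficient f (toℕ j) - 0ℤ))
      where
      periodic : ∀ d j → coefficient f (j ℕ.+ d ℕ.* n) ≡ coefficient f j
      periodic zero j = cong (coefficient f) (ℕ.+-identityʳ j)
      periodic (suc d) j = trans (pairing-cong f (λ i → trans
          (cong δ (begin
            i ℕ.+ (j ℕ.+ (n ℕ.+ d ℕ.* n))     ≡⟨ ℕ.+-assoc i j _ ⟨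
            (i ℕ.+ j) ℕ.+ (n ℕ.+ d ℕ.* n)     ≡⟨ ℕ.+-comm (i ℕ.+ j) _ ⟩
            (n ℕ.+ d ℕ.* n) ℕ.+ (i ℕ.+ j)     ≡⟨ ℕ.+-assoc n _ _ ⟩
            n ℕ.+ (d ℕ.* n ℕ.+ (i ℕ.+ j))     ≡⟨ cong (n ℕ.+_) (ℕ.+-comm (d ℕ.* n) (i ℕ.+ j)) ⟩
            n ℕ.+ ((i ℕ.+ j) ℕ.+ d ℕ.* n)     ≡⟨ cong (n ℕ.+_) (ℕ.+-assoc i j _) ⟩
            n ℕ.+ (i ℕ.+ (j ℕ.+ d ℕ.* n))     ∎))
          (δ-periodic _))) (periodic d j)
        where open ≡-Reasoning
      to : (∀ (j : Fin n) → + p ℤ.∣ coefficient f (toℕ j) - 0ℤ) → f ≈ []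
      to d = coefficientwise λ j → mod-p (subst (λ c → + p ℤ.∣ c - 0ℤ)
        (trans (sym (periodic (j ℕ./ n) (j ℕ.% n)))
               (cong (coefficient f) (sym (ℕ.m≡m%n+[m/n]*n j n))))
        (subst (λ i → + p ℤ.∣ coefficient f i - 0ℤ) (Fin.toℕ-fromℕ< (ℕ.m%n<n j n))
          (d (fromℕ< (ℕ.m%n<n j n)))))
      from : f ≈ [] → ∀ (j : Fin n) → + p ℤ.∣ coefficient f (toℕ j) - 0ℤ
      from e j = _≡ₚ_.p∣difference (coefficients e (toℕ j))

    -- The last entry of the list is the integer 1 itself, not merely 1 modulo p, and m is the
    -- degree.
    data Monic : ℕ → List ℤ → Set where
      one : Monic 0 (1ℤ ∷ [])
      _∷_ : ∀ a {m f} → Monic m f → Monic (suc m) (a ∷ f)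

    -- Here j = n - m selects x⁻ʲ = xᵐ. For i < m the number i + j lies strictly between 0 and n, so
    -- no lower term contributes and only the leading 1 is seen.
    coefficient-Monic : ∀ {m f} → Monic m f → ∀ j → 0 ℕ.< j → m ℕ.+ j ≡ n → coefficient f j ≡ 1ℤ
    coefficient-Monic one j _ refl = trans (ℤ.+-identityʳ _) (trans (ℤ.*-identityˡ _) (δ-yes ℕ.∣-refl))
    coefficient-Monic {suc m} {a ∷ f} (a ∷ monic) j 0<j m+j≡n = begin
      a * δ j + pairing f (λ i → δ (suc i ℕ.+ j))
        ≡⟨ cong₂ _+_ (cong (a *_) (δ-no n∤j)) (pairing-cong f (λ i → cong δ (sym (ℕ.+-suc i j)))) ⟩
      a * 0ℤ + coefficient f (suc j)
        ≡⟨ cong₂ _+_ (ℤ.*-zeroʳ a) (coefficient-Monic monic (suc j) (ℕ.s≤s ℕ.z≤n)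
             (trans (ℕ.+-suc m j) m+j≡n)) ⟩
      1ℤ ∎
      where
      open ≡-Reasoning
      n∤j : ¬ (n ℕ.∣ j)
      n∤j n∣j = ℕ.<⇒≱ (subst (j ℕ.<_) m+j≡n (ℕ.m<n+m j (ℕ.s≤s ℕ.z≤n)))
                      (ℕ.∣⇒≤ {{ℕ.>-nonZero 0<j}} n∣j)

    Monic⇒≉0 : 1 ℕ.< p → ∀ {m f} → Monic m f → m ℕ.< n → ¬ (f ≈ [])
    Monic⇒≉0 1<p {m} {f} monic m<n e = ℕ.<⇒≱ 1<p (ℕ.∣⇒≤ (ℤ.∣⇒∣ᵤ (subst (λ c → + p ℤ.∣ c - 0ℤ)
      (coefficient-Monic monic (n ℕ.∸ m) (ℕ.m<n⇒0<n∸m m<n) (ℕ.m+[n∸m]≡n (ℕ.<⇒≤ m<n)))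
      (_≡ₚ_.p∣difference (coefficients e (n ℕ.∸ m))))))

-- Finite fields and the affine planes over them.

module AffinePlanes where

  open import Algebra.Bundles using (CommutativeRing)
  open import Data.Empty using (⊥; ⊥-elim)
  open import Data.Fin.Base as Fin using (Fin; toℕ; fromℕ; finToFun; funToFin)
  import Data.Fin.Properties as Fin
  open import Data.Nat.Base as ℕ using (ℕ; zero; suc)
  import Data.Nat.Properties as ℕ
  import Data.Nat.DivMod as ℕ
  import Data.Nat.Divisibility as ℕ
  open import Data.Nat.Coprimality using (prime⇒coprime; coprime-Bézout)
  open import Data.Nat.GCD using (module Bézout)
  open import Data.Nat.Primality using (Prime)
  open import Data.Product.Base using (_,_; ∃-syntax; _×_; proj₁; proj₂)
  open import Data.Sum.Base using (_⊎_; inj₁; inj₂)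
  open import Function.Base using (_∘_)
  open import Level using (Level)
  open import Relation.Binary.Definitions using (tri<; tri≈; tri>)
  open import Relation.Binary.PropositionalEquality as ≡ using (_≡_; _≢_)
  open import Relation.Nullary.Decidable using (Dec; yes; no; map′)
  open import Relation.Nullary.Negation using (¬_; contradiction)
  import Algebra.Properties.CommutativeSemiring.Exp
  import Algebra.Properties.Group
  import Algebra.Properties.Semiring.Exp
  import Algebra.Properties.Semiring.Mult
  open IntegerCoefficients
  open FreshmansDream
  open PolynomialRoots

  funToFin-cong : ∀ {m n} {f g : Fin m → Fin n} → (∀ i → f i ≡ g i) → funToFin f ≡ funToFin g
  funToFin-cong {zero}  f≗g = ≡.refl
  funToFin-cong {suc m} f≗g = ≡.cong₂ Fin.combine (f≗g Fin.zero) (funToFin-cong (f≗g ∘ Fin.suc))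

  -- The lines {(u , line i u a)} of slope i cover an affine plane of order q
  -- without its vertical lines.
  record Plane (q : ℕ) : Set where
    field
      line       : Fin q → Fin q → Fin q → Fin q
      lineThrough : ∀ i u v → ∃[ a ] line i u a ≡ v
      line-injective : ∀ i u {a b} → line i u a ≡ line i u b → a ≡ b
      meet        : ∀ {i j} → i ≢ j → ∀ a b → ∃[ u ] line i u a ≡ line j u b
      meet-unique : ∀ {i j} → i ≢ j → ∀ {a b u v} →
                    line i u a ≡ line j u b → line i v a ≡ line j v b → u ≡ v

  module FiniteField {a ℓ : Level} (K : CommutativeRing a ℓ) where

    open CommutativeRing K
    open Algebra.Properties.Group +-group using (x∙y⁻¹≈ε⇒x≈y; ∙-cancelʳ)
    open Algebra.Properties.Semiring.Exp semiring
    open Algebra.Properties.CommutativeSemiring.Exp commutativeSemiring using (^-distrib-*)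
    open Algebra.Properties.Semiring.Mult semiring
      using (×-homo-+; ×1-homo-*; ×-congˡ) renaming (_×_ to _·_)
    open Frobenius K
    open Polynomial K
    open import Relation.Binary.Reasoning.Setoid setoid

    x≈y⇒x-y≈0 : ∀ {x y} → x ≈ y → x - y ≈ 0#
    x≈y⇒x-y≈0 {x} {y} x≈y = trans (+-congʳ x≈y) (-‿inverseʳ y)

    -- `index` picks one label for each class of equal elements, which turns equations of the field
    -- into propositional equalities in `Fin q`. Inverses are powers: `y ^ n` inverts every nonzero
    -- y.
    affinePlane : ∀ {q n} →
      (∀ y z → y * z ≈ 0# → y ≈ 0# ⊎ z ≈ 0#) →
      (∀ y → y ≈ 0# ⊎ y ^ suc n ≈ 1#) →
      (element : Fin q → Carrier) → (∀ {s t} → element s ≈ element t → s ≡ t) →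
      (index : Carrier → Fin q) → (∀ y → element (index y) ≈ y) →
      Plane q
    affinePlane {q} {n} noZeroDivisors zeroOrUnit element element-injective index element-index = record
      { line           = line
      ; lineThrough    = λ i u v → index (element v - element i * element u) ,
          element-injective (trans (element-line i u _) (trans (+-congˡ (element-index _))
            (solve 2 (λ s v → s :+ (v :- s) := v) refl (element i * element u) (element v))))
      ; line-injective = λ i u {a} {b} eq → element-injective (∙-cancelˡ (element i * element u) _ _
          (trans (sym (element-line i u a)) (trans (reflexive (≡.cong element eq)) (element-line i u b))))
      ; meet           = meet
      ; meet-unique    = meet-unique
      }
      where
      open Algebra.Properties.Group +-group using (∙-cancelˡ)
      open IntegerSolver K
      line : Fin q → Fin q → Fin q → Fin q
      line i u a = index (element i * element u + element a)

      element-line : ∀ i u a → element (line i u a) ≈ element i * element u + element a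
      element-line i u a = element-index _

      unit : ∀ {i j} → i ≢ j → (element i - element j) ^ suc n ≈ 1#
      unit {i} {j} i≢j with zeroOrUnit (element i - element j)
      ... | inj₁ i-j≈0 = contradiction (element-injective (x∙y⁻¹≈ε⇒x≈y _ _ i-j≈0)) i≢j
      ... | inj₂ i-j-unit = i-j-unit

      meet : ∀ {i j} → i ≢ j → ∀ a b → ∃[ u ] line i u a ≡ line j u b
      meet {i} {j} i≢j a b = u , element-injective (begin
        element (line i u a)                              ≈⟨ element-line i u a ⟩
        element i * element u + element a
          ≈⟨ solve 4 (λ i j u a → i :* u :+ a := (i :- j) :* u :+ (j :* u :+ a)) refl
               (element i) (element j) (element u) (element a) ⟩
        (element i - element j) * element u + (element j * element u + element a)
          ≈⟨ +-congʳ (*-congˡ (element-index _)) ⟩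
        (element i - element j) * ((element i - element j) ^ n * (element b - element a))
          + (element j * element u + element a)
          ≈⟨ +-congʳ (trans (sym (*-assoc _ _ _)) (trans (*-congʳ (unit i≢j)) (*-identityˡ _))) ⟩
        (element b - element a) + (element j * element u + element a)
          ≈⟨ solve 3 (λ a b s → (b :- a) :+ (s :+ a) := s :+ b) refl
               (element a) (element b) (element j * element u) ⟩
        element j * element u + element b                 ≈⟨ element-line j u b ⟨
        element (line j u b)                              ∎)
        where
        u : Fin q
        -- The abscissa (b - a) / (i - j), with the inverse written as a power.
        u = index ((element i - element j) ^ n * (element b - element a))

      meet-unique : ∀ {i j} → i ≢ j → ∀ {a b u v} →
        line i u a ≡ line j u b → line i v a ≡ line j v b → u ≡ v
      meet-unique {i} {j} i≢j {a} {b} {u} {v} eq₁ eq₂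
        with noZeroDivisors (element i - element j) (element u - element v) (begin
          (element i - element j) * (element u - element v)
            ≈⟨ solve 4 (λ i j u v → (i :- j) :* (u :- v) := (i :* u :- j :* u) :- (i :* v :- j :* v)) refl
                 (element i) (element j) (element u) (element v) ⟩
          (element i * element u - element j * element u) - (element i * element v - element j * element v)
            ≈⟨ +-cong (difference u eq₁) (-‿cong (difference v eq₂)) ⟩
          (element b - element a) - (element b - element a)
            ≈⟨ -‿inverseʳ _ ⟩
          0# ∎)
        where
        difference : ∀ u → line i u a ≡ line j u b →
          element i * element u - element j * element u ≈ element b - element a
        difference u eq = begin
          element i * element u - element j * element u
            ≈⟨ solve 3 (λ s t a → s :- t := (s :+ a) :- (t :+ a)) refl
                 (element i * element u) (element j * element u) (element a) ⟩
          (element i * element u + element a) - (element j * element u + element a)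
            ≈⟨ +-congʳ (trans (sym (element-line i u a))
                 (trans (reflexive (≡.cong element eq)) (element-line j u b))) ⟩
          (element j * element u + element b) - (element j * element u + element a)
            ≈⟨ solve 3 (λ t a b → (t :+ b) :- (t :+ a) := b :- a) refl
                 (element j * element u) (element a) (element b) ⟩
          element b - element a ∎
      ... | inj₁ i-j≈0 = contradiction (element-injective (x∙y⁻¹≈ε⇒x≈y _ _ i-j≈0)) i≢j
      ... | inj₂ u-v≈0 = element-injective (x∙y⁻¹≈ε⇒x≈y _ _ u-v≈0)

    digits : ∀ {p m} → (Fin m → Fin p) → Fin m → Carrier
    digits c i = toℕ (c i) · 1#

    -- 1, x, …, xᵉ⁻¹ are independent over 𝔽ₚ, because a relation would have the
    -- e conjugates of x as roots, and they span, because Yᵠ - Y has at most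
    -- q = pᵉ roots.
    module WithConjugates
      {p : ℕ} (p-prime : Prime p) (p·1≈0 : p · 1# ≈ 0#) (1≉0 : ¬ (1# ≈ 0#))
      (e n : ℕ) (q≡2+n : p ℕ.^ e ≡ suc (suc n))
      (≈0? : ∀ y → Dec (y ≈ 0#))
      (zeroOrUnit : ∀ y → y ≈ 0# ⊎ y ^ suc n ≈ 1#)
      (x : Carrier) (conjugates : ∀ d → 0 ℕ.< d → d ℕ.< e → ¬ (x ^ (p ℕ.^ d) ≈ x))
      where

      q : ℕ
      q = p ℕ.^ e

      _≈?_ : ∀ y z → Dec (y ≈ z)
      y ≈? z = map′ (x∙y⁻¹≈ε⇒x≈y y z) x≈y⇒x-y≈0 (≈0? (y - z))

      noZeroDivisors : ∀ y z → y * z ≈ 0# → y ≈ 0# ⊎ z ≈ 0#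
      noZeroDivisors y z yz≈0 with zeroOrUnit y
      ... | inj₁ y≈0 = inj₁ y≈0
      ... | inj₂ y^n≈1 = inj₂ (begin
        z                     ≈⟨ *-identityˡ z ⟨
        1# * z                ≈⟨ *-congʳ y^n≈1 ⟨
        (y * y ^ n) * z       ≈⟨ *-congʳ (*-comm y (y ^ n)) ⟩
        (y ^ n * y) * z       ≈⟨ *-assoc _ _ _ ⟩
        y ^ n * (y * z)       ≈⟨ *-congˡ yz≈0 ⟩
        y ^ n * 0#            ≈⟨ zeroʳ _ ⟩
        0#                    ∎)

      ^q-fixed : ∀ y → y ^ q ≈ y
      ^q-fixed y = trans (^-congʳ y q≡2+n) y*y^1+n≈y
        where
        y*y^1+n≈y : y * y ^ suc n ≈ y
        y*y^1+n≈y with zeroOrUnit y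
        ... | inj₁ y≈0 = trans (*-congʳ y≈0) (trans (zeroˡ _) (sym y≈0))
        ... | inj₂ y^≈1 = trans (*-congˡ y^≈1) (*-identityʳ y)

      -- Raising to the power p^(e - i) completes the exponent to q, and q-th powers change nothing.
      ^p^-injective : ∀ {i y z} → i ℕ.≤ e → y ^ (p ℕ.^ i) ≈ z ^ (p ℕ.^ i) → y ≈ z
      ^p^-injective {i} {y} {z} i≤e eq = trans (sym (split y)) (trans (^-congˡ (p ℕ.^ (e ℕ.∸ i)) eq) (split z))
        where
        split : ∀ y → (y ^ (p ℕ.^ i)) ^ (p ℕ.^ (e ℕ.∸ i)) ≈ y
        split y = trans (^-assocʳ y (p ℕ.^ i) (p ℕ.^ (e ℕ.∸ i))) (trans (^-congʳ y
          (≡.trans (≡.sym (ℕ.^-distribˡ-+-* p i (e ℕ.∸ i))) (≡.cong (p ℕ.^_) (ℕ.m+[n∸m]≡n i≤e))))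
          (^q-fixed y))

      -- Cancelling the i-th Frobenius power from an equality of conjugates would leave x fixed by
      -- the (j - i)-th.
      conjugate-distinct : ∀ {i j} → i ℕ.< j → j ℕ.< e → ¬ (x ^ (p ℕ.^ i) ≈ x ^ (p ℕ.^ j))
      conjugate-distinct {i} {j} i<j j<e eq =
        conjugates (j ℕ.∸ i) (ℕ.m<n⇒0<n∸m i<j) (ℕ.≤-<-trans (ℕ.m∸n≤m j i) j<e)
          (^p^-injective {i} (ℕ.<⇒≤ (ℕ.<-trans i<j j<e)) (begin
            (x ^ (p ℕ.^ (j ℕ.∸ i))) ^ (p ℕ.^ i)     ≈⟨ ^-assocʳ x (p ℕ.^ (j ℕ.∸ i)) (p ℕ.^ i) ⟩
            x ^ (p ℕ.^ (j ℕ.∸ i) ℕ.* p ℕ.^ i)       ≈⟨ ^-congʳ x (ℕ.^-distribˡ-+-* p (j ℕ.∸ i) i) ⟨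
            x ^ (p ℕ.^ (j ℕ.∸ i ℕ.+ i))             ≈⟨ ^-congʳ x (≡.cong (p ℕ.^_) (ℕ.m∸n+n≡m (ℕ.<⇒≤ i<j))) ⟩
            x ^ (p ℕ.^ j)                           ≈⟨ eq ⟨
            x ^ (p ℕ.^ i)                           ∎))

      conjugate-injective : ∀ {i j : Fin e} → x ^ (p ℕ.^ toℕ i) ≈ x ^ (p ℕ.^ toℕ j) → i ≡ j
      conjugate-injective {i} {j} eq with ℕ.<-cmp (toℕ i) (toℕ j)
      ... | tri< i<j _ _ = contradiction eq (conjugate-distinct i<j (Fin.toℕ<n j))
      ... | tri≈ _ i≡j _ = Fin.toℕ-injective i≡j
      ... | tri> _ _ j<i = contradiction (sym eq) (conjugate-distinct j<i (Fin.toℕ<n i))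

      multiple≈0 : ∀ k {d} → d · 1# ≈ 0# → (k ℕ.* d) · 1# ≈ 0#
      multiple≈0 k {d} d·1≈0 = trans (×1-homo-* k d) (trans (*-congˡ d·1≈0) (zeroʳ _))

      -- For 0 < d < p, Bézout writes 1 as a difference of multiples of p and d, both of which
      -- vanish in K.
      ·1≈0⇒≡0 : ∀ {d} → d ℕ.< p → d · 1# ≈ 0# → d ≡ 0
      ·1≈0⇒≡0 {zero} _ _ = ≡.refl
      ·1≈0⇒≡0 {suc d} d<p d·1≈0 with coprime-Bézout (prime⇒coprime p-prime d<p)
      ... | Bézout.+- k l eq = contradiction
        (trans (sym (trans (+-congˡ (multiple≈0 l d·1≈0)) (+-identityʳ 1#)))
          (trans (×-congˡ eq) (multiple≈0 k p·1≈0))) 1≉0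
      ... | Bézout.-+ k l eq = contradiction
        (trans (sym (trans (+-congˡ (multiple≈0 k p·1≈0)) (+-identityʳ 1#)))
          (trans (×-congˡ eq) (multiple≈0 l d·1≈0))) 1≉0

      ·1-distinct : ∀ {c d} → c ℕ.< d → d ℕ.< p → ¬ (c · 1# ≈ d · 1#)
      ·1-distinct {c} {d} c<d d<p eq = contradiction
        (·1≈0⇒≡0 (ℕ.≤-<-trans (ℕ.m∸n≤m d c) d<p) (∙-cancelʳ (c · 1#) _ _ (begin
          (d ℕ.∸ c) · 1# + c · 1#     ≈⟨ ×-homo-+ 1# (d ℕ.∸ c) c ⟨
          (d ℕ.∸ c ℕ.+ c) · 1#        ≈⟨ ×-congˡ (ℕ.m∸n+n≡m (ℕ.<⇒≤ c<d)) ⟩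
          d · 1#                      ≈⟨ eq ⟨
          c · 1#                      ≈⟨ +-identityˡ _ ⟨
          0# + c · 1#                 ∎)))
        (ℕ.m>n⇒m∸n≢0 c<d)

      digits-injective : ∀ {c d : Fin p} → toℕ c · 1# ≈ toℕ d · 1# → c ≡ d
      digits-injective {c} {d} eq with ℕ.<-cmp (toℕ c) (toℕ d)
      ... | tri< c<d _ _ = contradiction eq (·1-distinct c<d (Fin.toℕ<n d))
      ... | tri≈ _ c≡d _ = Fin.toℕ-injective c≡d
      ... | tri> _ _ d<c = contradiction (sym eq) (·1-distinct d<c (Fin.toℕ<n c))

      -- Frobenius powers are ring homomorphisms that fix the digits, hence commute with polynomials
      -- whose coefficients are digits.
      eval-conjugate : ∀ i {m} (c : Fin m → Fin p) y →
        eval (digits c) (y ^ (p ℕ.^ i)) ≈ eval (digits c) y ^ (p ℕ.^ i)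
      eval-conjugate i {zero} c y = sym (×1-fixed p-prime p·1≈0 i 0)
      eval-conjugate i {suc m} c y = begin
        digits c Fin.zero + y ^ (p ℕ.^ i) * eval (digits (c ∘ Fin.suc)) (y ^ (p ℕ.^ i))
          ≈⟨ +-cong (×1-fixed p-prime p·1≈0 i (toℕ (c Fin.zero)))
                    (*-congˡ (sym (eval-conjugate i (c ∘ Fin.suc) y))) ⟨
        digits c Fin.zero ^ (p ℕ.^ i) + y ^ (p ℕ.^ i) * eval (digits (c ∘ Fin.suc)) y ^ (p ℕ.^ i)
          ≈⟨ +-congˡ (^-distrib-* y _ (p ℕ.^ i)) ⟨
        digits c Fin.zero ^ (p ℕ.^ i) + (y * eval (digits (c ∘ Fin.suc)) y) ^ (p ℕ.^ i)
          ≈⟨ ^p^-distrib-+ p-prime p·1≈0 i _ _ ⟨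
        eval (digits c) y ^ (p ℕ.^ i) ∎

      independent : ∀ (c d : Fin e → Fin p) → eval (digits c) x ≈ eval (digits d) x → ∀ i → c i ≡ d i
      independent c d eq i = digits-injective (x∙y⁻¹≈ε⇒x≈y _ _
        (rootBound noZeroDivisors (λ i → digits c i - digits d i) (λ i → x ^ (p ℕ.^ toℕ i))
          conjugate-injective root i))
        where
        root : ∀ i → eval (λ i → digits c i - digits d i) (x ^ (p ℕ.^ toℕ i)) ≈ 0#
        root i = begin
          eval (λ i → digits c i - digits d i) (x ^ (p ℕ.^ toℕ i))
            ≈⟨ eval-+ (digits c) (λ i → - digits d i) _ ⟩
          eval (digits c) (x ^ (p ℕ.^ toℕ i)) + eval (λ i → - digits d i) (x ^ (p ℕ.^ toℕ i))
            ≈⟨ +-congˡ (eval-neg (digits d) _) ⟩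
          eval (digits c) (x ^ (p ℕ.^ toℕ i)) - eval (digits d) (x ^ (p ℕ.^ toℕ i))
            ≈⟨ x≈y⇒x-y≈0 (trans (eval-conjugate (toℕ i) c x)
                 (trans (^-congˡ (p ℕ.^ toℕ i) eq) (sym (eval-conjugate (toℕ i) d x)))) ⟩
          0# ∎

      element : Fin q → Carrier
      element t = eval (digits (finToFun {p} {e} t)) x

      element-injective : ∀ {s t} → element s ≈ element t → s ≡ t
      element-injective {s} {t} eq = ≡.trans (≡.sym (Fin.funToFin-finToFin {e} {p} s))
        (≡.trans (funToFin-cong {e} {p} (independent (finToFun {p} {e} s) (finToFun {p} {e} t) eq))
                 (Fin.funToFin-finToFin {e} {p} t))

      -- This is Yᵠ - Y: the q + 1 = n + 3 coefficients begin with 0 and -1, and the rest is Yⁿ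
      -- shifted by two places.
      fixedPolynomial : Fin (suc (suc (suc n))) → Carrier
      fixedPolynomial Fin.zero              = 0#
      fixedPolynomial (Fin.suc Fin.zero)    = - 1#
      fixedPolynomial (Fin.suc (Fin.suc i)) = monomial n i

      eval-fixedPolynomial : ∀ y → eval fixedPolynomial y ≈ 0#
      eval-fixedPolynomial y = begin
        0# + y * (- 1# + y * eval (monomial n) y)     ≈⟨ +-identityˡ _ ⟩
        y * (- 1# + y * eval (monomial n) y)          ≈⟨ *-congˡ (+-congˡ (*-congˡ (eval-monomial n y))) ⟩
        y * (- 1# + y ^ suc n)                        ≈⟨ vanish (zeroOrUnit y) ⟩
        0#                                            ∎
        where
        vanish : y ≈ 0# ⊎ y ^ suc n ≈ 1# → y * (- 1# + y ^ suc n) ≈ 0#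
        vanish (inj₁ y≈0) = trans (*-congʳ y≈0) (zeroˡ _)
        vanish (inj₂ y^≈1) = trans (*-congˡ (trans (+-congˡ y^≈1) (-‿inverseˡ 1#))) (zeroʳ y)

      tooManyRoots : (r : Fin (suc (suc (suc n))) → Carrier) → (∀ {i j} → r i ≈ r j → i ≡ j) → ⊥
      tooManyRoots r r-injective = 1≉0 (trans (sym (monomial-last n))
        (rootBound noZeroDivisors fixedPolynomial r r-injective (λ i → eval-fixedPolynomial (r i))
          (Fin.suc (Fin.suc (fromℕ n)))))

      -- A missed y, together with the q distinct values of `element`, would give Yᵠ - Y more roots
      -- than its degree. Decidable equality makes the proof a search for the digits of y.
      element-surjective : ∀ y → ∃[ t ] element t ≈ y
      element-surjective y with Fin.any? (λ t → element t ≈? y)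
      ... | yes t≈y = t≈y
      ... | no  ∄t = ⊥-elim (tooManyRoots roots (λ {i} {j} → roots-injective i j))
        where
        cast : Fin (suc (suc n)) → Fin q
        cast = Fin.cast (≡.sym q≡2+n)
        roots : Fin (suc (suc (suc n))) → Carrier
        roots Fin.zero    = y
        roots (Fin.suc i) = element (cast i)
        roots-injective : ∀ i j → roots i ≈ roots j → i ≡ j
        roots-injective Fin.zero    Fin.zero    eq = ≡.refl
        roots-injective Fin.zero    (Fin.suc j) eq = contradiction (cast j , sym eq) ∄t
        roots-injective (Fin.suc i) Fin.zero    eq = contradiction (cast i , eq) ∄t
        roots-injective (Fin.suc i) (Fin.suc j) eq = ≡.cong Fin.suc
          (≡.trans (≡.sym (Fin.cast-involutive q≡2+n (≡.sym q≡2+n) i))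
            (≡.trans (≡.cong (Fin.cast q≡2+n) (element-injective eq))
              (Fin.cast-involutive q≡2+n (≡.sym q≡2+n) j)))

      index : Carrier → Fin q
      index y = proj₁ (element-surjective y)

      element-index : ∀ y → element (index y) ≈ y
      element-index y = proj₂ (element-surjective y)

      plane : Plane q
      plane = affinePlane {n = n} noZeroDivisors zeroOrUnit element element-injective index element-index

-- Localisation at an idempotent and its refinement until a field is reached.

module Idempotents where

  open import Algebra.Bundles using (CommutativeRing)
  open import Algebra.Structures using (IsCommutativeRing)
  open import Data.List.Base using (List; []; _∷_)
  open import Data.List.Relation.Unary.All as All using (All; []; _∷_)
  open import Data.Nat.Base using (ℕ; suc)
  open import Data.Product.Base using (_,_; ∃-syntax; _×_)
  open import Data.Sum.Base as Sum using (_⊎_; inj₁; inj₂)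
  open import Level using (Level)
  open import Relation.Nullary.Decidable using (Dec; yes; no)
  open import Relation.Nullary.Negation using (¬_)
  import Algebra.Properties.Semiring.Exp
  import Algebra.Properties.Ring

  -- Annihilating 1 - ε for an idempotent ε amounts to comparing elements
  -- after multiplication by ε.
  module Localisation {a ℓ : Level} (R : CommutativeRing a ℓ) where

    open CommutativeRing R
    open Algebra.Properties.Semiring.Exp semiring
    open import Relation.Binary.Reasoning.Setoid setoid

    *-swap : ∀ x y z → x * (y * z) ≈ y * (x * z)
    *-swap x y z = trans (sym (*-assoc x y z)) (trans (*-congʳ (*-comm x y)) (*-assoc y x z))

    module _ (ε : Carrier) where

      infix 4 _≈ε_
      record _≈ε_ (x y : Carrier) : Set ℓ where
        constructor mk
        field scaled : ε * x ≈ ε * y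
      open _≈ε_ public

      ≈⇒≈ε : ∀ {x y} → x ≈ y → x ≈ε y
      ≈⇒≈ε x≈y = mk (*-congˡ x≈y)

      localised-isCommutativeRing : IsCommutativeRing _≈ε_ _+_ _*_ -_ 0# 1#
      localised-isCommutativeRing = record
        { isRing = record
          { +-isAbelianGroup = record
            { isGroup = record
              { isMonoid = record
                { isSemigroup = record
                  { isMagma = record
                    { isEquivalence = record
                      { refl  = mk refl
                      ; sym   = λ p → mk (sym (scaled p))
                      ; trans = λ p q → mk (trans (scaled p) (scaled q))
                      }
                    ; ∙-cong = λ p q → mk (trans (distribˡ ε _ _)
                        (trans (+-cong (scaled p) (scaled q)) (sym (distribˡ ε _ _))))
                    }
                  ; assoc = λ x y z → ≈⇒≈ε (+-assoc x y z)
                  }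
                ; identity = (λ x → ≈⇒≈ε (+-identityˡ x)) , (λ x → ≈⇒≈ε (+-identityʳ x))
                }
              ; inverse = (λ x → ≈⇒≈ε (-‿inverseˡ x)) , (λ x → ≈⇒≈ε (-‿inverseʳ x))
              ; ⁻¹-cong = λ p → mk (trans (sym (-‿distribʳ-* ε _))
                  (trans (-‿cong (scaled p)) (-‿distribʳ-* ε _)))
              }
            ; comm = λ x y → ≈⇒≈ε (+-comm x y)
            }
          ; *-cong = λ {x} {y} {u} {v} p q → mk (begin
              ε * (x * u)     ≈⟨ *-assoc ε x u ⟨
              (ε * x) * u     ≈⟨ *-congʳ (scaled p) ⟩
              (ε * y) * u     ≈⟨ *-assoc ε y u ⟩
              ε * (y * u)     ≈⟨ *-swap ε y u ⟩
              y * (ε * u)     ≈⟨ *-congˡ (scaled q) ⟩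
              y * (ε * v)     ≈⟨ *-swap y ε v ⟩
              ε * (y * v)     ∎)
          ; *-assoc = λ x y z → ≈⇒≈ε (*-assoc x y z)
          ; *-identity = (λ x → ≈⇒≈ε (*-identityˡ x)) , (λ x → ≈⇒≈ε (*-identityʳ x))
          ; distrib = (λ x y z → ≈⇒≈ε (distribˡ x y z)) , (λ x y z → ≈⇒≈ε (distribʳ x y z))
          }
        ; *-comm = λ x y → ≈⇒≈ε (*-comm x y)
        }
        where open Algebra.Properties.Ring ring using (-‿distribʳ-*)

      localised : CommutativeRing a ℓ
      localised = record { isCommutativeRing = localised-isCommutativeRing }

    -- y^(n+1) is idempotent, so multiplying ε by it makes y invertible unless the
    -- product vanishes, in which case y is already zero.
    module Refinement (n : ℕ) (y*y^1+n≈y : ∀ y → y * y ^ suc n ≈ y)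
                      (≈0? : ∀ y → Dec (y ≈ 0#)) where

      ZeroOrUnit : Carrier → Carrier → Set ℓ
      ZeroOrUnit ε y = (ε * y ≈ 0#) ⊎ (ε * y ^ suc n ≈ ε)

      scale : ∀ {ε} t {y z} → ε * y ≈ z → (ε * t) * y ≈ z * t
      scale {ε} t {y} {z} εy≈z = begin
        (ε * t) * y     ≈⟨ *-assoc ε t y ⟩
        ε * (t * y)     ≈⟨ *-congˡ (*-comm t y) ⟩
        ε * (y * t)     ≈⟨ *-assoc ε y t ⟨
        (ε * y) * t     ≈⟨ *-congʳ εy≈z ⟩
        z * t           ∎

      ZeroOrUnit-* : ∀ {ε} t {y} → ZeroOrUnit ε y → ZeroOrUnit (ε * t) y
      ZeroOrUnit-* t = Sum.map (λ εy≈0 → trans (scale t εy≈0) (zeroˡ t)) (scale t)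

      ^-idempotent : ∀ y → y ^ suc n * y ^ suc n ≈ y ^ suc n
      ^-idempotent y = begin
        (y * y ^ n) * y ^ suc n     ≈⟨ *-congʳ (*-comm y (y ^ n)) ⟩
        (y ^ n * y) * y ^ suc n     ≈⟨ *-assoc _ _ _ ⟩
        y ^ n * (y * y ^ suc n)     ≈⟨ *-congˡ (y*y^1+n≈y y) ⟩
        y ^ n * y                   ≈⟨ *-comm _ _ ⟩
        y ^ suc n                   ∎

      unit-self : ∀ ε y → (ε * y ^ suc n) * y ^ suc n ≈ ε * y ^ suc n
      unit-self ε y = trans (*-assoc _ _ _) (*-congˡ (^-idempotent y))

      -- As y = y · y^(n+1), whatever annihilates the idempotent belonging to y annihilates y.
      killed : ∀ {ε y} → ε * y ^ suc n ≈ 0# → ε * y ≈ 0#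
      killed {ε} {y} eq = begin
        ε * y                     ≈⟨ *-congˡ (y*y^1+n≈y y) ⟨
        ε * (y * y ^ suc n)       ≈⟨ *-swap ε y _ ⟩
        y * (ε * y ^ suc n)       ≈⟨ *-congˡ eq ⟩
        y * 0#                    ≈⟨ zeroʳ y ⟩
        0#                        ∎

      -- Both alternatives of `ZeroOrUnit` pass from ε to its multiples, so a later choice never
      -- spoils an earlier one. The answer is therefore returned as a multiplier t of the original
      -- ε.
      refine : ∀ ys ε → ¬ (ε ≈ 0#) →
               ∃[ t ] (¬ (ε * t ≈ 0#) × All (ZeroOrUnit (ε * t)) ys)
      refine [] ε ε≉0 = 1# , (λ ε≈0 → ε≉0 (trans (sym (*-identityʳ ε)) ε≈0)) , []
      refine (y ∷ ys) ε ε≉0 with ≈0? (ε * y ^ suc n)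
      ... | yes εy≈0 =
        let t , εt≉0 , all = refine ys ε ε≉0
        in t , εt≉0 , ZeroOrUnit-* t (inj₁ (killed εy≈0)) ∷ all
      ... | no εy≉0 =
        let t , εyt≉0 , all = refine ys (ε * y ^ suc n) εy≉0
            reassociate = *-assoc ε (y ^ suc n) t
        in y ^ suc n * t
         , (λ eq → εyt≉0 (trans reassociate eq))
         , All.map (resp reassociate) (ZeroOrUnit-* t (inj₂ (unit-self ε y)) ∷ all)
        where
        resp : ∀ {ε ε′ y} → ε ≈ ε′ → ZeroOrUnit ε y → ZeroOrUnit ε′ y
        resp eq = Sum.map (λ εy≈0 → trans (*-congʳ (sym eq)) εy≈0)
                          (λ εy≈ε → trans (*-congʳ (sym eq)) (trans εy≈ε eq))

-- The field with q elements as a direct factor of 𝔽ₚ[x]/(x^(q-1) - 1), and its plane.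

module GaloisPlanes where

  open import Algebra.Bundles using (CommutativeRing)
  open import Data.Fin.Base as Fin using (Fin; toℕ; fromℕ; fromℕ<; inject₁; finToFun; funToFin)
  import Data.Fin.Properties as Fin
  open import Data.Integer.Base as ℤ using (ℤ; 0ℤ)
  import Data.Integer.DivMod as ℤ
  open import Data.List.Base as List using (List; []; _∷_; _++_; replicate; tabulate; length; map)
  open import Data.List.Relation.Unary.All.Properties using (tabulate⁻)
  import Data.List.Properties as List
  open import Data.Nat.Base as ℕ using (ℕ; zero; suc)
  import Data.Nat.Properties as ℕ
  import Data.Nat.DivMod as ℕ
  open import Data.Nat.Primality using (Prime; prime⇒nonZero; prime⇒nonTrivial)
  open import Data.Product.Base using (_,_; ∃-syntax; _×_; proj₁; proj₂)
  open import Data.Sum.Base as Sum using (_⊎_; inj₁; inj₂)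
  open import Function.Base using (_∘_)
  open import Level using (Level; 0ℓ; _⊔_)
  open import Relation.Binary.PropositionalEquality as ≡ using (_≡_)
  open import Relation.Nullary.Decidable using (Dec; map′)
  open import Relation.Nullary.Negation using (¬_)
  import Algebra.Properties.CommutativeSemiring.Exp
  import Algebra.Properties.Semiring.Exp
  import Algebra.Properties.Semiring.Mult
  open IntegerCoefficients
  open FreshmansDream
  open PolynomialRoots
  open CyclicGroupRing
  open AffinePlanes
  open Idempotents

  -- The sum p + p² + ... + pᵏ, which is the degree of the product of all x^(pᵈ) - x with 1 ≤ d ≤ k.
  geometric : ℕ → ℕ → ℕ
  geometric p zero    = 0
  geometric p (suc k) = p ℕ.^ suc k ℕ.+ geometric p k

  -- Each step needs only 2 · p^(k+1) ≤ p · p^(k+1), and for p = 2 there is equality. The bound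
  -- keeps the degree of u below q - 1, so that u is not affected by reduction modulo x^(q-1) - 1.
  geometric-bound : ∀ {p} → 1 ℕ.< p → ∀ k → 2 ℕ.+ geometric p k ℕ.≤ p ℕ.^ suc k
  geometric-bound {p} 1<p zero = ≡.subst (2 ℕ.≤_) (≡.sym (ℕ.*-identityʳ p)) 1<p
  geometric-bound {p} 1<p (suc k) = begin
    2 ℕ.+ (p ℕ.^ suc k ℕ.+ geometric p k)      ≡⟨ ℕ.+-assoc 2 (p ℕ.^ suc k) (geometric p k) ⟨
    2 ℕ.+ p ℕ.^ suc k ℕ.+ geometric p k        ≡⟨ ≡.cong (ℕ._+ geometric p k) (ℕ.+-comm 2 (p ℕ.^ suc k)) ⟩
    p ℕ.^ suc k ℕ.+ 2 ℕ.+ geometric p k        ≡⟨ ℕ.+-assoc (p ℕ.^ suc k) 2 (geometric p k) ⟩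
    p ℕ.^ suc k ℕ.+ (2 ℕ.+ geometric p k)      ≤⟨ ℕ.+-monoʳ-≤ (p ℕ.^ suc k) (geometric-bound 1<p k) ⟩
    p ℕ.^ suc k ℕ.+ p ℕ.^ suc k                ≡⟨ ≡.cong (p ℕ.^ suc k ℕ.+_) (ℕ.+-identityʳ _) ⟨
    2 ℕ.* p ℕ.^ suc k                          ≤⟨ ℕ.*-monoˡ-≤ (p ℕ.^ suc k) 1<p ⟩
    p ℕ.* p ℕ.^ suc k                          ∎
    where open ℕ.≤-Reasoning

  module Quotient {a ℓ : Level} (R : CommutativeRing a ℓ) where

    open CommutativeRing R hiding (zero)
    open Algebra.Properties.Semiring.Exp semiring
    open Algebra.Properties.CommutativeSemiring.Exp commutativeSemiring using (^-distrib-*)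
    open Algebra.Properties.Semiring.Mult semiring
      using (×-homo-+; ×1-homo-*; ×-congˡ) renaming (_×_ to _·_)
    open Frobenius R
    open Polynomial R
    open FiniteField R using (digits)
    open Localisation R
    open IntegerSolver R
    open import Relation.Binary.Reasoning.Setoid setoid

    -- A Horner form of y as a polynomial in x with natural coefficients. Recursion on it yields
    -- both y^q = y and a finite list of representatives.
    data Generated (x : Carrier) : Carrier → Set (a ⊔ ℓ) where
      nil  : ∀ {y} → y ≈ 0# → Generated x y
      step : ∀ {y z} d → y ≈ d · 1# + x * z → Generated x z → Generated x y

    conjugateProduct : ℕ → Carrier → ℕ → Carrier
    conjugateProduct p x zero    = 1#
    conjugateProduct p x (suc k) = (x ^ (p ℕ.^ suc k) - x) * conjugateProduct p x k

    -- Every y satisfies y^(pᵉ⁺¹) = y, so a suitable idempotent ε cuts out a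
    -- field; starting from a power of u keeps the conjugates of x apart in it.
    module Construction {p : ℕ} (p-prime : Prime p) (p·1≈0 : p · 1# ≈ 0#)
      (e n : ℕ) (q≡2+n : p ℕ.^ suc e ≡ suc (suc n)) (≈0? : ∀ y → Dec (y ≈ 0#))
      (x : Carrier) (x^1+n≈1 : x ^ suc n ≈ 1#) (generated : ∀ y → Generated x y)
      (u≉0 : ¬ (conjugateProduct p x e ≈ 0#)) where

      private instance _ = prime⇒nonZero p-prime

      x^q≈x : x ^ (p ℕ.^ suc e) ≈ x
      x^q≈x = trans (^-congʳ x q≡2+n) (trans (*-congˡ x^1+n≈1) (*-identityʳ x))

      generated-fixed : ∀ {y} → Generated x y → y ^ (p ℕ.^ suc e) ≈ y
      generated-fixed {y} (nil y≈0) =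
        trans (^-congˡ (p ℕ.^ suc e) y≈0) (trans (×1-fixed p-prime p·1≈0 (suc e) 0) (sym y≈0))
      generated-fixed {y} (step {z = z} d y≈d+xz gen) = begin
        y ^ (p ℕ.^ suc e)
          ≈⟨ ^-congˡ (p ℕ.^ suc e) y≈d+xz ⟩
        (d · 1# + x * z) ^ (p ℕ.^ suc e)
          ≈⟨ ^p^-distrib-+ p-prime p·1≈0 (suc e) (d · 1#) (x * z) ⟩
        (d · 1#) ^ (p ℕ.^ suc e) + (x * z) ^ (p ℕ.^ suc e)
          ≈⟨ +-cong (×1-fixed p-prime p·1≈0 (suc e) d)
               (trans (^-distrib-* x z (p ℕ.^ suc e)) (*-cong x^q≈x (generated-fixed gen))) ⟩
        d · 1# + x * z
          ≈⟨ y≈d+xz ⟨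
        y ∎

      y*y^1+n≈y : ∀ y → y * y ^ suc n ≈ y
      y*y^1+n≈y y = trans (sym (^-congʳ y q≡2+n)) (generated-fixed (generated y))

      ·1-mod : ∀ k → k · 1# ≈ (k ℕ.% p) · 1#
      ·1-mod k = begin
        k · 1#                                          ≈⟨ ×-congˡ (ℕ.m≡m%n+[m/n]*n k p) ⟩
        (k ℕ.% p ℕ.+ k ℕ./ p ℕ.* p) · 1#                ≈⟨ ×-homo-+ 1# (k ℕ.% p) _ ⟩
        (k ℕ.% p) · 1# + (k ℕ./ p ℕ.* p) · 1#           ≈⟨ +-congˡ (×1-homo-* (k ℕ./ p) p) ⟩
        (k ℕ.% p) · 1# + (k ℕ./ p) · 1# * p · 1#        ≈⟨ +-congˡ (trans (*-congˡ p·1≈0) (zeroʳ _)) ⟩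
        (k ℕ.% p) · 1# + 0#                             ≈⟨ +-identityʳ _ ⟩
        (k ℕ.% p) · 1#                                  ∎

      -- Multiplication by x rotates coefficients: the leading one wraps round to the constant term
      -- because x^(n+1) = 1, and multiples of 1 count modulo p. So p^(n+1) representatives exhaust
      -- R, and `refine` can run over all of them.
      span : ∀ {y} → Generated x y → ∃[ c ] y ≈ eval {suc n} (digits {p} c) x
      span (nil y≈0) = (λ _ → fromℕ< (ℕ.>-nonZero⁻¹ p))
        , trans y≈0 (sym (eval-zero (suc n) (λ _ → ×-congˡ {1#} (Fin.toℕ-fromℕ< (ℕ.>-nonZero⁻¹ p))) x))
      span {y} (step {z = z} d₀ y≈d+xz gen) with span gen
      ... | c , z≈c = c′ , (begin
        y
          ≈⟨ y≈d+xz ⟩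
        d₀ · 1# + x * z
          ≈⟨ +-congˡ (*-congˡ (trans z≈c (eval-init-last (digits c) x))) ⟩
        d₀ · 1# + x * (eval (digits c ∘ inject₁) x + x ^ n * last)
          ≈⟨ solve 5 (λ a x s t l → a :+ x :* (s :+ t :* l) := (a :+ (x :* t) :* l) :+ x :* s) refl
               (d₀ · 1#) x (eval (digits c ∘ inject₁) x) (x ^ n) last ⟩
        (d₀ · 1# + x ^ suc n * last) + x * eval (digits c ∘ inject₁) x
          ≈⟨ +-congʳ (begin
               d₀ · 1# + x ^ suc n * last
                 ≈⟨ +-congˡ (trans (*-congʳ x^1+n≈1) (*-identityˡ last)) ⟩
               d₀ · 1# + last
                 ≈⟨ ×-homo-+ 1# d₀ _ ⟨
               d · 1#
                 ≈⟨ ·1-mod d ⟩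
               (d ℕ.% p) · 1#
                 ≈⟨ ×-congˡ (Fin.toℕ-fromℕ< (ℕ.m%n<n d p)) ⟨
               digits c′ Fin.zero ∎) ⟩
        eval (digits c′) x ∎)
        where
        last : Carrier
        last = digits c (fromℕ n)
        d : ℕ
        d = d₀ ℕ.+ toℕ (c (fromℕ n))
        c′ : Fin (suc n) → Fin p
        c′ Fin.zero    = fromℕ< (ℕ.m%n<n d p)
        c′ (Fin.suc i) = c (inject₁ i)

      u : Carrier
      u = conjugateProduct p x e

      open Refinement n y*y^1+n≈y ≈0?

      u^1+n≉0 : ¬ (1# * u ^ suc n ≈ 0#)
      u^1+n≉0 eq = u≉0 (trans (sym (*-identityˡ u)) (killed eq))

      private
        representative : Fin (p ℕ.^ suc n) → Carrier
        representative t = eval {suc n} (digits (finToFun {p} {suc n} t)) x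

        refined : ∃[ t ] (¬ ((1# * u ^ suc n) * t ≈ 0#) × _)
        refined = refine (tabulate representative) (1# * u ^ suc n) u^1+n≉0

      abstract
        ε : Carrier
        ε = (1# * u ^ suc n) * proj₁ refined

        ε≉0 : ¬ (ε ≈ 0#)
        ε≉0 = proj₁ (proj₂ refined)

        zeroOrUnit : ∀ y → ZeroOrUnit ε y
        zeroOrUnit y with span (generated y)
        ... | c , y≈c = Sum.map
            (trans (*-congˡ y≈t)) (trans (*-congˡ (^-congˡ (suc n) y≈t)))
            (tabulate⁻ (proj₂ (proj₂ refined)) t)
          where
          t : Fin (p ℕ.^ suc n)
          t = funToFin c
          y≈t : y ≈ representative t
          y≈t = trans y≈c (eval-cong (λ i →
            reflexive (≡.cong (λ d → toℕ d · 1#) (≡.sym (Fin.finToFun-funToFin c i)))) x)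

        -- The refinement starts from the idempotent u^(n+1), so ε is a multiple of it. This makes u
        -- a unit in K.
        ε*u^1+n≈ε : ε * u ^ suc n ≈ ε
        ε*u^1+n≈ε = scale (proj₁ refined) (unit-self 1# u)

      K : CommutativeRing a ℓ
      K = localised ε

      private
        module K = CommutativeRing K
        module ^ᴷ = Algebra.Properties.Semiring.Exp K.semiring
        module ×ᴷ = Algebra.Properties.Semiring.Mult K.semiring

      -- K has the operations of R and only a coarser equality, so powers coincide on the nose.
      ^ᴷ≡^ : ∀ y k → y ^ᴷ.^ k ≡ y ^ k
      ^ᴷ≡^ y zero    = ≡.refl
      ^ᴷ≡^ y (suc k) = ≡.cong (y *_) (^ᴷ≡^ y k)

      ×ᴷ≡× : ∀ k y → k ×ᴷ.× y ≡ k · y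
      ×ᴷ≡× zero    y = ≡.refl
      ×ᴷ≡× (suc k) y = ≡.cong (y +_) (×ᴷ≡× k y)

      ≈0⇒≈ε0 : ∀ {y} → ε * y ≈ 0# → y K.≈ 0#
      ≈0⇒≈ε0 εy≈0 = mk (trans εy≈0 (sym (zeroʳ ε)))

      ≈ε0⇒≈0 : ∀ {y} → y K.≈ 0# → ε * y ≈ 0#
      ≈ε0⇒≈0 eq = trans (scaled eq) (zeroʳ ε)

      1≉ᴷ0 : ¬ (1# K.≈ 0#)
      1≉ᴷ0 eq = ε≉0 (trans (sym (*-identityʳ ε)) (≈ε0⇒≈0 eq))

      u≉ᴷ0 : ¬ (u K.≈ 0#)
      u≉ᴷ0 u≈0 = ε≉0 (begin
        ε                     ≈⟨ ε*u^1+n≈ε ⟨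
        ε * (u * u ^ n)       ≈⟨ *-assoc ε u _ ⟨
        (ε * u) * u ^ n       ≈⟨ *-congʳ (≈ε0⇒≈0 u≈0) ⟩
        0# * u ^ n            ≈⟨ zeroˡ (u ^ n) ⟩
        0#                    ∎)

      -- Read backwards: since u is nonzero in K, no x^(pᵈ) with 1 ≤ d ≤ e equals x there.
      conjugateProduct≈ᴷ0 : ∀ k d → 0 ℕ.< d → d ℕ.≤ k → x ^ (p ℕ.^ d) K.≈ x → conjugateProduct p x k K.≈ 0#
      conjugateProduct≈ᴷ0 zero (suc d) 0<d () eq
      conjugateProduct≈ᴷ0 (suc k) d 0<d d≤1+k eq =
        vanish (ℕ.m≤n⇒m<n∨m≡n d≤1+k)
        where
        vanish : d ℕ.< suc k ⊎ d ≡ suc k → (x ^ (p ℕ.^ suc k) - x) * conjugateProduct p x k K.≈ 0#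
        vanish (inj₁ (ℕ.s≤s d≤k)) =
          K.trans (K.*-congˡ (conjugateProduct≈ᴷ0 k d 0<d d≤k eq)) (K.zeroʳ _)
        vanish (inj₂ ≡.refl) = K.trans
          (K.*-congʳ (FiniteField.x≈y⇒x-y≈0 K eq)) (K.zeroˡ _)

      plane : Plane (p ℕ.^ suc e)
      plane = FiniteField.WithConjugates.plane K p-prime
        (K.trans (K.reflexive (×ᴷ≡× p 1#)) (≈⇒≈ε ε p·1≈0))
        1≉ᴷ0 (suc e) n q≡2+n
        (λ y → map′ ≈0⇒≈ε0 ≈ε0⇒≈0 (≈0? (ε * y)))
        (λ y → Sum.map ≈0⇒≈ε0
          (λ εy≈ε → K.trans (K.reflexive (^ᴷ≡^ y (suc n))) (mk (trans εy≈ε (sym (*-identityʳ ε)))))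
          (zeroOrUnit y))
        x
        (λ d 0<d d≤e eq → u≉ᴷ0 (conjugateProduct≈ᴷ0 e d 0<d (ℕ.s≤s⁻¹ d≤e)
          (K.trans (K.reflexive (≡.sym (^ᴷ≡^ x (p ℕ.^ d)))) eq)))

  module Galois {p : ℕ} (p-prime : Prime p) (e n : ℕ) (q≡2+n : p ℕ.^ suc e ≡ suc (suc n)) where

    private instance _ = prime⇒nonZero p-prime

    1<p : 1 ℕ.< p
    1<p = ℕ.nonTrivial⇒n>1 p {{prime⇒nonTrivial p-prime}}

    -- The exponent `suc n` is q - 1.
    open CyclicRing p (suc n) hiding (_≈_; isCommutativeRing; commutativeRing)

    R : CommutativeRing 0ℓ 0ℓ
    R = CyclicRing.commutativeRing p (suc n)

    open CommutativeRing R hiding (zero)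
    open Algebra.Properties.Semiring.Exp semiring
    open Quotient R
    open IntegerSolver R
    open import Relation.Binary.Reasoning.Setoid setoid

    generated : ∀ f → Generated x f
    generated []      = nil refl
    generated (a ∷ f) = step (a ℤ.%ℕ p)
      (trans (∷-split a f) (+-congʳ {x * f} (constant≈×1 a))) (generated f)

    shift : ℕ → Carrier → Carrier
    shift k f = replicate k 0ℤ ++ f

    shift≈ : ∀ k f → shift k f ≈ x ^ k * f
    shift≈ zero    f = sym (*-identityˡ f)
    shift≈ (suc k) f = begin
      0ℤ ∷ shift k f      ≈⟨ x⊠ (shift k f) ⟨
      x * shift k f       ≈⟨ *-congˡ {x} (shift≈ k f) ⟩
      x * (x ^ k * f)     ≈⟨ *-assoc x (x ^ k) f ⟨
      x ^ suc k * f       ∎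

    Monic-shift : ∀ k {m f} → Monic m f → Monic (k ℕ.+ m) (shift k f)
    Monic-shift zero    monic = monic
    Monic-shift (suc k) monic = 0ℤ ∷ Monic-shift k monic

    length-Monic : ∀ {m f} → Monic m f → length f ≡ suc m
    length-Monic one         = ≡.refl
    length-Monic (_ ∷ monic) = ≡.cong suc (length-Monic monic)

    Monic-⊞ : ∀ {m f} → Monic m f → ∀ g → length g ℕ.≤ m → Monic m (f ⊞ g)
    Monic-⊞ one         []      _           = one
    Monic-⊞ (a ∷ monic) []      _           = a ∷ monic
    Monic-⊞ (a ∷ monic) (b ∷ g) (ℕ.s≤s len) = (a ℤ.+ b) ∷ Monic-⊞ monic g len

    -- The same element as `conjugateProduct`, computed by shifting lists instead of by `_⊠_`, so
    -- that its leading entry stays literally 1.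
    monicProduct : ℕ → Carrier
    monicProduct zero    = 1#
    monicProduct (suc k) = shift (p ℕ.^ suc k) (monicProduct k) ⊞ (⊟ (0ℤ ∷ monicProduct k))

    monicProduct≈ : ∀ k → monicProduct k ≈ conjugateProduct p x k
    monicProduct≈ zero = refl
    monicProduct≈ (suc k) = begin
      shift (p ℕ.^ suc k) (monicProduct k) - (0ℤ ∷ monicProduct k)
        ≈⟨ +-cong (shift≈ (p ℕ.^ suc k) (monicProduct k)) (-‿cong (sym (x⊠ (monicProduct k)))) ⟩
      x ^ (p ℕ.^ suc k) * monicProduct k - x * monicProduct k
        ≈⟨ solve 3 (λ s x u → s :* u :- x :* u := (s :- x) :* u) refl
             (x ^ (p ℕ.^ suc k)) x (monicProduct k) ⟩
      (x ^ (p ℕ.^ suc k) - x) * monicProduct k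
        ≈⟨ *-congˡ {x ^ (p ℕ.^ suc k) - x} (monicProduct≈ k) ⟩
      (x ^ (p ℕ.^ suc k) - x) * conjugateProduct p x k ∎

    Monic-monicProduct : ∀ k → Monic (geometric p k) (monicProduct k)
    Monic-monicProduct zero = one
    Monic-monicProduct (suc k) = Monic-⊞ (Monic-shift (p ℕ.^ suc k) monic) _
      (≡.subst (ℕ._≤ geometric p (suc k))
        (≡.sym (≡.trans (List.length-map ℤ.-_ (0ℤ ∷ monicProduct k)) (≡.cong suc (length-Monic monic))))
        -- The subtracted list has length two more than the degree of the old product; as p^(k+1) ≥
        -- 2, it does not reach the leading entry of the shifted copy.
        (ℕ.+-monoˡ-≤ (geometric p k) (ℕ.≤-trans 1<p (ℕ.m≤m*n p (p ℕ.^ k) {{ℕ.m^n≢0 p k}}))))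
      where monic = Monic-monicProduct k

    u≉0 : ¬ (conjugateProduct p x e ≈ 0#)
    u≉0 u≈0 = Monic⇒≉0 1<p (Monic-monicProduct e)
      (ℕ.s≤s⁻¹ (≡.subst (2 ℕ.+ geometric p e ℕ.≤_) q≡2+n (geometric-bound 1<p e)))
      (trans (monicProduct≈ e) u≈0)

    plane : Plane (p ℕ.^ suc e)
    plane = Construction.plane p-prime p×1≈0 e n q≡2+n ≈0? x x^n≈1 generated u≉0

-- Powers of the Gaussian integer N + i and their first crossing of the real axis.

module GaussianPowers where

  open import Defs using (module Gaussian)
  open import Data.Integer.Base as ℤ using (ℤ; +_; 0ℤ; 1ℤ; _+_; _*_; -_; _-_; _≤_; _<_)
  import Data.Integer.Properties as ℤ
  open import Data.Integer.Solver using (module +-*-Solver)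
  open import Data.Nat.Base as ℕ using (ℕ; zero; suc)
  import Data.Nat.Properties as ℕ
  import Data.Nat.DivMod as ℕ
  open import Data.Product.Base using (_,_; ∃-syntax; _×_; proj₁; proj₂)
  open import Data.Sum.Base using (inj₁; inj₂)
  open import Relation.Binary.PropositionalEquality
  open import Relation.Nullary.Decidable using (yes; no)
  open import Relation.Nullary.Negation using (contradiction)
  import Algebra.Properties.Semiring.Exp
  open import Algebra.Bundles using (CommutativeRing)
  open +-*-Solver using (solve; _:=_; _:+_; _:*_; _:-_; :-_; con)

  module ℤ[i] = Gaussian ℤ.+-*-commutativeRing
  open ℤ[i] using (re; im; _+i_; im-≈)
  open Algebra.Properties.Semiring.Exp (CommutativeRing.semiring ℤ[i].commutativeRing)
    using (_^_; ^-homo-*; ^-assocʳ)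

  private
    *-nonNeg : ∀ {a b} → 0ℤ ≤ a → 0ℤ ≤ b → 0ℤ ≤ a * b
    *-nonNeg {a} {b} 0≤a 0≤b = subst (_≤ a * b) (ℤ.*-zeroʳ a)
      (ℤ.*-monoˡ-≤-nonNeg a {{ℤ.nonNegative 0≤a}} 0≤b)

    +-nonNeg : ∀ {a b} → 0ℤ ≤ a → 0ℤ ≤ b → 0ℤ ≤ a + b
    +-nonNeg = ℤ.+-mono-≤

    *-nonPos : ∀ {a b} → a ≤ 0ℤ → 0ℤ ≤ b → a * b ≤ 0ℤ
    *-nonPos {b = b} a≤0 0≤b = ℤ.*-monoʳ-≤-nonNeg b {{ℤ.nonNegative 0≤b}} a≤0

    -- The inequalities below are read off from explicit nonnegative differences.
    by-difference : ∀ {a b} d → b - a ≡ d → 0ℤ ≤ d → a ≤ b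
    by-difference d eq 0≤d = ℤ.0≤i-j⇒j≤i (subst (0ℤ ≤_) (sym eq) 0≤d)

    difference : ∀ {a b} → a ≤ b → 0ℤ ≤ b - a
    difference = ℤ.i≤j⇒0≤j-i

  module Powers (N : ℕ) (1≤N : 1 ℕ.≤ N) where

    x y : ℕ → ℤ
    x j = re ((+ N +i 1ℤ) ^ j)
    y j = im ((+ N +i 1ℤ) ^ j)

    x-suc : ∀ j → x (suc j) ≡ + N * x j - y j
    x-suc j = cong (λ t → + N * x j - t) (ℤ.*-identityˡ (y j))

    y-suc : ∀ j → y (suc j) ≡ x j + + N * y j
    y-suc j = trans (ℤ.+-comm (+ N * y j) (1ℤ * x j)) (cong (_+ + N * y j) (ℤ.*-identityˡ (x j)))

    y-+ : ∀ j k → y (j ℕ.+ k) ≡ x j * y k + y j * x k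
    y-+ j k = im-≈ (^-homo-* (+ N +i 1ℤ) j k)

    y1≡1 : y 1 ≡ 1ℤ
    y1≡1 = trans (y-suc 0) (cong (λ t → 1ℤ + t) (ℤ.*-zeroʳ (+ N)))

    x1≡N : x 1 ≡ + N
    x1≡N = trans (x-suc 0) (trans (ℤ.+-identityʳ _) (ℤ.*-identityʳ (+ N)))

    0≤N : 0ℤ ≤ + N
    0≤N = ℤ.+≤+ ℕ.z≤n

    -- The tangent of r times the angle of N + i is at most r / (N - r).
    firstQuadrant : ∀ r k → r ℕ.+ k ≡ N →
      0ℤ ≤ x r × 0ℤ ≤ y r × y r * + k ≤ + r * x r
    firstQuadrant zero k eq = ℤ.+≤+ ℕ.z≤n , ℤ.≤-refl , ℤ.≤-refl
    firstQuadrant (suc r) k eq with firstQuadrant r (suc k) (trans (ℕ.+-suc r k) eq)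
    ... | 0≤x , 0≤y , slope = 0≤x′ , 0≤y′ , slope′
      where
      X = x r
      Y = y r
      N≡ : + N ≡ + r + (1ℤ + + k)
      N≡ = cong +_ (sym (trans (ℕ.+-suc r k) eq))
      0≤k : 0ℤ ≤ + k
      0≤k = ℤ.+≤+ ℕ.z≤n
      0≤x′ : 0ℤ ≤ x (suc r)
      0≤x′ = subst (0ℤ ≤_) (sym (trans (x-suc r) (trans (cong (λ n → n * X - Y) N≡)
          (solve 4 (λ r k x y → (r :+ (con 1ℤ :+ k)) :* x :- y :=
            (r :* x :- y :* (con 1ℤ :+ k)) :+ ((con 1ℤ :+ k) :* x :+ k :* y)) refl (+ r) (+ k) X Y))))
        (+-nonNeg (difference slope)
          (+-nonNeg (*-nonNeg {1ℤ + + k} (ℤ.+≤+ ℕ.z≤n) 0≤x) (*-nonNeg 0≤k 0≤y)))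
      0≤y′ : 0ℤ ≤ y (suc r)
      0≤y′ = subst (0ℤ ≤_) (sym (y-suc r)) (+-nonNeg 0≤x (*-nonNeg 0≤N 0≤y))
      slope′ : y (suc r) * + k ≤ + suc r * x (suc r)
      slope′ = by-difference
        (+ N * (+ r * X - Y * (1ℤ + + k)) + ((1ℤ + + r) * X + + k * Y))
        (trans (cong₂ (λ s t → (1ℤ + + r) * s - t * + k) (x-suc r) (y-suc r))
          (trans (cong (λ n → (1ℤ + + r) * (n * X - Y) - (X + n * Y) * + k) N≡)
            (trans (solve 4 (λ r k x y →
                (con 1ℤ :+ r) :* ((r :+ (con 1ℤ :+ k)) :* x :- y) :- (x :+ (r :+ (con 1ℤ :+ k)) :* y) :* k :=
                (r :+ (con 1ℤ :+ k)) :* (r :* x :- y :* (con 1ℤ :+ k)) :+ ((con 1ℤ :+ r) :* x :+ k :* y))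
              refl (+ r) (+ k) X Y)
              (cong (λ n → n * (+ r * X - Y * (1ℤ + + k)) + ((1ℤ + + r) * X + + k * Y)) (sym N≡)))))
        (+-nonNeg (*-nonNeg 0≤N (difference slope))
          (+-nonNeg (*-nonNeg {1ℤ + + r} (ℤ.+≤+ ℕ.z≤n) 0≤x) (*-nonNeg 0≤k 0≤y)))

    -- The cotangent x / y drops by at least 1 / 2N in each step while x ≥ 0.
    secondQuadrant : ∀ c j → 0ℤ < y j → + 2 * + N * x j ≤ + c * y j →
      ∃[ k ] (x k ≤ 0ℤ × 0ℤ < y k)
    secondQuadrant c j 0<y bound with x j ℤ.≤? 0ℤ
    ... | yes x≤0 = j , x≤0 , 0<y
    secondQuadrant zero j 0<y bound | no x≰0 = contradiction bound (ℤ.<⇒≱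
      (subst (_< + 2 * + N * x j) (ℤ.*-zeroʳ (+ 2 * + N))
        (ℤ.*-monoˡ-<-pos (+ 2 * + N) {{ℤ.positive 0<2N}} (ℤ.≰⇒> x≰0))))
      where
      0<2N : 0ℤ < + 2 * + N
      0<2N = ℤ.*-monoˡ-<-pos (+ 2) {0ℤ} {+ N} (ℤ.+<+ 1≤N)
    secondQuadrant (suc c) j 0<y bound | no x≰0 = secondQuadrant c (suc j)
      (subst (0ℤ <_) (sym (y-suc j)) (ℤ.+-mono-<-≤ 0<X (*-nonNeg 0≤N (ℤ.<⇒≤ 0<y))))
      (by-difference
        (((+ N * ((1ℤ + + c) * Y - + 2 * + N * X)) + + N * Y) + + c * X)
        (trans (cong₂ (λ s t → + c * t - + 2 * + N * s) (x-suc j) (y-suc j))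
          (solve 4 (λ n c x y → c :* (x :+ n :* y) :- con (+ 2) :* n :* (n :* x :- y) :=
              ((n :* ((con 1ℤ :+ c) :* y :- con (+ 2) :* n :* x)) :+ n :* y) :+ c :* x)
            refl (+ N) (+ c) X Y))
        (+-nonNeg (+-nonNeg (*-nonNeg 0≤N (difference bound)) (*-nonNeg 0≤N (ℤ.<⇒≤ 0<y)))
          (*-nonNeg {+ c} (ℤ.+≤+ ℕ.z≤n) (ℤ.<⇒≤ 0<X))))
      where
      X = x j
      Y = y j
      0<X : 0ℤ < X
      0<X = ℤ.≰⇒> x≰0

    -- Squaring a power with x ≤ 0 < y gives the imaginary part 2xy ≤ 0.
    lowerHalfPlane : ∃[ j ] (1 ℕ.≤ j × y j ≤ 0ℤ)
    -- At j = 1 we have x = N and y = 1, so the bound 2N · x ≤ c · y holds with equality for c =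
    -- 2N².
    lowerHalfPlane with secondQuadrant (2 ℕ.* (N ℕ.* N)) 1
      (subst (0ℤ <_) (sym y1≡1) (ℤ.+<+ (ℕ.s≤s ℕ.z≤n)))
      (ℤ.≤-reflexive (trans (cong (+ 2 * + N *_) x1≡N)
        (trans (ℤ.*-assoc (+ 2) (+ N) (+ N)) (trans (cong (+ 2 *_) (sym (ℤ.pos-* N N)))
          (trans (sym (ℤ.pos-* 2 (N ℕ.* N))) (trans (sym (ℤ.*-identityʳ _))
            (cong (+ (2 ℕ.* (N ℕ.* N)) *_) (sym y1≡1))))))))
    ... | zero , _ , 0<y = contradiction 0<y (ℤ.<-irrefl refl)
    ... | suc a , x≤0 , 0<y = suc a ℕ.+ suc a , ℕ.s≤s ℕ.z≤n ,
      subst (_≤ 0ℤ) (sym (y-+ (suc a) (suc a)))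
        (ℤ.+-mono-≤ (*-nonPos x≤0 (ℤ.<⇒≤ 0<y))
          (subst (_≤ 0ℤ) (ℤ.*-comm (x (suc a)) (y (suc a))) (*-nonPos x≤0 (ℤ.<⇒≤ 0<y))))

    -- A search upwards from index 1, bounded by j. Since y 1 = 1, the crossing is not at the first
    -- power, whence 1 ≤ m.
    firstCrossing : ∀ j → 1 ℕ.≤ j → y j ≤ 0ℤ →
      ∃[ m ] (1 ℕ.≤ m × y (suc m) ≤ 0ℤ × (∀ i → 1 ℕ.≤ i → i ℕ.≤ m → 0ℤ < y i))
    firstCrossing (suc j) _ yj≤0 = search j 0 (ℕ.+-identityʳ _) λ i 1≤i i≤0 → contradiction 1≤i (ℕ.≤⇒≯ i≤0)
      where
      search : ∀ d i → d ℕ.+ i ≡ j → (∀ k → 1 ℕ.≤ k → k ℕ.≤ i → 0ℤ < y k) →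
        ∃[ m ] (1 ℕ.≤ m × y (suc m) ≤ 0ℤ × (∀ i → 1 ℕ.≤ i → i ℕ.≤ m → 0ℤ < y i))
      search d i d+i≡j positive with y (suc i) ℤ.≤? 0ℤ
      search d zero _ positive | yes y≤0 =
        contradiction (subst (_≤ 0ℤ) y1≡1 y≤0) (ℤ.<⇒≱ (ℤ.+<+ (ℕ.s≤s ℕ.z≤n)))
      search d (suc i) _ positive | yes y≤0 = suc i , ℕ.s≤s ℕ.z≤n , y≤0 , positive
      search zero i refl positive | no y≰0 = contradiction yj≤0 y≰0
      search (suc d) i d+i≡j positive | no y≰0 =
        search d (suc i) (trans (ℕ.+-suc d i) d+i≡j) λ k 1≤k k≤1+i → case k 1≤k (ℕ.m≤n⇒m<n∨m≡n k≤1+i)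
        where
        case : ∀ k → 1 ℕ.≤ k → _ → 0ℤ < y k
        case k 1≤k (inj₁ (ℕ.s≤s k≤i)) = positive k 1≤k k≤i
        case k 1≤k (inj₂ refl) = ℤ.≰⇒> y≰0

    -- Past the first index j = m + 1 with Im ≤ 0, the powers stay in the lower half
    -- plane for as long as the powers from the start stay in the first quadrant.
    afterCrossing : ∀ m r k → 1 ℕ.≤ m → 0ℤ < y m → y (suc m) ≤ 0ℤ → r ℕ.+ k ≡ N → y (suc m ℕ.+ r) ≤ 0ℤ
    afterCrossing m r k 1≤m 0<y y≤0 r+k≡N = subst (_≤ 0ℤ) (sym (y-+ (suc m) r))
      (ℤ.+-mono-≤ (*-nonPos x≤0 (proj₁ (proj₂ quadrant))) (*-nonPos y≤0 (proj₁ quadrant)))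
      where
      quadrant = firstQuadrant r k r+k≡N
      -- From x m + N · y m = y (m + 1) ≤ 0. Then x (m + 1) = N · x m - y m is nonpositive too, so
      -- the crossing power lies in the closed third quadrant.
      xm≤0 : x m ≤ 0ℤ
      xm≤0 = ℤ.≤-trans
        (by-difference (+ N * y m) (solve 2 (λ x t → (x :+ t) :- x := t) refl (x m) (+ N * y m))
          (*-nonNeg 0≤N (ℤ.<⇒≤ 0<y)))
        (subst (_≤ 0ℤ) (y-suc m) y≤0)
      x≤0 : x (suc m) ≤ 0ℤ
      x≤0 = subst (_≤ 0ℤ) (sym (x-suc m)) (ℤ.+-mono-≤
        (subst (_≤ 0ℤ) (ℤ.*-comm (x m) (+ N)) (*-nonPos xm≤0 0≤N))
        (ℤ.neg-mono-≤ (ℤ.<⇒≤ 0<y)))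

  -- Here k is j / p rounded up, computed as the quotient of j + p - 1 by p; r is what the remainder
  -- leaves of p - 1.
  roundUp : ∀ p → 1 ℕ.≤ p → ∀ j → ∃[ r ] ∃[ k ] (r ℕ.< p × j ℕ.+ r ≡ k ℕ.* p)
  roundUp p@(suc p-1) _ j = p-1 ℕ.∸ t ℕ.% p , t ℕ./ p , ℕ.s≤s (ℕ.m∸n≤m p-1 (t ℕ.% p)) ,
    ℕ.+-cancelˡ-≡ (t ℕ.% p) _ _ (begin
      t ℕ.% p ℕ.+ (j ℕ.+ (p-1 ℕ.∸ t ℕ.% p))     ≡⟨ ℕ.+-comm (t ℕ.% p) _ ⟩
      j ℕ.+ (p-1 ℕ.∸ t ℕ.% p) ℕ.+ t ℕ.% p       ≡⟨ ℕ.+-assoc j _ _ ⟩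
      j ℕ.+ (p-1 ℕ.∸ t ℕ.% p ℕ.+ t ℕ.% p)       ≡⟨ cong (j ℕ.+_) (ℕ.m∸n+n≡m (ℕ.s≤s⁻¹ (ℕ.m%n<n t p))) ⟩
      t                                         ≡⟨ ℕ.m≡m%n+[m/n]*n t p ⟩
      t ℕ.% p ℕ.+ t ℕ./ p ℕ.* p                 ∎)
    where
    open ≡-Reasoning
    t : ℕ
    t = j ℕ.+ p-1

  -- If k exceeded m, then kp ≥ p + pm ≥ p + 2m ≥ p + m + 1 would exceed m + 1 + r. Thus the k-th
  -- power still precedes the crossing although its p-th power comes after it.
  quotient≤ : ∀ {p m r k} → 2 ℕ.≤ p → 1 ℕ.≤ m → r ℕ.< p → suc m ℕ.+ r ≡ k ℕ.* p → 1 ℕ.≤ k × k ℕ.≤ m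
  quotient≤ {k = zero} _ _ _ ()
  quotient≤ {p} {m} {r} {suc k} 2≤p 1≤m r<p eq = ℕ.s≤s ℕ.z≤n , ℕ.≮⇒≥ λ m≤k → ℕ.<⇒≱
    (begin-strict
      suc m ℕ.+ r                  <⟨ ℕ.+-monoʳ-< (suc m) r<p ⟩
      suc m ℕ.+ p                  ≤⟨ ℕ.+-monoˡ-≤ p (ℕ.+-monoˡ-≤ m 1≤m) ⟩
      m ℕ.+ m ℕ.+ p                ≡⟨ cong (ℕ._+ p) (cong (m ℕ.+_) (sym (ℕ.+-identityʳ m))) ⟩
      2 ℕ.* m ℕ.+ p                ≡⟨ ℕ.+-comm (2 ℕ.* m) p ⟩
      p ℕ.+ 2 ℕ.* m                ≤⟨ ℕ.+-monoʳ-≤ p (ℕ.*-monoˡ-≤ m 2≤p) ⟩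
      p ℕ.+ p ℕ.* m                ≡⟨ cong (p ℕ.+_) (ℕ.*-comm p m) ⟩
      suc m ℕ.* p                  ∎)
    (subst (suc m ℕ.* p ℕ.≤_) (sym eq) (ℕ.*-monoˡ-≤ p m≤k))
    where open ℕ.≤-Reasoning

  -- Take N = p + 1, for which the first p powers stay in the first quadrant. Then w = N + i has its
  -- p-th power there. For z take (N + i)ᵏ, where kp is the first multiple of p at or after the
  -- crossing: fewer than p steps separate the two, so the p-th power of z is still in the lower
  -- half plane.
  signChange : ∀ p → 2 ℕ.≤ p →
    (∃[ z ] (0ℤ < im z × im (z ^ p) ≤ 0ℤ)) × (∃[ w ] (0ℤ < im w × 0ℤ ≤ im (w ^ p)))
  signChange p 2≤p = lower , (+ suc p +i 1ℤ) , ℤ.+<+ (ℕ.s≤s ℕ.z≤n)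
                   , proj₁ (proj₂ (firstQuadrant p 1 (ℕ.+-comm p 1)))
    where
    open Powers (suc p) (ℕ.s≤s ℕ.z≤n)
    lower : ∃[ z ] (0ℤ < im z × im (z ^ p) ≤ 0ℤ)
    lower with lowerHalfPlane
    ... | j , 1≤j , yj≤0 with firstCrossing j 1≤j yj≤0
    ... | m , 1≤m , y≤0 , positive with roundUp p (ℕ.≤-trans (ℕ.s≤s ℕ.z≤n) 2≤p) (suc m)
    ... | r , k , r<p , eq with quotient≤ 2≤p 1≤m r<p eq
    ... | 1≤k , k≤m = (+ suc p +i 1ℤ) ^ k , positive k 1≤k k≤m ,
      subst (_≤ 0ℤ) (sym (trans (im-≈ (^-assocʳ (+ suc p +i 1ℤ) k p)) (cong y (sym eq))))
        (afterCrossing m r (suc p ℕ.∸ r) 1≤m (positive m 1≤m ℕ.≤-refl) y≤0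
          (ℕ.m+[n∸m]≡n (ℕ.<⇒≤ (ℕ.m≤n⇒m≤1+n r<p))))

-- From Gaussian integers to rational points where Im (u + i)ᵖ has opposite signs.

module Cotangents where

  open import Defs using (module Gaussian)
  open import Algebra.Bundles using (CommutativeRing)
  open import Data.Integer.Base as ℤ using (ℤ; +_; -[1+_]; 0ℤ)
  import Data.Integer.Properties as ℤ
  open import Data.Nat.Base as ℕ using (ℕ; zero; suc)
  import Data.Nat.Properties as ℕ
  open import Data.Product.Base using (_,_; ∃-syntax; _×_)
  open import Data.Rational.Base
  open import Data.Rational.Properties
  open import Relation.Binary.PropositionalEquality
  import Algebra.Properties.CommutativeSemiring.Exp
  import Algebra.Properties.Semiring.Exp
  open IntegerCoefficients
  open GaussianPowers using (signChange; module ℤ[i])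

  module ℚ[i] = Gaussian +-*-commutativeRing
  open ℚ[i] using (Complex; re; im; _+i_; im-≈; _,_; fromReal)

  private
    module ℤ[i]^ = Algebra.Properties.Semiring.Exp (CommutativeRing.semiring ℤ[i].commutativeRing)
    module ℚ[i]R = CommutativeRing ℚ[i].commutativeRing
  open Algebra.Properties.Semiring.Exp ℚ[i]R.semiring using (_^_; ^-congˡ)
  open Algebra.Properties.CommutativeSemiring.Exp ℚ[i]R.commutativeSemiring using (^-distrib-*)
  open Algebra.Properties.Semiring.Exp (CommutativeRing.semiring +-*-commutativeRing)
    using () renaming (_^_ to _^ℚ_)
  open IntegerSolver +-*-commutativeRing

  fromℤ-nonNeg : ∀ {i} → 0ℤ ℤ.≤ i → 0ℚ ≤ fromℤ i
  fromℤ-nonNeg {+ zero}  _ = ≤-refl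
  fromℤ-nonNeg {+ suc n} _ = +-mono-≤ {0ℚ} {1ℚ} (<⇒≤ (positive⁻¹ 1ℚ)) (fromℤ-nonNeg {+ n} (ℤ.+≤+ ℕ.z≤n))
  fromℤ-nonNeg { -[1+ n ]} ()

  fromℤ-pos : ∀ {i} → 0ℤ ℤ.< i → 0ℚ < fromℤ i
  fromℤ-pos {+ zero}  (ℤ.+<+ ())
  fromℤ-pos {+ suc n} _ = +-mono-<-≤ {0ℚ} {1ℚ} (positive⁻¹ 1ℚ) (fromℤ-nonNeg {+ n} (ℤ.+≤+ ℕ.z≤n))

  fromℤ-nonPos : ∀ {i} → i ℤ.≤ 0ℤ → fromℤ i ≤ 0ℚ
  fromℤ-nonPos {+ zero}  _ = ≤-refl
  fromℤ-nonPos {+ suc n} (ℤ.+≤+ ())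
  fromℤ-nonPos { -[1+ n ]} _ = neg-antimono-≤ (fromℤ-nonNeg {+ suc n} (ℤ.+≤+ ℕ.z≤n))

  fromℤ[i] : ℤ[i].Complex → Complex
  fromℤ[i] z = fromℤ (ℤ[i].re z) +i fromℤ (ℤ[i].im z)

  fromℤ[i]-* : ∀ z w → fromℤ[i] (z ℤ[i].*ᶜ w) ≡ fromℤ[i] z ℚ[i].*ᶜ fromℤ[i] w
  fromℤ[i]-* z w = cong₂ _+i_
    (trans (fromℤ-+ (ℤ[i].re z ℤ.* ℤ[i].re w) (ℤ.- (ℤ[i].im z ℤ.* ℤ[i].im w)))
      (cong₂ _+_ (fromℤ-* (ℤ[i].re z) (ℤ[i].re w))
        (trans (fromℤ-neg (ℤ[i].im z ℤ.* ℤ[i].im w)) (cong -_ (fromℤ-* (ℤ[i].im z) (ℤ[i].im w))))))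
    (trans (fromℤ-+ (ℤ[i].re z ℤ.* ℤ[i].im w) (ℤ[i].im z ℤ.* ℤ[i].re w))
      (cong₂ _+_ (fromℤ-* (ℤ[i].re z) (ℤ[i].im w)) (fromℤ-* (ℤ[i].im z) (ℤ[i].re w))))

  fromℤ[i]-^ : ∀ z k → fromℤ[i] (z ℤ[i]^.^ k) ≡ fromℤ[i] z ^ k
  fromℤ[i]-^ z zero    = refl
  fromℤ[i]-^ z (suc k) = trans (fromℤ[i]-* z (z ℤ[i]^.^ k)) (cong (fromℤ[i] z ℚ[i].*ᶜ_) (fromℤ[i]-^ z k))

  -- The imaginary part of (u + i)ᵏ.  Its zeros are the cotangents of the
  -- multiples of π / k.
  imPower : ℕ → ℚ → ℚ
  imPower k u = im ((u +i 1ℚ) ^ k)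

  fromReal-^ : ∀ c k → fromReal c ^ k ℚ[i].≈ᶜ fromReal (c ^ℚ k)
  fromReal-^ c zero    = ℚ[i]R.refl
  fromReal-^ c (suc k) = ℚ[i]R.trans (ℚ[i]R.*-congˡ {fromReal c} (fromReal-^ c k))
    ( trans (cong (λ t → c * c ^ℚ k + - t) (*-zeroˡ 0ℚ)) (+-identityʳ _)
    , trans (cong₂ _+_ (*-zeroʳ c) (*-zeroˡ (c ^ℚ k))) (+-identityˡ 0ℚ))

  im-fromReal-* : ∀ d v → im (fromReal d ℚ[i].*ᶜ v) ≡ d * im v
  im-fromReal-* d v = trans (cong (λ t → d * im v + t) (*-zeroˡ (re v))) (+-identityʳ _)

  ^ℚ-pos : ∀ {c} → 0ℚ < c → ∀ k → 0ℚ < c ^ℚ k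
  ^ℚ-pos 0<c zero    = positive⁻¹ 1ℚ
  ^ℚ-pos {c} 0<c (suc k) = positive⁻¹ (c * c ^ℚ k)
    {{pos*pos⇒pos c {{positive 0<c}} (c ^ℚ k) {{positive (^ℚ-pos 0<c k)}}}}

  -- Factor z = c (u + i) with c = im z and u = re z / im z. The positive real factor cᵏ preserves
  -- the sign of the imaginary part.
  cotangent : ∀ z → 0ℚ < im z → ∀ k → ∃[ u ] ∃[ d ] (0ℚ < d × im (z ^ k) ≡ d * imPower k u)
  cotangent z 0<c k = u , c ^ℚ k , ^ℚ-pos 0<c k , (begin
    im (z ^ k)                                      ≡⟨ im-≈ (^-congˡ k z≈c[u+i]) ⟩
    im ((fromReal c ℚ[i].*ᶜ (u +i 1ℚ)) ^ k)         ≡⟨ im-≈ (^-distrib-* (fromReal c) (u +i 1ℚ) k) ⟩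
    im (fromReal c ^ k ℚ[i].*ᶜ (u +i 1ℚ) ^ k)       ≡⟨ im-≈ (ℚ[i]R.*-congʳ {(u +i 1ℚ) ^ k} (fromReal-^ c k)) ⟩
    im (fromReal (c ^ℚ k) ℚ[i].*ᶜ (u +i 1ℚ) ^ k)    ≡⟨ im-fromReal-* (c ^ℚ k) ((u +i 1ℚ) ^ k) ⟩
    c ^ℚ k * imPower k u                            ∎)
    where
    open ≡-Reasoning
    c : ℚ
    c = im z
    instance
      c-positive : Positive c
      c-positive = positive 0<c
      c-nonZero : NonZero c
      c-nonZero = pos⇒nonZero c
    u : ℚ
    u = re z * 1/ c
    z≈c[u+i] : z ℚ[i].≈ᶜ fromReal c ℚ[i].*ᶜ (u +i 1ℚ)
    z≈c[u+i] =
        sym (begin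
          c * (re z * 1/ c) + - (0ℚ * 1ℚ)   ≡⟨ +-identityʳ _ ⟩
          c * (re z * 1/ c)                 ≡⟨ cong (c *_) (*-comm (re z) (1/ c)) ⟩
          c * (1/ c * re z)                 ≡⟨ *-assoc c (1/ c) (re z) ⟨
          (c * 1/ c) * re z                 ≡⟨ cong (_* re z) (*-inverseʳ c) ⟩
          1ℚ * re z                         ≡⟨ *-identityˡ (re z) ⟩
          re z                              ∎)
      , sym (trans (cong₂ _+_ (*-identityʳ c) (*-zeroˡ u)) (+-identityʳ c))

  imPower-signChange : ∀ p → 2 ℕ.≤ p → (∃[ u ] imPower p u ≤ 0ℚ) × (∃[ v ] 0ℚ ≤ imPower p v)
  imPower-signChange p 2≤p =
    let (z , 0<im-z , im-z^p≤0) , (w , 0<im-w , 0≤im-w^p) = signChange p 2≤p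
        u , d , 0<d , eq  = cotangent (fromℤ[i] z) (fromℤ-pos 0<im-z) p
        v , e , 0<e , eq′ = cotangent (fromℤ[i] w) (fromℤ-pos 0<im-w) p
    in (u , *-cancelˡ-≤-pos d {{positive 0<d}} (subst₂ _≤_
             (trans (cong im (fromℤ[i]-^ z p)) eq) (sym (*-zeroʳ d)) (fromℤ-nonPos im-z^p≤0)))
     , (v , *-cancelˡ-≤-pos e {{positive 0<e}} (subst₂ _≤_
             (sym (*-zeroʳ e)) (trans (cong im (fromℤ[i]-^ w p)) eq′) (fromℤ-nonNeg 0≤im-w^p)))

-- Bisection for real roots and the reciprocal of 1 + x².

module RealRoots where

  open import Defs hiding (_·_)
  open import Algebra.Bundles using (CommutativeRing)
  open import Data.Integer.Base as ℤ using (ℤ; +_; -[1+_])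
  import Data.Integer.Properties as ℤ
  open import Data.Nat.Base as ℕ using (ℕ; zero; suc)
  import Data.Nat.Properties as ℕ
  open import Data.Product.Base using (_,_; ∃-syntax; _×_)
  open import Data.Rational.Base
  open import Data.Rational.Properties
  import Data.Rational.Unnormalised.Base as ℚᵘ
  import Data.Rational.Unnormalised.Properties as ℚᵘ
  open import Relation.Binary.PropositionalEquality
  open import Relation.Nullary.Decidable using (yes; no)
  import Algebra.Properties.Semiring.Mult
  import Algebra.Properties.Semiring.Exp
  open IntegerCoefficients
  open Cotangents using (imPower; imPower-signChange; module ℚ[i])

  open IntegerSolver +-*-commutativeRing using (solve; _:=_; _:+_; _:*_; _:-_; :-_)
  open Algebra.Properties.Semiring.Mult (CommutativeRing.semiring +-*-commutativeRing)
    using () renaming (_×_ to _·_)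

  toℚᵘ-/1 : ∀ n → toℚᵘ (+ n / 1) ℚᵘ.≃ ℚᵘ.mkℚᵘ (+ n) 0
  toℚᵘ-/1 n = toℚᵘ-fromℚᵘ (ℚᵘ.mkℚᵘ (+ n) 0)

  suc-/1 : ∀ n → 1ℚ + + n / 1 ≡ + suc n / 1
  suc-/1 n = toℚᵘ-injective (begin
    toℚᵘ (1ℚ + + n / 1)                     ≈⟨ toℚᵘ-homo-+ 1ℚ (+ n / 1) ⟩
    ℚᵘ.1ℚᵘ ℚᵘ.+ toℚᵘ (+ n / 1)              ≈⟨ ℚᵘ.+-congʳ ℚᵘ.1ℚᵘ (toℚᵘ-/1 n) ⟩
    ℚᵘ.1ℚᵘ ℚᵘ.+ ℚᵘ.mkℚᵘ (+ n) 0             ≈⟨ ℚᵘ.*≡* (cong (ℤ._* + 1) (cong (λ i → + 1 ℤ.+ i) (ℤ.*-identityʳ (+ n)))) ⟩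
    ℚᵘ.mkℚᵘ (+ suc n) 0                     ≈⟨ toℚᵘ-/1 (suc n) ⟨
    toℚᵘ (+ suc n / 1)                      ∎)
    where open ℚᵘ.≃-Reasoning

  ·1≡/1 : ∀ n → n · 1ℚ ≡ + n / 1
  ·1≡/1 zero    = refl
  ·1≡/1 (suc n) = trans (cong (λ t → 1ℚ + t) (·1≡/1 n)) (suc-/1 n)

  -- For r = i / d the natural number ∣i∣ + 1 will do, because d ≥ 1.
  natural-above : ∀ r → ∃[ n ] (r < suc n · 1ℚ)
  natural-above r@(mkℚ i d-1 _) = ℤ.∣ i ∣ , subst (r <_) (sym (·1≡/1 (suc ℤ.∣ i ∣)))
    (toℚᵘ-cancel-< (ℚᵘ.<-respʳ-≃ (ℚᵘ.≃-sym (toℚᵘ-/1 (suc ℤ.∣ i ∣)))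
      (ℚᵘ.*<* (subst (ℤ._< + suc ℤ.∣ i ∣ ℤ.* + suc d-1) (sym (ℤ.*-identityʳ i))
        (ℤ.≤-<-trans (i≤∣i∣ i) (subst (+ ℤ.∣ i ∣ ℤ.<_) (ℤ.pos-* (suc ℤ.∣ i ∣) (suc d-1))
          (ℤ.+<+ (ℕ.m≤m*n (suc ℤ.∣ i ∣) (suc d-1)))))))))
    where
    i≤∣i∣ : ∀ i → i ℤ.≤ + ℤ.∣ i ∣
    i≤∣i∣ (+ n)    = ℤ.≤-refl
    i≤∣i∣ -[1+ n ] = ℤ.-≤+

  archimedean : ∀ D {ε} → 0ℚ < ε → ∃[ n ] (D < suc n · 1ℚ * ε)
  archimedean D {ε} 0<ε =
    let n , bound = natural-above (D * 1/ ε)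
    in n , subst (_< suc n · 1ℚ * ε)
         (trans (*-assoc D (1/ ε) ε) (trans (cong (D *_) (*-inverseˡ ε)) (*-identityʳ D)))
         (*-monoˡ-<-pos ε bound)
    where instance
    ε-positive : Positive ε
    ε-positive = positive 0<ε
    ε-nonZero : NonZero ε
    ε-nonZero = pos⇒nonZero ε

  ·1-positive : ∀ n → 0ℚ < suc n · 1ℚ
  ·1-positive zero    = positive⁻¹ 1ℚ
  ·1-positive (suc n) = +-mono-< (positive⁻¹ 1ℚ) (·1-positive n)

  halves : ∀ t → ½ * t + ½ * t ≡ t
  halves t = trans (sym (*-distribʳ-+ t ½ ½)) (*-identityˡ t)

  ∣½*∣ : ∀ t → ∣ ½ * t ∣ ≡ ½ * ∣ t ∣
  ∣½*∣ t = ∣p*q∣≡∣p∣*∣q∣ ½ t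

  ∣p-q∣≡∣q-p∣ : ∀ p q → ∣ p - q ∣ ≡ ∣ q - p ∣
  ∣p-q∣≡∣q-p∣ p q = trans (sym (∣-p∣≡∣p∣ (p - q)))
    (cong ∣_∣ (solve 2 (λ p q → :- (p :- q) := q :- p) refl p q))

  triangle : ∀ p q r → ∣ p - r ∣ ≤ ∣ p - q ∣ + ∣ q - r ∣
  triangle p q r = subst (λ d → ∣ d ∣ ≤ ∣ p - q ∣ + ∣ q - r ∣)
    (solve 3 (λ p q r → (p :- q) :+ (q :- r) := p :- r) refl p q r)
    (∣p+q∣≤∣p∣+∣q∣ (p - q) (q - r))

  module Bisection (f : ℚ → ℚ) where

    -- No order between `lower` and `upper` is recorded, since the two sign points may come either
    -- way round; the gap is signed and measured by its absolute value.
    record Bracket : Set where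
      field
        lower upper : ℚ
        lower≤0     : f lower ≤ 0ℚ
        0≤upper     : 0ℚ ≤ f upper

      gap : ℚ
      gap = upper - lower

      midpoint : ℚ
      midpoint = lower + ½ * gap

    open Bracket

    bisect : Bracket → Bracket
    bisect B with f (midpoint B) ≤? 0ℚ
    ... | yes mid≤0 = record { lower = midpoint B ; upper = upper B ; lower≤0 = mid≤0 ; 0≤upper = 0≤upper B }
    ... | no  mid≰0 = record { lower = lower B ; upper = midpoint B ; lower≤0 = lower≤0 B ; 0≤upper = <⇒≤ (≰⇒> mid≰0) }

    ∣gap∣ : Bracket → ℚ
    ∣gap∣ B = ∣ gap B ∣

    private
      mid-lower : ∀ B → midpoint B - lower B ≡ ½ * gap B
      mid-lower B = solve 2 (λ l g → (l :+ g) :- l := g) refl (lower B) (½ * gap B)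

      upper-mid : ∀ B → upper B - midpoint B ≡ ½ * gap B
      upper-mid B = trans (solve 3 (λ u l g → u :- (l :+ g) := (u :- l) :- g) refl (upper B) (lower B) (½ * gap B))
        (trans (cong (_- ½ * gap B) (sym (halves (gap B))))
          (solve 1 (λ g → (g :+ g) :- g := g) refl (½ * gap B)))

    gap-bisect : ∀ B → ∣gap∣ (bisect B) ≡ ½ * ∣gap∣ B
    gap-bisect B with f (midpoint B) ≤? 0ℚ
    ... | yes _ = trans (cong ∣_∣ (upper-mid B)) (∣½*∣ (gap B))
    ... | no  _ = trans (cong ∣_∣ (mid-lower B)) (∣½*∣ (gap B))

    lower-bisect : ∀ B → ∣ lower (bisect B) - lower B ∣ ≤ ½ * ∣gap∣ B
    lower-bisect B with f (midpoint B) ≤? 0ℚ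
    ... | yes _ = ≤-reflexive (trans (cong ∣_∣ (mid-lower B)) (∣½*∣ (gap B)))
    ... | no  _ = subst (_≤ ½ * ∣gap∣ B) (sym (cong ∣_∣ (+-inverseʳ (lower B))))
      (subst (_≤ ½ * ∣gap∣ B) (*-zeroʳ ½) (*-monoˡ-≤-nonNeg ½ (0≤∣p∣ (gap B))))

    module _ (B₀ : Bracket) where

      bracket : ℕ → Bracket
      bracket zero    = B₀
      bracket (suc n) = bisect (bracket n)

      l g : ℕ → ℚ
      l n = lower (bracket n)
      g n = gap (bracket n)

      -- A bisection moves the lower end by at most half of the gap and removes the other half from
      -- the gap, so the sum of displacement and gap never grows. The sum is what makes the
      -- induction close.
      drift : ∀ m k → ∣ l (k ℕ.+ m) - l m ∣ + ∣ g (k ℕ.+ m) ∣ ≤ ∣ g m ∣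
      drift m zero = ≤-reflexive (trans (cong (λ t → ∣ t ∣ + ∣ g m ∣) (+-inverseʳ (l m))) (+-identityˡ _))
      drift m (suc k) = begin
        ∣ l (suc n) - l m ∣ + ∣ g (suc n) ∣
          ≤⟨ +-mono-≤ (≤-trans (triangle (l (suc n)) (l n) (l m)) (+-monoˡ-≤ ∣ l n - l m ∣ (lower-bisect (bracket n))))
                      (≤-reflexive (gap-bisect (bracket n))) ⟩
        (½ * ∣ g n ∣ + ∣ l n - l m ∣) + ½ * ∣ g n ∣
          ≡⟨ solve 2 (λ h t → (h :+ t) :+ h := t :+ (h :+ h)) refl (½ * ∣ g n ∣) ∣ l n - l m ∣ ⟩
        ∣ l n - l m ∣ + (½ * ∣ g n ∣ + ½ * ∣ g n ∣)
          ≡⟨ cong (λ t → ∣ l n - l m ∣ + t) (halves ∣ g n ∣) ⟩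
        ∣ l n - l m ∣ + ∣ g n ∣
          ≤⟨ drift m k ⟩
        ∣ g m ∣ ∎
        where
        open ≤-Reasoning
        n : ℕ
        n = k ℕ.+ m

      -- A linear bound in place of 2ⁿ already combines with the Archimedean property. The step uses
      -- n + 2 ≤ 2 (n + 1).
      gap-bound : ∀ n → suc n · 1ℚ * ∣ g n ∣ ≤ ∣ g 0 ∣
      gap-bound zero = ≤-reflexive (trans (cong (_* ∣ g 0 ∣) (+-identityʳ 1ℚ)) (*-identityˡ _))
      gap-bound (suc n) = begin
        (1ℚ + s) * ∣ g (suc n) ∣        ≡⟨ cong ((1ℚ + s) *_) (gap-bisect (bracket n)) ⟩
        (1ℚ + s) * h                    ≤⟨ *-monoʳ-≤-nonNeg h {{nonNegative 0≤h}} (+-monoˡ-≤ s 1≤s) ⟩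
        (s + s) * h                     ≡⟨ solve 2 (λ s h → (s :+ s) :* h := s :* (h :+ h)) refl s h ⟩
        s * (h + h)                     ≡⟨ cong (s *_) (halves ∣ g n ∣) ⟩
        s * ∣ g n ∣                     ≤⟨ gap-bound n ⟩
        ∣ g 0 ∣                         ∎
        where
        open ≤-Reasoning
        s h : ℚ
        s = suc n · 1ℚ
        h = ½ * ∣ g n ∣
        0≤h : 0ℚ ≤ h
        0≤h = subst (_≤ h) (*-zeroʳ ½) (*-monoˡ-≤-nonNeg ½ (0≤∣p∣ (g n)))
        1≤s : 1ℚ ≤ s
        1≤s = subst (_≤ s) (+-identityʳ 1ℚ) (+-monoʳ-≤ 1ℚ (0≤ n))
          where
          0≤ : ∀ n → 0ℚ ≤ n · 1ℚ
          0≤ zero    = ≤-refl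
          0≤ (suc n) = <⇒≤ (·1-positive n)

      gap-decreasing : ∀ {m n} → m ℕ.≤ n → ∣ g n ∣ ≤ ∣ g m ∣
      gap-decreasing {m} {n} m≤n = subst (λ k → ∣ g k ∣ ≤ ∣ g m ∣) (ℕ.m∸n+n≡m m≤n)
        (≤-trans (≤-trans (≤-reflexive (sym (+-identityˡ _))) (+-monoˡ-≤ ∣ g (n ℕ.∸ m ℕ.+ m) ∣ (0≤∣p∣ (l (n ℕ.∸ m ℕ.+ m) - l m))))
                 (drift m (n ℕ.∸ m)))

      lower-drift : ∀ {m n} → m ℕ.≤ n → ∣ l n - l m ∣ ≤ ∣ g m ∣
      lower-drift {m} {n} m≤n = subst (λ k → ∣ l k - l m ∣ ≤ ∣ g m ∣) (ℕ.m∸n+n≡m m≤n)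
        (≤-trans (≤-trans (≤-reflexive (sym (+-identityʳ _))) (+-monoʳ-≤ ∣ l (n ℕ.∸ m ℕ.+ m) - l m ∣ (0≤∣p∣ (g (n ℕ.∸ m ℕ.+ m)))))
                 (drift m (n ℕ.∸ m)))

      gap→0 : ∀ {ε} → 0ℚ < ε → ∃[ N ] (∀ n → N ℕ.≤ n → ∣ g n ∣ < ε)
      gap→0 {ε} 0<ε =
        let N , D<Nε = archimedean ∣ g 0 ∣ 0<ε
        in N , λ n N≤n → ≤-<-trans (gap-decreasing N≤n)
             (*-cancelˡ-<-nonNeg (suc N · 1ℚ) {{nonNegative (<⇒≤ (·1-positive N))}}
               (≤-<-trans (gap-bound N) D<Nε))

      half-positive : ∀ {ε} → 0ℚ < ε → 0ℚ < ½ * ε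
      half-positive {ε} 0<ε = subst (_< ½ * ε) (*-zeroʳ ½) (*-monoʳ-<-pos ½ 0<ε)

      add-halves : ∀ {ε s t} → s < ½ * ε → t < ½ * ε → s + t < ε
      add-halves {ε} {s} {t} s< t< = subst (λ r → s + t < r) (halves ε) (+-mono-< s< t<)

      lower-cauchy : IsCauchy l
      lower-cauchy ε 0<ε =
        let N , small = gap→0 (half-positive 0<ε)
            near : ∀ n → N ℕ.≤ n → ∣ l n - l N ∣ < ½ * ε
            near n N≤n = ≤-<-trans (lower-drift N≤n) (small N ℕ.≤-refl)
        in N , λ m n N≤m N≤n → ≤-<-trans (triangle (l m) (l N) (l n))
             (add-halves {ε} (near m N≤m) (subst (_< ½ * ε) (∣p-q∣≡∣q-p∣ (l n) (l N)) (near n N≤n)))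

      gap-cauchy : IsCauchy g
      gap-cauchy ε 0<ε =
        let N , small = gap→0 (half-positive 0<ε)
        in N , λ m n N≤m N≤n → ≤-<-trans
             (subst (∣ g m - g n ∣ ≤_) (cong (λ t → ∣ g m ∣ + t) (∣-p∣≡∣p∣ (g n))) (∣p+q∣≤∣p∣+∣q∣ (g m) (- g n)))
             (add-halves {ε} (small m N≤m) (small n N≤n))

      root gapᵣ : ℝ
      root = mkℝ l lower-cauchy
      gapᵣ = mkℝ g gap-cauchy

      gapᵣ≈0 : gapᵣ ≈ᵣ ι 0ℚ
      gapᵣ≈0 = mk≈ λ ε 0<ε → let N , small = gap→0 0<ε
        in N , λ n N≤n → subst (λ t → ∣ t ∣ < ε) (sym (+-identityʳ (g n))) (small n N≤n)

      module _ (F : ℝ → ℝ) (F-seq : ∀ x n → seq (F x) n ≡ f (seq x n))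
               (F-cong : ∀ {x y} → x ≈ᵣ y → F x ≈ᵣ F y) where

        private
          module R = CommutativeRing ℝ-commutativeRing

          Froot≈Fupper : F root ≈ᵣ F (root +ᵣ gapᵣ)
          Froot≈Fupper = F-cong (R.sym (R.trans (R.+-congˡ {root} gapᵣ≈0) (R.+-identityʳ root)))

          below : ∀ n → seq (F root) n ≤ 0ℚ
          below n = subst (_≤ 0ℚ) (sym (F-seq root n)) (lower≤0 (bracket n))

          above : ∀ n → 0ℚ ≤ seq (F (root +ᵣ gapᵣ)) n
          above n = subst (0ℚ ≤_) (sym (trans (F-seq (root +ᵣ gapᵣ) n) (cong f
              (solve 2 (λ l u → l :+ (u :- l) := u) refl (l n) (upper (bracket n))))))
            (0≤upper (bracket n))

          squeeze : ∀ {s t} → s ≤ 0ℚ → 0ℚ ≤ t → ∣ s - 0ℚ ∣ ≤ ∣ s - t ∣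
          squeeze {s} {t} s≤0 0≤t = begin
            ∣ s - 0ℚ ∣     ≡⟨ cong ∣_∣ (+-identityʳ s) ⟩
            ∣ s ∣          ≡⟨ ∣-p∣≡∣p∣ s ⟨
            ∣ - s ∣        ≡⟨ 0≤p⇒∣p∣≡p (neg-antimono-≤ s≤0) ⟩
            - s            ≡⟨ +-identityˡ (- s) ⟨
            0ℚ - s         ≤⟨ +-monoˡ-≤ (- s) 0≤t ⟩
            t - s          ≡⟨ 0≤p⇒∣p∣≡p (+-mono-≤ 0≤t (neg-antimono-≤ s≤0)) ⟨
            ∣ t - s ∣      ≡⟨ ∣p-q∣≡∣q-p∣ t s ⟩
            ∣ s - t ∣      ∎
            where open ≤-Reasoning

        -- The sequences of lower and upper ends are equal as real numbers, so `F-cong` gives equal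
        -- values there. Termwise these values have opposite signs, hence each is bounded by their
        -- difference.
        F-root≈0 : F root ≈ᵣ ι 0ℚ
        F-root≈0 = mk≈ λ ε 0<ε →
          let N , near = close Froot≈Fupper ε 0<ε
          in N , λ n N≤n → ≤-<-trans (squeeze (below n) (above n)) (near n N≤n)

  module _ (x : ℝ) where

    private
      module R = CommutativeRing ℝ-commutativeRing

    1+x² : ℝ
    1+x² = x *ᵣ x +ᵣ ι 1ℚ

    private
      q : ℕ → ℚ
      q = seq 1+x²

      1≤q : ∀ n → 1ℚ ≤ q n
      1≤q n = subst (_≤ q n) (+-identityˡ 1ℚ) (+-monoˡ-≤ 1ℚ (square (seq x n)))
        where
        square : ∀ t → 0ℚ ≤ t * t
        square t with 0ℚ ≤? t
        ... | yes 0≤t = subst (_≤ t * t) (*-zeroʳ t) (*-monoˡ-≤-nonNeg t {{nonNegative 0≤t}} 0≤t)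
        ... | no  0≰t = subst₂ _≤_ (*-zeroʳ (- t)) (solve 1 (λ t → (:- t) :* (:- t) := t :* t) refl t)
          (*-monoˡ-≤-nonNeg (- t) {{nonNegative 0≤-t}} 0≤-t)
          where
          0≤-t : 0ℚ ≤ - t
          0≤-t = neg-antimono-≤ (<⇒≤ (≰⇒> 0≰t))

      instance
        q-positive : ∀ {n} → Positive (q n)
        q-positive {n} = positive (<-≤-trans (positive⁻¹ 1ℚ) (1≤q n))
        q-nonZero : ∀ {n} → NonZero (q n)
        q-nonZero {n} = pos⇒nonZero (q n)

      s : ℕ → ℚ
      s n = 1/ q n

      0≤s : ∀ n → 0ℚ ≤ s n
      0≤s n = <⇒≤ (positive⁻¹ (s n) {{1/pos⇒pos (q n)}})

      s≤1 : ∀ n → s n ≤ 1ℚ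
      s≤1 n = subst₂ _≤_ (*-identityʳ (s n)) (*-inverseˡ (q n))
        (*-monoˡ-≤-nonNeg (s n) {{nonNegative (0≤s n)}} (1≤q n))

      s-difference : ∀ m n → s m - s n ≡ (q n - q m) * (s m * s n)
      s-difference m n = sym (begin
        (q n - q m) * (s m * s n)
          ≡⟨ solve 4 (λ a b s t → (b :- a) :* (s :* t) := s :* (b :* t) :- (a :* s) :* t) refl
               (q m) (q n) (s m) (s n) ⟩
        s m * (q n * s n) - (q m * s m) * s n
          ≡⟨ cong₂ (λ u v → s m * u - v * s n) (*-inverseʳ (q n)) (*-inverseʳ (q m)) ⟩
        s m * 1ℚ - 1ℚ * s n
          ≡⟨ cong₂ (λ u v → u - v) (*-identityʳ (s m)) (*-identityˡ (s n)) ⟩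
        s m - s n ∎)
        where open ≡-Reasoning

      -- The reciprocal is 1-Lipschitz on [1, ∞), so the indices that work for 1 + x² also work for
      -- its inverse.
      s-cauchy : IsCauchy s
      s-cauchy ε 0<ε =
        let N , near = cauchy 1+x² ε 0<ε
        in N , λ m n N≤m N≤n → ≤-<-trans (bound m n) (near m n N≤m N≤n)
        where
        bound : ∀ m n → ∣ s m - s n ∣ ≤ ∣ q m - q n ∣
        bound m n = begin
          ∣ s m - s n ∣                       ≡⟨ cong ∣_∣ (s-difference m n) ⟩
          ∣ (q n - q m) * (s m * s n) ∣       ≡⟨ ∣p*q∣≡∣p∣*∣q∣ (q n - q m) (s m * s n) ⟩
          ∣ q n - q m ∣ * ∣ s m * s n ∣       ≡⟨ cong (∣ q n - q m ∣ *_) (0≤p⇒∣p∣≡p 0≤ss) ⟩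
          ∣ q n - q m ∣ * (s m * s n)
            ≤⟨ *-monoˡ-≤-nonNeg ∣ q n - q m ∣ {{∣-∣-nonNeg (q n - q m)}} ss≤1 ⟩
          ∣ q n - q m ∣ * 1ℚ                  ≡⟨ *-identityʳ _ ⟩
          ∣ q n - q m ∣                       ≡⟨ ∣p-q∣≡∣q-p∣ (q n) (q m) ⟩
          ∣ q m - q n ∣                       ∎
          where
          open ≤-Reasoning
          0≤ss : 0ℚ ≤ s m * s n
          0≤ss = subst (_≤ s m * s n) (*-zeroʳ (s m)) (*-monoˡ-≤-nonNeg (s m) {{nonNegative (0≤s m)}} (0≤s n))
          ss≤1 : s m * s n ≤ 1ℚ
          ss≤1 = ≤-trans (*-monoˡ-≤-nonNeg (s m) {{nonNegative (0≤s m)}} (s≤1 n))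
            (subst (_≤ 1ℚ) (sym (*-identityʳ (s m))) (s≤1 m))

    1/[1+x²] : ℝ
    1/[1+x²] = mkℝ s s-cauchy

    1+x²-inverse : 1+x² *ᵣ 1/[1+x²] ≈ᵣ ι 1ℚ
    1+x²-inverse = mk≈ λ ε 0<ε → 0 , λ n _ →
      subst (_< ε) (sym (trans (cong (λ t → ∣ t - 1ℚ ∣) (*-inverseʳ (q n))) refl)) 0<ε

  cotangentRoot : ∀ p → 2 ℕ.≤ p → ∃[ u ] (im ((u +i ι 1ℚ) ^ᶜ p) ≈ᵣ ι 0ℚ)
  cotangentRoot p 2≤p = root B₀ , F-root≈0 B₀ (λ u → im ((u +i ι 1ℚ) ^ᶜ p)) (λ u n → im-seq u n p)
      (λ u≈v → im-≈ (^-congˡ p (u≈v , CommutativeRing.refl ℝ-commutativeRing)))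
    where
    open Bisection (imPower p)
    open Gaussian ℝ-commutativeRing using (im-≈; _,_)
    open Algebra.Properties.Semiring.Exp (CommutativeRing.semiring ℂ-commutativeRing) using (^-congˡ)
    open Algebra.Properties.Semiring.Exp (CommutativeRing.semiring ℚ[i].commutativeRing)
      using () renaming (_^_ to _^ℚ[i]_)
    B₀ : Bracket
    B₀ = let (u , below) , (v , above) = imPower-signChange p 2≤p
      in record { lower = u ; upper = v ; lower≤0 = below ; 0≤upper = above }
    -- Real operations are termwise, so the n-th term of a complex power is the rational power of
    -- the n-th term; the two components depend on each other.
    re-seq : ∀ u n k → seq (re ((u +i ι 1ℚ) ^ᶜ k)) n ≡ ℚ[i].re ((seq u n ℚ[i].+i 1ℚ) ^ℚ[i] k)
    im-seq : ∀ u n k → seq (im ((u +i ι 1ℚ) ^ᶜ k)) n ≡ imPower k (seq u n)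
    re-seq u n zero    = refl
    re-seq u n (suc k) = cong₂ (λ s t → seq u n * s - 1ℚ * t) (re-seq u n k) (im-seq u n k)
    im-seq u n zero    = refl
    im-seq u n (suc k) = cong₂ (λ s t → seq u n * t + 1ℚ * s) (re-seq u n k) (im-seq u n k)

-- Fourier matrices of (ℤ/p)ᵉ and their spreading over the lines of a plane.

module FourierMatrices where

  open import Algebra.Bundles using (CommutativeRing)
  open import Data.Fin.Base as Fin using (Fin; toℕ; combine; quotient; remainder; _↑ˡ_; _↑ʳ_)
  import Data.Fin.Properties as Fin
  open import Data.Fin.Permutation using (permutation)
  open import Data.Nat.Base as ℕ using (ℕ; zero; suc)
  import Data.Nat.Properties as ℕ
  import Data.Nat.DivMod as ℕ
  open import Data.Nat.Coprimality using (prime⇒coprime; coprime-Bézout)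
  open import Data.Nat.GCD using (module Bézout)
  open import Data.Nat.Primality using (Prime; prime⇒nonZero)
  open import Data.Product.Base using (_,_; ∃-syntax; _×_; proj₁; proj₂)
  open import Function.Base using (_∘_)
  open import Level using (Level; _⊔_)
  open import Relation.Binary.PropositionalEquality as ≡ using (_≡_; _≢_)
  open import Relation.Nullary.Decidable using (Dec; yes; no)
  open import Relation.Nullary.Negation using (¬_; contradiction)
  import Algebra.Properties.CommutativeSemiring.Exp
  import Algebra.Properties.Semiring.Exp
  import Algebra.Properties.Semiring.Mult
  import Algebra.Properties.Semiring.Sum
  import Algebra.Properties.CommutativeMonoid.Sum
  open AffinePlanes using (Plane)
  open IntegerCoefficients

  -- x - y modulo p
  difference : ∀ {p} .{{_ : ℕ.NonZero p}} → Fin p → Fin p → ℕ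
  difference {p} x y = (toℕ x ℕ.+ (p ℕ.∸ 1) ℕ.* toℕ y) ℕ.% p

  -- Adding y to x + (p - 1) y gives x + p y, so a zero difference makes x and y congruent, and both
  -- are below p.
  difference≢0 : ∀ {p} .{{_ : ℕ.NonZero p}} {x y : Fin p} → x ≢ y → difference x y ≢ 0
  difference≢0 {p} {x} {y} x≢y d≡0 = x≢y (Fin.toℕ-injective (begin
    toℕ x                                    ≡⟨ ℕ.m<n⇒m%n≡m (Fin.toℕ<n x) ⟨
    toℕ x ℕ.% p                              ≡⟨ ℕ.[m+kn]%n≡m%n (toℕ x) (toℕ y) p ⟨
    (toℕ x ℕ.+ toℕ y ℕ.* p) ℕ.% p            ≡⟨ ≡.cong (ℕ._% p) rearrange ⟩
    (toℕ y ℕ.+ d ℕ./ p ℕ.* p) ℕ.% p          ≡⟨ ℕ.[m+kn]%n≡m%n (toℕ y) (d ℕ./ p) p ⟩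
    toℕ y ℕ.% p                              ≡⟨ ℕ.m<n⇒m%n≡m (Fin.toℕ<n y) ⟩
    toℕ y                                    ∎))
    where
    open ≡.≡-Reasoning
    d : ℕ
    d = toℕ x ℕ.+ (p ℕ.∸ 1) ℕ.* toℕ y
    rearrange : toℕ x ℕ.+ toℕ y ℕ.* p ≡ toℕ y ℕ.+ d ℕ./ p ℕ.* p
    rearrange = begin
      toℕ x ℕ.+ toℕ y ℕ.* p                              ≡⟨ ≡.cong (λ k → toℕ x ℕ.+ toℕ y ℕ.* k) (ℕ.suc-pred p) ⟨
      toℕ x ℕ.+ toℕ y ℕ.* suc (ℕ.pred p)                 ≡⟨ ≡.cong (toℕ x ℕ.+_) (ℕ.*-comm (toℕ y) _) ⟩
      toℕ x ℕ.+ (toℕ y ℕ.+ ℕ.pred p ℕ.* toℕ y)           ≡⟨ ≡.cong (toℕ x ℕ.+_) (ℕ.+-comm (toℕ y) _) ⟩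
      toℕ x ℕ.+ (ℕ.pred p ℕ.* toℕ y ℕ.+ toℕ y)           ≡⟨ ℕ.+-assoc (toℕ x) _ (toℕ y) ⟨
      d ℕ.+ toℕ y                                        ≡⟨ ℕ.+-comm d (toℕ y) ⟩
      toℕ y ℕ.+ d                                        ≡⟨ ≡.cong (toℕ y ℕ.+_) (ℕ.m≡m%n+[m/n]*n d p) ⟩
      toℕ y ℕ.+ (d ℕ.% p ℕ.+ d ℕ./ p ℕ.* p)              ≡⟨ ≡.cong (λ r → toℕ y ℕ.+ (r ℕ.+ d ℕ./ p ℕ.* p)) d≡0 ⟩
      toℕ y ℕ.+ d ℕ./ p ℕ.* p                            ∎

  module Sums {a ℓ : Level} (R : CommutativeRing a ℓ) where

    open CommutativeRing R hiding (zero)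
    open Algebra.Properties.Semiring.Sum semiring
      using (sum; sum-cong-≋; sum-replicate-zero; *-distribˡ-sum; *-distribʳ-sum)
    open import Relation.Binary.Reasoning.Setoid setoid

    sum≈0 : ∀ {n} {f : Fin n → Carrier} → (∀ i → f i ≈ 0#) → sum f ≈ 0#
    sum≈0 {n} f≈0 = trans (sum-cong-≋ f≈0) (sum-replicate-zero n)

    sum-single : ∀ {n} (f : Fin n → Carrier) k → (∀ i → i ≢ k → f i ≈ 0#) → sum f ≈ f k
    sum-single f Fin.zero    f≈0 = trans (+-congˡ (sum≈0 (λ i → f≈0 (Fin.suc i) λ ()))) (+-identityʳ _)
    sum-single f (Fin.suc k) f≈0 = trans
      (+-cong (f≈0 Fin.zero λ ()) (sum-single (f ∘ Fin.suc) k λ i i≢k → f≈0 (Fin.suc i) (i≢k ∘ Fin.suc-injective)))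
      (+-identityˡ _)

    sum-++ : ∀ m {n} (f : Fin (m ℕ.+ n) → Carrier) →
             sum f ≈ sum (λ i → f (i ↑ˡ n)) + sum (λ j → f (m ↑ʳ j))
    sum-++ zero    f = sym (+-identityˡ _)
    sum-++ (suc m) f = trans (+-congˡ (sum-++ m (f ∘ Fin.suc))) (sym (+-assoc _ _ _))

    sum-combine : ∀ m {n} (f : Fin (m ℕ.* n) → Carrier) →
                  sum f ≈ sum (λ i → sum (λ j → f (combine {m} {n} i j)))
    sum-combine zero    f = refl
    sum-combine (suc m) {n} f = trans (sum-++ n f) (+-congˡ (sum-combine m (λ k → f (n ↑ʳ k))))

    sum-remQuot : ∀ m n (f : Fin m → Fin n → Carrier) →
                  sum (λ k → f (quotient n k) (remainder {m} n k)) ≈ sum (λ i → sum (f i))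
    sum-remQuot m n f = trans (sum-combine m _) (sum-cong-≋ λ i → sum-cong-≋ λ j →
      reflexive (≡.cong (λ (k , l) → f k l) (Fin.remQuot-combine {m} i j)))

    sum-product : ∀ {m n} (f : Fin m → Carrier) (g : Fin n → Carrier) →
                  sum (λ i → sum (λ j → f i * g j)) ≈ sum f * sum g
    sum-product f g = trans (sum-cong-≋ (λ i → sym (*-distribˡ-sum (f i) g))) (sym (*-distribʳ-sum (sum g) f))

  -- The matrix identities see ℂ only as a commutative ring with a multiplicative involution, so no
  -- Cauchy sequence enters them.
  module Hermitian {a ℓ : Level} (R : CommutativeRing a ℓ)
    (conj : CommutativeRing.Carrier R → CommutativeRing.Carrier R)
    (conj-cong : ∀ {x y} → CommutativeRing._≈_ R x y → CommutativeRing._≈_ R (conj x) (conj y))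
    (conj-* : ∀ x y → CommutativeRing._≈_ R (conj (CommutativeRing._*_ R x y))
                                            (CommutativeRing._*_ R (conj x) (conj y)))
    (conj-0 : CommutativeRing._≈_ R (conj (CommutativeRing.0# R)) (CommutativeRing.0# R))
    (conj-1 : CommutativeRing._≈_ R (conj (CommutativeRing.1# R)) (CommutativeRing.1# R))
    (conj-involutive : ∀ x → CommutativeRing._≈_ R (conj (conj x)) x)
    where

    open CommutativeRing R hiding (zero)
    open Algebra.Properties.Semiring.Exp semiring
    open Algebra.Properties.CommutativeSemiring.Exp commutativeSemiring using (^-distrib-*)
    open Algebra.Properties.Semiring.Mult semiring using (×1-homo-*) renaming (_×_ to _·_)
    open Algebra.Properties.Semiring.Sum semiring
      using (sum; sum-cong-≋; sum-replicate; sum-replicate-zero; *-distribˡ-sum; *-distribʳ-sum)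
    open Algebra.Properties.CommutativeMonoid.Sum +-commutativeMonoid using (∑-comm; sum-permute)
    open Sums R
    open IntegerSolver R
    open import Relation.Binary.Reasoning.Setoid setoid

    *-interchange : ∀ w x y z → (w * x) * (y * z) ≈ (w * y) * (x * z)
    *-interchange = solve 4 (λ w x y z → (w :* x) :* (y :* z) := (w :* y) :* (x :* z)) refl

    1^ : ∀ n → 1# ^ n ≈ 1#
    1^ zero    = refl
    1^ (suc n) = trans (*-identityˡ _) (1^ n)

    conj-^ : ∀ x n → conj (x ^ n) ≈ conj x ^ n
    conj-^ x zero    = conj-1
    conj-^ x (suc n) = trans (conj-* x (x ^ n)) (*-congˡ (conj-^ x n))

    Unimodular : Carrier → Set ℓ
    Unimodular x = x * conj x ≈ 1#

    unimodular-* : ∀ {x y} → Unimodular x → Unimodular y → Unimodular (x * y)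
    unimodular-* {x} {y} ux uy = begin
      (x * y) * conj (x * y)          ≈⟨ *-congˡ (conj-* x y) ⟩
      (x * y) * (conj x * conj y)     ≈⟨ *-interchange x y (conj x) (conj y) ⟩
      (x * conj x) * (y * conj y)     ≈⟨ *-cong ux uy ⟩
      1# * 1#                         ≈⟨ *-identityˡ 1# ⟩
      1#                              ∎

    unimodular-conj : ∀ {x} → Unimodular x → Unimodular (conj x)
    unimodular-conj {x} ux = trans (*-congˡ (conj-involutive x)) (trans (*-comm (conj x) x) ux)

    unimodular-^ : ∀ {x} → Unimodular x → ∀ n → Unimodular (x ^ n)
    unimodular-^ ux zero    = trans (*-congˡ conj-1) (*-identityˡ 1#)
    unimodular-^ ux (suc n) = unimodular-* ux (unimodular-^ ux n)

    -- `symmetric` lets the orthogonality of rows serve for columns too.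
    record Fourier (n m : ℕ) : Set (a ⊔ ℓ) where
      field
        F          : Fin n → Fin n → Carrier
        unimodular : ∀ x u → Unimodular (F x u)
        rootOfUnity : ∀ x u → F x u ^ m ≈ 1#
        symmetric  : ∀ x u → F x u ≈ F u x
        orthogonal : ∀ {x y} → x ≢ y → sum (λ u → F x u * conj (F y u)) ≈ 0#

      norm : ∀ x → sum (λ u → F x u * conj (F x u)) ≈ n · 1#
      norm x = trans (sum-cong-≋ (unimodular x)) (sum-replicate n)

    trivial : ∀ m → Fourier 1 m
    trivial m = record
      { F           = λ _ _ → 1#
      ; unimodular  = λ _ _ → trans (*-congˡ conj-1) (*-identityˡ 1#)
      ; rootOfUnity = λ _ _ → 1^ m
      ; symmetric   = λ _ _ → refl
      ; orthogonal  = λ { {Fin.zero} {Fin.zero} 0≢0 → contradiction ≡.refl 0≢0 }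
      }

    -- The inner product of two rows factors over the tensor components; distinct rows differ in
    -- some component, whose factor vanishes.
    kronecker : ∀ {n k m} → Fourier n m → Fourier k m → Fourier (n ℕ.* k) m
    kronecker {n} {k} {m} A B = record
      { F           = λ r s → A.F (quotient k r) (quotient k s) * B.F (remainder {n} k r) (remainder {n} k s)
      ; unimodular  = λ r s → unimodular-* (A.unimodular _ _) (B.unimodular _ _)
      ; rootOfUnity = λ r s → trans (^-distrib-* _ _ m)
          (trans (*-cong (A.rootOfUnity _ _) (B.rootOfUnity _ _)) (*-identityˡ 1#))
      ; symmetric   = λ r s → *-cong (A.symmetric _ _) (B.symmetric _ _)
      ; orthogonal  = λ {r} {s} → orthogonal r s
      }
      where
      module A = Fourier A
      module B = Fourier B
      orthogonal : ∀ r s → r ≢ s → _ ≈ 0#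
      orthogonal r s r≢s = begin
        sum (λ t → (A.F (quotient k r) (quotient k t) * B.F (remainder {n} k r) (remainder {n} k t))
          * conj (A.F (quotient k s) (quotient k t) * B.F (remainder {n} k s) (remainder {n} k t)))
          ≈⟨ sum-cong-≋ {n ℕ.* k} (λ t → trans (*-congˡ (conj-* _ _)) (*-interchange _ _ _ _)) ⟩
        sum (λ t → α (quotient k t) * β (remainder {n} k t))
          ≈⟨ sum-remQuot n k (λ i j → α i * β j) ⟩
        sum (λ i → sum (λ j → α i * β j))
          ≈⟨ sum-product α β ⟩
        sum α * sum β
          ≈⟨ vanish (quotient k r Fin.≟ quotient k s) (remainder {n} k r Fin.≟ remainder {n} k s) ⟩
        0# ∎
        where
        α : Fin n → Carrier
        α i = A.F (quotient k r) i * conj (A.F (quotient k s) i)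
        β : Fin k → Carrier
        β j = B.F (remainder {n} k r) j * conj (B.F (remainder {n} k s) j)
        vanish : Dec (quotient k r ≡ quotient k s) → Dec (remainder {n} k r ≡ remainder {n} k s) →
                 sum α * sum β ≈ 0#
        vanish (no q≢)  _         = trans (*-congʳ (A.orthogonal q≢)) (zeroˡ _)
        vanish (yes _)  (no r≢)   = trans (*-congˡ (B.orthogonal r≢)) (zeroʳ _)
        vanish (yes q≡) (yes r≡)  = contradiction
          (≡.trans (≡.sym (Fin.combine-remQuot {n} k r))
            (≡.trans (≡.cong₂ combine q≡ r≡) (Fin.combine-remQuot {n} k s))) r≢s

    -- `ω-cancel` says that ω - 1 is no zero divisor. For prime p this takes the place of
    -- primitivity, without comparing powers of ω.
    module PrimeFourier {p : ℕ} (p-prime : Prime p) (ω : Carrier) (ω-unimodular : Unimodular ω)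
      (ω^p≈1 : ω ^ p ≈ 1#) (ω-cancel : ∀ s → ω * s ≈ s → s ≈ 0#) where

      private instance _ = prime⇒nonZero p-prime

      ω^[c*p]≈1 : ∀ c → ω ^ (c ℕ.* p) ≈ 1#
      ω^[c*p]≈1 c = trans (^-congʳ ω (ℕ.*-comm c p))
        (trans (sym (^-assocʳ ω p c)) (trans (^-congˡ c ω^p≈1) (1^ c)))

      ω^-mod : ∀ d → ω ^ d ≈ ω ^ (d ℕ.% p)
      ω^-mod d = trans (^-congʳ ω (ℕ.m≡m%n+[m/n]*n d p))
        (trans (^-homo-* ω (d ℕ.% p) _) (trans (*-congˡ (ω^[c*p]≈1 (d ℕ./ p))) (*-identityʳ _)))

      powerSum : Carrier → ℕ → Carrier
      powerSum ν n = sum {n} (λ u → ν ^ toℕ u)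

      powerSum-suc : ∀ ν n → powerSum ν (suc n) ≈ powerSum ν n + ν ^ n
      powerSum-suc ν zero = trans (+-identityʳ 1#) (sym (+-identityˡ 1#))
      powerSum-suc ν (suc n) = begin
        1# + sum {suc n} (λ u → ν * ν ^ toℕ u)      ≈⟨ +-congˡ (*-distribˡ-sum {suc n} ν (λ u → ν ^ toℕ u)) ⟨
        1# + ν * powerSum ν (suc n)                 ≈⟨ +-congˡ (*-congˡ (powerSum-suc ν n)) ⟩
        1# + ν * (powerSum ν n + ν ^ n)             ≈⟨ +-congˡ (distribˡ ν _ _) ⟩
        1# + (ν * powerSum ν n + ν ^ suc n)         ≈⟨ +-assoc _ _ _ ⟨
        (1# + ν * powerSum ν n) + ν ^ suc n         ≈⟨ +-congʳ (+-congˡ (*-distribˡ-sum {n} ν (λ u → ν ^ toℕ u))) ⟩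
        powerSum ν (suc n) + ν ^ suc n              ∎

      -- Multiplying by ν permutes the powers of ν.
      powerSum-shift : ∀ ν → ν ^ p ≈ 1# → ν * powerSum ν p ≈ powerSum ν p
      powerSum-shift ν ν^p≈1 = begin
        ν * powerSum ν p                      ≈⟨ solve 2 (λ o s → s := (o :+ s) :- o) refl 1# _ ⟩
        (1# + ν * powerSum ν p) - 1#          ≈⟨ +-congʳ (+-congˡ (*-distribˡ-sum {p} ν (λ u → ν ^ toℕ u))) ⟩
        powerSum ν (suc p) - 1#               ≈⟨ +-congʳ (powerSum-suc ν p) ⟩
        (powerSum ν p + ν ^ p) - 1#           ≈⟨ +-congʳ (+-congˡ ν^p≈1) ⟩
        (powerSum ν p + 1#) - 1#              ≈⟨ solve 2 (λ o s → (s :+ o) :- o := s) refl 1# _ ⟩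
        powerSum ν p                          ∎

      -- The sum S is fixed by ν = ωᵏ. As k is invertible modulo p, ω or its inverse is a power of
      -- ν, so ω fixes S as well, and `ω-cancel` applies.
      powerSum≈0 : ∀ {k} → .{{ℕ.NonZero k}} → k ℕ.< p → powerSum (ω ^ k) p ≈ 0#
      powerSum≈0 {k} k<p = ω-cancel S (ωS≈S (coprime-Bézout (prime⇒coprime p-prime k<p)))
        where
        ν S : Carrier
        ν = ω ^ k
        S = powerSum ν p
        ν^p≈1 : ν ^ p ≈ 1#
        ν^p≈1 = trans (^-assocʳ ω k p) (ω^[c*p]≈1 k)
        νᵃS≈S : ∀ a → ν ^ a * S ≈ S
        νᵃS≈S zero    = *-identityˡ S
        νᵃS≈S (suc a) = trans (*-assoc ν (ν ^ a) S) (trans (*-congˡ (νᵃS≈S a)) (powerSum-shift ν ν^p≈1))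
        ν^≈ : ∀ b → ω ^ (b ℕ.* k) ≈ ν ^ b
        ν^≈ b = trans (^-congʳ ω (ℕ.*-comm b k)) (sym (^-assocʳ ω k b))
        ωS≈S : Bézout.Identity 1 p k → ω * S ≈ S
        ωS≈S (Bézout.-+ c b eq) = begin
          ω * S                           ≈⟨ *-congʳ (*-identityʳ ω) ⟨
          (ω * 1#) * S                    ≈⟨ *-congʳ (*-congˡ (ω^[c*p]≈1 c)) ⟨
          ω ^ (1 ℕ.+ c ℕ.* p) * S         ≈⟨ *-congʳ (trans (^-congʳ ω eq) (ν^≈ b)) ⟩
          ν ^ b * S                       ≈⟨ νᵃS≈S b ⟩
          S                               ∎
        -- Now 1 + bk = cp, so ω is the inverse of νᵇ, which fixes S.
        ωS≈S (Bézout.+- c b eq) = begin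
          ω * S                           ≈⟨ *-congˡ (νᵃS≈S b) ⟨
          ω * (ν ^ b * S)                 ≈⟨ *-assoc ω (ν ^ b) S ⟨
          (ω * ν ^ b) * S                 ≈⟨ *-congʳ (*-congˡ (ν^≈ b)) ⟨
          ω ^ (1 ℕ.+ b ℕ.* k) * S         ≈⟨ *-congʳ (trans (^-congʳ ω eq) (ω^[c*p]≈1 c)) ⟩
          1# * S                          ≈⟨ *-identityˡ S ⟩
          S                               ∎

      conj-ω : conj ω ≈ ω ^ (p ℕ.∸ 1)
      conj-ω = begin
        conj ω                            ≈⟨ *-identityʳ _ ⟨
        conj ω * 1#                       ≈⟨ *-congˡ ω^p≈1 ⟨
        conj ω * ω ^ p                    ≈⟨ *-congˡ (^-congʳ ω (ℕ.suc-pred p)) ⟨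
        conj ω * (ω * ω ^ (p ℕ.∸ 1))      ≈⟨ *-assoc _ _ _ ⟨
        (conj ω * ω) * ω ^ (p ℕ.∸ 1)      ≈⟨ *-congʳ (trans (*-comm _ _) ω-unimodular) ⟩
        1# * ω ^ (p ℕ.∸ 1)                ≈⟨ *-identityˡ _ ⟩
        ω ^ (p ℕ.∸ 1)                     ∎

      quotient-power : ∀ (x y : Fin p) u →
        ω ^ (toℕ x ℕ.* u) * conj (ω ^ (toℕ y ℕ.* u)) ≈ (ω ^ difference x y) ^ u
      quotient-power x y u = begin
        ω ^ (toℕ x ℕ.* u) * conj (ω ^ (toℕ y ℕ.* u))
          ≈⟨ *-cong (sym (^-assocʳ ω (toℕ x) u)) (trans (conj-cong (sym (^-assocʳ ω (toℕ y) u)))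
               (trans (conj-^ _ u) (^-congˡ u (trans (conj-^ ω (toℕ y))
                 (trans (^-congˡ (toℕ y) conj-ω) (^-assocʳ ω (p ℕ.∸ 1) (toℕ y))))))) ⟩
        (ω ^ toℕ x) ^ u * (ω ^ ((p ℕ.∸ 1) ℕ.* toℕ y)) ^ u
          ≈⟨ ^-distrib-* _ _ u ⟨
        (ω ^ toℕ x * ω ^ ((p ℕ.∸ 1) ℕ.* toℕ y)) ^ u
          ≈⟨ ^-congˡ u (^-homo-* ω (toℕ x) _) ⟨
        (ω ^ (toℕ x ℕ.+ (p ℕ.∸ 1) ℕ.* toℕ y)) ^ u
          ≈⟨ ^-congˡ u (ω^-mod (toℕ x ℕ.+ (p ℕ.∸ 1) ℕ.* toℕ y)) ⟩
        (ω ^ difference x y) ^ u ∎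

      primeFourier : Fourier p p
      primeFourier = record
        { F           = λ x u → ω ^ (toℕ x ℕ.* toℕ u)
        ; unimodular  = λ x u → unimodular-^ ω-unimodular (toℕ x ℕ.* toℕ u)
        ; rootOfUnity = λ x u → trans (^-assocʳ ω (toℕ x ℕ.* toℕ u) p) (ω^[c*p]≈1 (toℕ x ℕ.* toℕ u))
        ; symmetric   = λ x u → ^-congʳ ω (ℕ.*-comm (toℕ x) (toℕ u))
        ; orthogonal  = λ {x} {y} x≢y → trans (sum-cong-≋ {p} (λ u → quotient-power x y (toℕ u)))
            (powerSum≈0 {{ℕ.≢-nonZero (difference≢0 x≢y)}} (ℕ.m%n<n (toℕ x ℕ.+ (p ℕ.∸ 1) ℕ.* toℕ y) p))
        }

      powerFourier : ∀ e → Fourier (p ℕ.^ e) p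
      powerFourier zero    = trivial p
      powerFourier (suc e) = kronecker primeFourier (powerFourier e)

    module Assembly {q m : ℕ} (plane : Plane q) (fourier : Fourier q m) where

      open Plane plane
      open Fourier fourier

      -- Row (x , a) of the i-th matrix is row x of F spread over the line
      -- with slope i and intercept a.
      entry : Fin q → Fin q → Fin q → Fin q → Fin q → Carrier
      entry i x a u v with line i u a Fin.≟ v
      ... | yes _ = F x u
      ... | no  _ = 0#

      entry-on : ∀ i x a u {v} → line i u a ≡ v → entry i x a u v ≈ F x u
      entry-on i x a u {v} on with line i u a Fin.≟ v
      ... | yes _   = refl
      ... | no  off = contradiction on off

      entry-off : ∀ i x a u {v} → line i u a ≢ v → entry i x a u v ≈ 0#
      entry-off i x a u {v} off with line i u a Fin.≟ v
      ... | yes on = contradiction on off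
      ... | no  _  = refl

      inner : ∀ i j x a y b → sum (λ u → sum (λ v → entry i x a u v * conj (entry j y b u v)))
              ≈ sum (λ u → F x u * conj (entry j y b u (line i u a)))
      inner i j x a y b = sum-cong-≋ λ u → trans
        (sum-single _ (line i u a) (λ v v≢ → trans (*-congʳ (entry-off i x a u (v≢ ∘ ≡.sym))) (zeroˡ _)))
        (*-congʳ (entry-on i x a u ≡.refl))

      product : Fin q → Fin q → Fin q → Fin q → Fin q → Fin q → Carrier
      product i j x a y b = sum (λ u → sum (λ v → entry i x a u v * conj (entry j y b u v)))

      product-norm : ∀ i x a → product i i x a x a ≈ q · 1#
      product-norm i x a = trans (inner i i x a x a)
        (trans (sum-cong-≋ (λ u → *-congˡ (conj-cong (entry-on i x a u ≡.refl)))) (norm x))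

      -- Rows over the same line are orthogonal as rows of F; rows over distinct parallel lines have
      -- disjoint supports.
      product-parallel : ∀ i {x a y b} → ¬ (x ≡ y × a ≡ b) → product i i x a y b ≈ 0#
      product-parallel i {x} {a} {y} {b} distinct = trans (inner i i x a y b) (vanish (a Fin.≟ b))
        where
        vanish : Dec (a ≡ b) → sum (λ u → F x u * conj (entry i y b u (line i u a))) ≈ 0#
        vanish (yes ≡.refl) = trans
          (sum-cong-≋ (λ u → *-congˡ (conj-cong (entry-on i y a u ≡.refl))))
          (orthogonal (λ x≡y → distinct (x≡y , ≡.refl)))
        vanish (no a≢b) = sum≈0 λ u → trans
          (*-congˡ (trans (conj-cong (entry-off i y b u (λ eq → a≢b (line-injective i u (≡.sym eq))))) conj-0))
          (zeroʳ _)

      module _ {i j : Fin q} (i≢j : i ≢ j) where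

        meeting : Fin q → Fin q → Fin q
        meeting a b = proj₁ (meet i≢j a b)

        meets : ∀ a b → line i (meeting a b) a ≡ line j (meeting a b) b
        meets a b = proj₂ (meet i≢j a b)

        cross : Fin q → Fin q → Fin q → Carrier
        cross x y u = F x u * conj (F y u)

        product-cross : ∀ x a y b → product i j x a y b ≈ cross x y (meeting a b)
        product-cross x a y b = trans (inner i j x a y b) (trans
          (sum-single _ (meeting a b) λ u u≢ → trans
            (*-congˡ (trans (conj-cong (entry-off j y b u
              (λ eq → u≢ (meet-unique i≢j (≡.sym eq) (meets a b))))) conj-0))
            (zeroʳ _))
          (*-congˡ (conj-cong (entry-on j y b (meeting a b) (≡.sym (meets a b))))))

        cross-unimodular : ∀ x y u → Unimodular (cross x y u)
        cross-unimodular x y u = unimodular-* (unimodular x u) (unimodular-conj (unimodular y u))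

        cross-rootOfUnity : ∀ x y u → cross x y u ^ m ≈ 1#
        cross-rootOfUnity x y u = trans (^-distrib-* _ _ m) (trans
          (*-cong (rootOfUnity x u) (trans (sym (conj-^ _ m)) (trans (conj-cong (rootOfUnity y u)) conj-1)))
          (*-identityˡ 1#))

        -- Through each point of the line with slope i and intercept a passes exactly one line of
        -- slope j, so b ↦ `meeting a b` is a permutation.
        sum-meetingʳ : ∀ a (f : Fin q → Carrier) → sum (λ b → f (meeting a b)) ≈ sum f
        sum-meetingʳ a f = sym (sum-permute f (permutation (meeting a) through
          (λ u → meet-unique i≢j (meets a (through u)) (≡.sym (on u)))
          (λ b → line-injective j (meeting a b) (≡.trans (on (meeting a b)) (meets a b)))))
          where
          through : Fin q → Fin q
          through u = proj₁ (lineThrough j u (line i u a))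
          on : ∀ u → line j u (through u) ≡ line i u a
          on u = proj₂ (lineThrough j u (line i u a))

        sum-meetingˡ : ∀ b (f : Fin q → Carrier) → sum (λ a → f (meeting a b)) ≈ sum f
        sum-meetingˡ b f = sym (sum-permute f (permutation (λ a → meeting a b) through
          (λ u → meet-unique i≢j (meets (through u) b) (on u))
          (λ a → line-injective i (meeting a b) (≡.trans (on (meeting a b)) (≡.sym (meets a b))))))
          where
          through : Fin q → Fin q
          through u = proj₁ (lineThrough i u (line j u b))
          on : ∀ u → line i u (through u) ≡ line j u b
          on u = proj₂ (lineThrough i u (line j u b))

        -- Summing over y first and using the symmetry of F, the inner sum becomes the inner product
        -- of the rows of F indexed by the two meeting points: a norm if a = b, and zero otherwise.
        crossSum : ∀ x a x′ b →
          sum (λ y → sum (λ c → cross x y (meeting a c) * conj (cross x′ y (meeting b c))))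
          ≈ sum (λ c → (F x (meeting a c) * conj (F x′ (meeting b c)))
                       * sum (λ y → F (meeting b c) y * conj (F (meeting a c) y)))
        crossSum x a x′ b = trans (∑-comm {q} {q} _) (sum-cong-≋ {q} λ c → trans
          (sum-cong-≋ {q} λ y → begin
            (F x (meeting a c) * conj (F y (meeting a c))) * conj (F x′ (meeting b c) * conj (F y (meeting b c)))
              ≈⟨ *-congˡ (trans (conj-* _ _) (*-congˡ (conj-involutive _))) ⟩
            (F x (meeting a c) * conj (F y (meeting a c))) * (conj (F x′ (meeting b c)) * F y (meeting b c))
              ≈⟨ solve 4 (λ r s t u → (r :* s) :* (t :* u) := (r :* t) :* (u :* s)) refl _ _ _ _ ⟩
            (F x (meeting a c) * conj (F x′ (meeting b c))) * (F y (meeting b c) * conj (F y (meeting a c)))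
              ≈⟨ *-congˡ (*-cong (symmetric y _) (conj-cong (symmetric y _))) ⟩
            (F x (meeting a c) * conj (F x′ (meeting b c))) * (F (meeting b c) y * conj (F (meeting a c) y)) ∎)
          (sym (*-distribˡ-sum {q} _ _)))

        hadamard : ∀ x a x′ →
          sum (λ y → sum (λ c → cross x y (meeting a c) * conj (cross x′ y (meeting a c))))
          ≈ sum (λ u → cross x x′ u) * (q · 1#)
        hadamard x a x′ = begin
          sum (λ y → sum (λ c → cross x y (meeting a c) * conj (cross x′ y (meeting a c))))
            ≈⟨ crossSum x a x′ a ⟩
          sum (λ c → cross x x′ (meeting a c) * sum (λ y → F (meeting a c) y * conj (F (meeting a c) y)))
            ≈⟨ sum-cong-≋ (λ c → *-congˡ (norm (meeting a c))) ⟩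
          sum (λ c → cross x x′ (meeting a c) * (q · 1#))
            ≈⟨ *-distribʳ-sum (q · 1#) (λ c → cross x x′ (meeting a c)) ⟨
          sum (λ c → cross x x′ (meeting a c)) * (q · 1#)
            ≈⟨ *-congʳ (sum-meetingʳ a (cross x x′)) ⟩
          sum (λ u → cross x x′ u) * (q · 1#) ∎

        hadamard-norm : ∀ x a →
          sum (λ y → sum (λ c → cross x y (meeting a c) * conj (cross x y (meeting a c)))) ≈ (q ℕ.* q) · 1#
        hadamard-norm x a = trans (hadamard x a x) (trans (*-congʳ (norm x)) (sym (×1-homo-* q q)))

        hadamard-orthogonal : ∀ {x a x′ b} → ¬ (x ≡ x′ × a ≡ b) →
          sum (λ y → sum (λ c → cross x y (meeting a c) * conj (cross x′ y (meeting b c)))) ≈ 0#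
        hadamard-orthogonal {x} {a} {x′} {b} distinct = vanish (a Fin.≟ b)
          where
          vanish : Dec (a ≡ b) →
            sum (λ y → sum (λ c → cross x y (meeting a c) * conj (cross x′ y (meeting b c)))) ≈ 0#
          vanish (yes ≡.refl) = trans (hadamard x a x′)
            (trans (*-congʳ (orthogonal (λ x≡x′ → distinct (x≡x′ , ≡.refl)))) (zeroˡ _))
          -- The parallel lines with intercepts a and b cut the line with slope j and intercept c at
          -- different abscissas; a common one would force a = b.
          vanish (no a≢b) = trans (crossSum x a x′ b) (sum≈0 λ c → trans
            (*-congˡ (orthogonal λ eq → a≢b (line-injective i (meeting a c)
              (≡.trans (meets a c) (≡.trans (≡.cong (λ u → line j u c) (≡.sym eq))
                (≡.trans (≡.sym (meets b c)) (≡.cong (λ u → line i u b) eq)))))))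
            (zeroʳ _))

-- Conjugation in R[i] and the root of unity ω = g / ḡ.

module Conjugations where

  open import Defs using (module Gaussian)
  open import Algebra.Bundles using (CommutativeRing)
  open import Data.Nat.Base using (zero; suc)
  open import Level using (Level)
  import Algebra.Properties.CommutativeSemiring.Exp
  import Algebra.Properties.Group
  import Algebra.Properties.Ring
  import Algebra.Properties.Semiring.Exp
  open IntegerCoefficients

  module Conjugation {a ℓ : Level} (A : CommutativeRing a ℓ) where

    open CommutativeRing A
    open Gaussian A
    open Algebra.Properties.Ring ring using (-0#≈0#)
    open Algebra.Properties.Group +-group using (⁻¹-involutive)
    open IntegerSolver A

    conj-cong : ∀ {z w} → z ≈ᶜ w → conj z ≈ᶜ conj w
    conj-cong z≈w = re-≈ z≈w , -‿cong (im-≈ z≈w)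

    conj-* : ∀ z w → conj (z *ᶜ w) ≈ᶜ conj z *ᶜ conj w
    conj-* z w =
        solve 4 (λ a b c d → a :* c :- b :* d := a :* c :- (:- b) :* (:- d)) refl (re z) (im z) (re w) (im w)
      , solve 4 (λ a b c d → :- (a :* d :+ b :* c) := a :* (:- d) :+ (:- b) :* c) refl (re z) (im z) (re w) (im w)

    conj-fromReal : ∀ x → conj (fromReal x) ≈ᶜ fromReal x
    conj-fromReal x = refl , -0#≈0#

    conj-involutive : ∀ z → conj (conj z) ≈ᶜ z
    conj-involutive z = refl , ⁻¹-involutive (im z)

    *-conj : ∀ z → z *ᶜ conj z ≈ᶜ fromReal ∣ z ∣²
    *-conj z =
        solve 2 (λ a b → a :* a :- b :* (:- b) := a :* a :+ b :* b) refl (re z) (im z)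
      , trans (solve 2 (λ a b → a :* (:- b) :+ b :* a := a :- a) refl (re z) (im z)) (-‿inverseʳ _)

    im≈0⇒real : ∀ {z} → im z ≈ 0# → z ≈ᶜ conj z
    im≈0⇒real im≈0 = refl , trans im≈0 (trans (sym -0#≈0#) (-‿cong (sym im≈0)))

    fromReal-* : ∀ x y → fromReal x *ᶜ fromReal y ≈ᶜ fromReal (x * y)
    fromReal-* x y =
        trans (+-congˡ (trans (-‿cong (zeroˡ 0#)) -0#≈0#)) (+-identityʳ _)
      , trans (+-cong (zeroʳ x) (zeroˡ y)) (+-identityʳ 0#)

  -- ω = g² / (g ḡ) satisfies ωⁿ = 1 as soon as gⁿ is real, and ω - 1 is
  -- invertible when g - ḡ is.
  module RootFromGaussian {a ℓ : Level} (R : CommutativeRing a ℓ) where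

    open CommutativeRing R hiding (zero)
    open Algebra.Properties.Semiring.Exp semiring
    open Algebra.Properties.CommutativeSemiring.Exp commutativeSemiring using (^-distrib-*)
    open IntegerSolver R
    open import Relation.Binary.Reasoning.Setoid setoid

    1^ : ∀ n → 1# ^ n ≈ 1#
    1^ zero    = refl
    1^ (suc n) = trans (*-identityˡ _) (1^ n)

    module _ (g ḡ r : Carrier) (gḡr≈1 : (g * ḡ) * r ≈ 1#) where

      ω : Carrier
      ω = (g * g) * r

      ω^n≈1 : ∀ n → g ^ n ≈ ḡ ^ n → ω ^ n ≈ 1#
      ω^n≈1 n g^n≈ḡ^n = begin
        ((g * g) * r) ^ n           ≈⟨ ^-distrib-* (g * g) r n ⟩
        (g * g) ^ n * r ^ n         ≈⟨ *-congʳ (^-distrib-* g g n) ⟩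
        (g ^ n * g ^ n) * r ^ n     ≈⟨ *-congʳ (*-congˡ g^n≈ḡ^n) ⟩
        (g ^ n * ḡ ^ n) * r ^ n     ≈⟨ *-congʳ (^-distrib-* g ḡ n) ⟨
        (g * ḡ) ^ n * r ^ n         ≈⟨ ^-distrib-* (g * ḡ) r n ⟨
        ((g * ḡ) * r) ^ n           ≈⟨ ^-congˡ n gḡr≈1 ⟩
        1# ^ n                      ≈⟨ 1^ n ⟩
        1#                          ∎

      ω-inverse : ω * ((ḡ * ḡ) * r) ≈ 1#
      ω-inverse = trans
        (solve 3 (λ g h r → (g :* g :* r) :* (h :* h :* r) := (g :* h :* r) :* (g :* h :* r)) refl g ḡ r)
        (trans (*-cong gḡr≈1 gḡr≈1) (*-identityˡ 1#))

      -- As gḡr = 1, ω - 1 = g r (g - ḡ) is a product of units with inverse ḡ h.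
      ω-cancel : ∀ h → (g - ḡ) * h ≈ 1# → ∀ s → ω * s ≈ s → s ≈ 0#
      ω-cancel h inverse s ωs≈s = begin
        s                                                       ≈⟨ *-identityˡ s ⟨
        1# * s                                                  ≈⟨ *-congʳ (*-identityˡ 1#) ⟨
        (1# * 1#) * s                                           ≈⟨ *-congʳ (*-cong gḡr≈1 inverse) ⟨
        (((g * ḡ) * r) * ((g - ḡ) * h)) * s
          ≈⟨ solve 5 (λ g k r h s → ((g :* k :* r) :* ((g :- k) :* h)) :* s :=
               (k :* h) :* (((g :* g) :* r) :* s :- ((g :* k) :* r) :* s)) refl g ḡ r h s ⟩
        (ḡ * h) * (ω * s - ((g * ḡ) * r) * s)
          ≈⟨ *-congˡ (+-cong ωs≈s (-‿cong (trans (*-congʳ gḡr≈1) (*-identityˡ s)))) ⟩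
        (ḡ * h) * (s - s)                                       ≈⟨ *-congˡ (-‿inverseʳ s) ⟩
        (ḡ * h) * 0#                                            ≈⟨ zeroʳ _ ⟩
        0#                                                      ∎

-- The primitive root of unity in ℂ, the matrices, and the theorem.

open import Defs
open import Algebra.Bundles using (CommutativeRing)
open import Data.Fin.Base as Fin using (Fin; combine; quotient; remainder)
import Data.Fin.Properties as Fin
open import Data.Nat.Base as ℕ using (ℕ; zero; suc)
import Data.Nat.Properties as ℕ
open import Data.Nat.Primality using (Prime; prime⇒nonZero; prime⇒nonTrivial)
open import Data.Product.Base using (_,_; ∃-syntax; Σ-syntax; _×_; proj₁; proj₂)
open import Data.Rational.Base as ℚ using (ℚ; 0ℚ; 1ℚ)
import Data.Rational.Properties as ℚ
open import Data.Sum.Base using (_⊎_; inj₁; inj₂)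
open import Function.Base using (case_of_)
open import Level using (Level)
open import Relation.Binary.PropositionalEquality as ≡ using (_≡_; _≢_)
open import Relation.Nullary.Decidable using (Dec; yes; no)
open import Relation.Nullary.Negation using (¬_)
import Algebra.Properties.Semiring.Exp
import Algebra.Properties.Semiring.Mult
import Algebra.Properties.Semiring.Sum
open IntegerCoefficients
open AffinePlanes using (Plane)
open GaloisPlanes
open FourierMatrices
open Conjugations
open RealRoots using (cotangentRoot; 1/[1+x²]; 1+x²-inverse; suc-/1)

private
  module ℝᴿ = CommutativeRing ℝ-commutativeRing
  module ℂᴿ = CommutativeRing ℂ-commutativeRing
  module ℝ[i] = Gaussian ℝ-commutativeRing

open Conjugation ℝ-commutativeRing
open Hermitian ℂ-commutativeRing conj conj-cong conj-* (conj-fromReal (ι 0ℚ)) (conj-fromReal (ι 1ℚ)) conj-involutive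

pointwise : ∀ {x y} → (∀ n → seq x n ≡ seq y n) → x ≈ᵣ y
pointwise {x} {y} eq = mk≈ λ ε 0<ε → 0 , λ n _ → ≡.subst (ℚ._< ε)
  (≡.sym (≡.trans (≡.cong (λ t → ℚ.∣ t ℚ.- seq y n ∣) (eq n)) (≡.cong ℚ.∣_∣ (ℚ.+-inverseʳ (seq y n))))) 0<ε

module PrimitiveRoot {p : ℕ} (2≤p : 2 ℕ.≤ p) where

  private
    u : ℝ
    u = proj₁ (cotangentRoot p 2≤p)
    g r h : ℂ
    g = u +i ι 1ℚ
    r = fromReal (1/[1+x²] u)
    -- 1 / 2i
    h = ι 0ℚ +i ι (ℚ.- ℚ.½)

    gḡr≈1 : (g *ᶜ conj g) *ᶜ r ≈ᶜ 1ᶜ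
    gḡr≈1 = ℂᴿ.trans (ℂᴿ.*-congʳ {r} (*-conj g))
      (ℂᴿ.trans (fromReal-* ∣ g ∣² (1/[1+x²] u))
        (ℝᴿ.trans (ℝᴿ.*-congʳ {1/[1+x²] u} (ℝᴿ.+-congˡ {u ℝᴿ.* u} (ℝᴿ.*-identityˡ (ι 1ℚ)))) (1+x²-inverse u)
        ℝ[i]., ℝᴿ.refl))

    inverse : (g +ᶜ -ᶜ conj g) *ᶜ h ≈ᶜ 1ᶜ
    inverse = ℝᴿ.trans (ℝᴿ.+-cong (ℝᴿ.zeroʳ (u ℝᴿ.+ (ℝᴿ.- u))) (pointwise {y = ι 1ℚ} λ _ → ≡.refl))
                       (ℝᴿ.+-identityˡ (ι 1ℚ))
      ℝ[i]., ℝᴿ.trans (ℝᴿ.+-cong (ℝᴿ.trans (ℝᴿ.*-congʳ {im h} (ℝᴿ.-‿inverseʳ u)) (ℝᴿ.zeroˡ (im h)))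
                               (ℝᴿ.zeroʳ (im (g +ᶜ -ᶜ conj g)))) (ℝᴿ.+-identityʳ (ι 0ℚ))

  open RootFromGaussian ℂ-commutativeRing hiding (1^; ω)

  ω : ℂ
  ω = (g *ᶜ g) *ᶜ r

  ω-unimodular : Unimodular ω
  ω-unimodular = ℂᴿ.trans (ℂᴿ.*-congˡ {ω} (ℂᴿ.trans (conj-* (g *ᶜ g) r)
      (ℂᴿ.*-cong (conj-* g g) (conj-fromReal (1/[1+x²] u)))))
    (ω-inverse g (conj g) r gḡr≈1)

  ω^p≈1 : ω ^ᶜ p ≈ᶜ 1ᶜ
  ω^p≈1 = ω^n≈1 g (conj g) r gḡr≈1 p
    (ℂᴿ.trans (im≈0⇒real (proj₂ (cotangentRoot p 2≤p))) (conj-^ g p))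

  cancel : ∀ s → ω *ᶜ s ≈ᶜ s → s ≈ᶜ 0ᶜ
  cancel = ω-cancel g (conj g) r gḡr≈1 h inverse

open Algebra.Properties.Semiring.Exp ℂᴿ.semiring using (^-congˡ; ^-assocʳ; ^-congʳ)
open Algebra.Properties.Semiring.Mult ℂᴿ.semiring using () renaming (_×_ to _·1_)
open Algebra.Properties.Semiring.Sum ℂᴿ.semiring using (sum-cong-≋)
open Sums ℂ-commutativeRing using (sum-remQuot)

·1≈fromℕ : ∀ n → n ·1 1ᶜ ≈ᶜ fromℕ n
·1≈fromℕ zero    = ℂᴿ.refl
·1≈fromℕ (suc n) = ℂᴿ.trans (ℂᴿ.+-congˡ {1ᶜ} (·1≈fromℕ n))
  (pointwise (λ _ → suc-/1 n) ℝ[i]., pointwise (λ _ → ≡.refl))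

unimodular⇒𝕋 : ∀ {z w} → z ≈ᶜ w → Unimodular w → 𝕋 z
unimodular⇒𝕋 {z} {w} z≈w ww̄≈1 = ℝ[i].re-≈ (ℂᴿ.trans (ℂᴿ.sym (*-conj z))
  (ℂᴿ.trans (ℂᴿ.*-cong z≈w (conj-cong z≈w)) ww̄≈1))

scalar : ∀ {n} k (M : Matrix n) → (∀ r → M r r ≈ᶜ k ·1 1ᶜ) → (∀ {r s} → r ≢ s → M r s ≈ᶜ 0ᶜ) →
         M ≋ fromℕ k • I n
scalar k M diagonal offDiagonal r s with r Fin.≟ s
... | yes ≡.refl = ℂᴿ.trans (diagonal r) (ℂᴿ.trans (·1≈fromℕ k) (ℂᴿ.sym (ℂᴿ.*-identityʳ (fromℕ k))))
... | no  r≢s    = ℂᴿ.trans (offDiagonal r≢s) (ℂᴿ.sym (ℂᴿ.zeroʳ (fromℕ k)))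

·⁎-cong : ∀ {n} {A B : Matrix n} → A ≋ B → A · A ⁎ ≋ B · B ⁎
·⁎-cong {n} A≋B i j = sum-cong-≋ {n} λ k → ℂᴿ.*-cong (A≋B i k) (conj-cong (A≋B j k))

IsUnitWeighing-resp-≋ : ∀ {n k A B} → A ≋ B → IsUnitWeighing n k A → IsUnitWeighing n k B
IsUnitWeighing-resp-≋ {n} {k} {A} {B} A≋B W = record
  { entries = λ i j → case entries i j of λ where
      (inj₁ A≈0) → inj₁ (ℂᴿ.trans (ℂᴿ.sym (A≋B i j)) A≈0)
      (inj₂ A∈𝕋) → inj₂ (ℝᴿ.trans (ℝ[i].re-≈ (∣∣²-cong (ℂᴿ.sym (A≋B i j)))) A∈𝕋)
  ; weight  = λ i j → ℂᴿ.trans (ℂᴿ.sym (·⁎-cong A≋B i j)) (weight i j)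
  }
  where
  open IsUnitWeighing W
  ∣∣²-cong : ∀ {z w} → z ≈ᶜ w → fromReal ∣ z ∣² ≈ᶜ fromReal ∣ w ∣²
  ∣∣²-cong {z} {w} z≈w = ℂᴿ.trans (ℂᴿ.sym (*-conj z)) (ℂᴿ.trans (ℂᴿ.*-cong z≈w (conj-cong z≈w)) (*-conj w))

module Matrices {q m : ℕ} (plane : Plane q) (fourier : Fourier q m) where

  open Plane plane
  open Fourier fourier
  open Assembly plane fourier

  private
    row column : Fin (q ℕ.* q) → Fin q
    row    = quotient q
    column = remainder {q} q

    distinct : ∀ {r s} → r ≢ s → ¬ (row r ≡ row s × column r ≡ column s)
    distinct {r} {s} r≢s (row≡ , column≡) = r≢s (≡.trans (≡.sym (Fin.combine-remQuot {q} q r))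
      (≡.trans (≡.cong₂ combine row≡ column≡) (Fin.combine-remQuot {q} q s)))

  -- The quotient of the row index is the row of F and the remainder is the intercept. Hence a block
  -- of a product fixes a pair of rows of F, and diagonal blocks compare a row with itself.
  W : Fin q → Matrix (q ℕ.* q)
  W i r s = entry i (row r) (column r) (row s) (column s)

  W-product : ∀ i j r s → (W i · W j ⁎) r s ≈ᶜ product i j (row r) (column r) (row s) (column s)
  W-product i j r s = sum-remQuot q q
    (λ u v → entry i (row r) (column r) u v *ᶜ conj (entry j (row s) (column s) u v))

  W-isUnitWeighing : ∀ i → IsUnitWeighing (q ℕ.* q) q (W i)
  W-isUnitWeighing i = record
    { entries = λ r s → entries (row r) (column r) (row s) (column s) (line i (row s) (column r) Fin.≟ column s)
    ; weight  = scalar q (W i · W i ⁎)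
        (λ r → ℂᴿ.trans (W-product i i r r) (product-norm i (row r) (column r)))
        (λ {r} {s} r≢s → ℂᴿ.trans (W-product i i r s) (product-parallel i (distinct r≢s)))
    }
    where
    entries : ∀ x a u v → Dec (line i u a ≡ v) → (entry i x a u v ≈ᶜ 0ᶜ) ⊎ 𝕋 (entry i x a u v)
    entries x a u v (yes on) = inj₂ (unimodular⇒𝕋 (entry-on i x a u on) (unimodular x u))
    entries x a u v (no off) = inj₁ (entry-off i x a u off)

  module _ {i j : Fin q} (i≢j : i ≢ j) where

    private
      H : Matrix (q ℕ.* q)
      H = W i · W j ⁎

      C : Fin q → Fin q → Fin q → Fin q → ℂ
      C x a y b = cross i≢j x y (meeting i≢j a b)

    H≈cross : ∀ r s → H r s ≈ᶜ C (row r) (column r) (row s) (column s)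
    H≈cross r s = ℂᴿ.trans (W-product i j r s) (product-cross i≢j (row r) (column r) (row s) (column s))

    block≈cross : ∀ x a y b → block H x y a b ≈ᶜ C x a y b
    block≈cross x a y b = ℂᴿ.trans (H≈cross (combine x a) (combine y b)) (ℂᴿ.reflexive
      (≡.cong₂ (λ (k , l) (k′ , l′) → C k l k′ l′) (Fin.remQuot-combine x a) (Fin.remQuot-combine y b)))

    H-product : ∀ r s → (H · H ⁎) r s ≈ᶜ
      Σᶜ (λ y → Σᶜ (λ c → C (row r) (column r) y c *ᶜ conj (C (row s) (column s) y c)))
    H-product r s = ℂᴿ.trans
      (sum-cong-≋ {q ℕ.* q} λ t → ℂᴿ.*-cong (H≈cross r t) (conj-cong (H≈cross s t)))
      (sum-remQuot q q λ y c → C (row r) (column r) y c *ᶜ conj (C (row s) (column s) y c))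

    H-isComplexHadamard : IsComplexHadamard (q ℕ.* q) H
    H-isComplexHadamard = record
      { entries = λ r s → inj₂ (unimodular⇒𝕋 (H≈cross r s)
          (cross-unimodular i≢j (row r) (row s) (meeting i≢j (column r) (column s))))
      ; weight  = scalar (q ℕ.* q) (H · H ⁎)
          (λ r → ℂᴿ.trans (H-product r r) (hadamard-norm i≢j (row r) (column r)))
          (λ {r} {s} r≢s → ℂᴿ.trans (H-product r s) (hadamard-orthogonal i≢j (distinct r≢s)))
      }

    isQuasiUnbiased : IsQuasiUnbiased (q ℕ.* q) q (q ℕ.* q) (ι 1ℚ) (W i) (W j)
    isQuasiUnbiased = record
      { unitWeighing₁ = W-isUnitWeighing i
      ; unitWeighing₂ = W-isUnitWeighing j
      ; r             = ι 1ℚ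
      ; r-positive    = 1ℚ , ℚ.positive⁻¹ 1ℚ , 0 , λ _ _ → ℚ.≤-refl
      ; r²a≈1         = pointwise λ _ → ≡.refl
      -- With a = 1 the normalising factor is 1, and the scaled product is H up to `_≋_`.
      ; product       = IsUnitWeighing-resp-≋ (λ r s → ℂᴿ.sym (ℂᴿ.*-identityˡ (H r s))) H-isComplexHadamard
      }

    isBushType : IsBushType q H
    isBushType = record
      { complexHadamard = H-isComplexHadamard
      ; diagonal        = λ x a b → ℂᴿ.trans (block≈cross x a x b) (unimodular x (meeting i≢j a b))
      ; offDiagonalʳ    = λ x y x≢y a b → ℂᴿ.trans
          (sum-cong-≋ {q} λ c → ℂᴿ.trans (ℂᴿ.*-identityʳ (block H x y a c)) (block≈cross x a y c))
          (ℂᴿ.trans (sum-meetingʳ i≢j a (cross i≢j x y)) (orthogonal x≢y))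
      ; offDiagonalˡ    = λ x y x≢y a b → ℂᴿ.trans
          (sum-cong-≋ {q} λ c → ℂᴿ.trans (ℂᴿ.*-identityˡ (block H x y c b)) (block≈cross x c y b))
          (ℂᴿ.trans (sum-meetingˡ i≢j b (cross i≢j x y)) (orthogonal x≢y))
      }

    -- The entries are already m-th roots of unity, and m divides q; it is applied with m = p.
    isButson : ∀ k → q ≡ m ℕ.* k → IsButson (q ℕ.* q) q H
    isButson k q≡m*k = record
      { complexHadamard = H-isComplexHadamard
      ; entries         = λ r s → ℂᴿ.trans (^-congˡ q (H≈cross r s)) (power (row r) (row s) (meeting i≢j (column r) (column s)))
      }
      where
      power : ∀ x y u → cross i≢j x y u ^ᶜ q ≈ᶜ 1ᶜ
      power x y u = ℂᴿ.trans (^-congʳ (cross i≢j x y u) q≡m*k)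
        (ℂᴿ.trans (ℂᴿ.sym (^-assocʳ (cross i≢j x y u) m k))
          (ℂᴿ.trans (^-congˡ k (cross-rootOfUnity i≢j x y u)) (1^ k)))

  W-mutuallyQuasiUnbiased : ∀ k → q ≡ m ℕ.* k →
    Σ[ W ∈ (Fin q → Matrix (q ℕ.* q)) ]
      ((∀ i → IsUnitWeighing (q ℕ.* q) q (W i))
      × (∀ i j → i ≢ j → IsQuasiUnbiased (q ℕ.* q) q (q ℕ.* q) (ι 1ℚ) (W i) (W j))
      × (∀ i j → i ≢ j → IsBushType q (W i · W j ⁎) × IsButson (q ℕ.* q) q (W i · W j ⁎)))
  W-mutuallyQuasiUnbiased k q≡m*k = W , W-isUnitWeighing , (λ i j → isQuasiUnbiased)
    , (λ i j i≢j → isBushType i≢j , isButson i≢j k q≡m*k)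

module PrimePower {p : ℕ} (p-prime : Prime p) (e : ℕ) where

  1<p : 1 ℕ.< p
  1<p = ℕ.nonTrivial⇒n>1 p {{prime⇒nonTrivial p-prime}}

  2≤q : 2 ℕ.≤ p ℕ.^ suc e
  2≤q = ℕ.≤-trans 1<p (ℕ.m≤m*n p (p ℕ.^ e) {{ℕ.m^n≢0 p e {{prime⇒nonZero p-prime}}}})

  open PrimitiveRoot 1<p

  abstract
    plane : Plane (p ℕ.^ suc e)
    -- The parameter n is q - 2, the exponent that inverts nonzero field elements.
    plane = Galois.plane p-prime e (p ℕ.^ suc e ℕ.∸ 2) (≡.sym (ℕ.m+[n∸m]≡n 2≤q))

    fourier : Fourier (p ℕ.^ suc e) p
    fourier = PrimeFourier.powerFourier p-prime ω ω-unimodular ω^p≈1 cancel (suc e)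

open import Data.Nat.Base using (_*_)

theorem6p3 : (q : ℕ) → IsPrimePower q →
    Σ[ W ∈ (Fin q → Matrix (q * q)) ]
    ((∀ i → IsUnitWeighing (q * q) q (W i))
    × (∀ i j → i ≢ j → IsQuasiUnbiased (q * q) q (q * q) (ι 1ℚ) (W i) (W j))
    × (∀ i j → i ≢ j → IsBushType q (W i · W j ⁎) × IsButson (q * q) q (W i · W j ⁎)))
-- The exponent 0 is excluded by `1 ≤ e`, and p ^ suc e unfolds to p * p ^ e, which provides the
-- factorisation m * k of q.
theorem6p3 _ (p , suc e , p-prime , _ , ≡.refl) =
  Matrices.W-mutuallyQuasiUnbiased plane fourier (p ℕ.^ e) ≡.refl
  where open PrimePower p-prime e
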